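{- Fix positive integers $r,m$ with $\omega=\frac{r}{m}\le \frac12$, an odd prime $p$ of the form $p=lm+1$ with $l$ a positive integer, and positive integers $k,n$ with $n\ge 2k$. Let $T_s(z,q)\in\mathbb{Z}[z,q]$, $s=0,1,2,\dots$, be the polynomials defined in the context below. Then for every $s\ge 1$, $$ \frac{T_{s+1}(z,q)}{T_{s}(z^p,q^p)} \equiv \frac{T_{s}(z,q)}{T_{s-1}(z^p,q^p)} \pmod{[p^s]_q}, $$ where $[p^s]_q=\frac{1-q^{p^s}}{1-q}=1+q+\dots+q^{p^s-1}$; that is, the difference of the two sides is divisible by the polynomial $[p^s]_q$ (equivalently, $T_{s+1}(z,q)\,T_{s-1}(z^p,q^p)-T_s(z,q)\,T_s(z^p,q^p)$ is divisible by $[p^s]_q$ in $\mathbb{Z}[z,q]$).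
   Context: Setting. Let $\omega=r/m\le 1/2$ ($r,m$ positive integers), $p=lm+1$ an odd prime, and $n\ge 2k$ positive integers. For $1\le i\le n-1$ define $\mathrm{v}_i=i$ if $i<k$, $\mathrm{v}_i=k$ if $k\le i\le n-k$, and $\mathrm{v}_i=n-i$ if $i>n-k$. Introduce variables $x_{i,j}$ for $1\le i\le n-1$, $1\le j\le \mathrm{v}_i$, and a variable $z$ and a parameter $q$. Note that $(p^s-1)\omega$ and $\frac{(p^s-1)(1-2\omega)}{2}$ are nonnegative integers. For $s\ge 0$ define $$ \overline{\Phi}_s(x,z,q)=\Big(\prod_{i=1}^{n-1}\prod_{j=1}^{\mathrm{v}_i}x_{i,j}\Big)^{(p^s-1)(1-\omega)}\prod_{i=1}^{n-1}\prod_{\substack{1\le a\ne b\le \mathrm{v}_i}}\ \prod_{t=0}^{\frac{(p^s-1)(1-2\omega)}{2}-1}(x_{i,a}-q^{t}x_{i,b}) $$ $$ \times\prod_{i=1}^{n-2}\prod_{a=1}^{\mathrm{v}_i}\prod_{b=1}^{\mathrm{v}_{i+1}}\prod_{t=0}^{(p^s-1)\omega-1}(x_{i,a}-q^{t}x_{i+1,b})\times\prod_{a=1}^{k}\prod_{t=0}^{(p^s-1)\omega-1}(z-q^{t}x_{k,a})(1-q^{t}x_{n-k,a}), $$ (empty products equal $1$), let $\Delta(x)=\prod_{i=1}^{n-1}\prod_{1\le a<b\le \mathrm{v}_i}(x_{i,b}-x_{i,a})$, and $\Phi_s(x,z,q)=\Delta(x)\,\overline{\Phi}_s(x,z,q)$.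 Define $$ T_s(z,q)=(-1)^{(p^s-1)N\omega}\,\mathrm{coeff}_{x^{dp^s-1}}\,\Phi_s(x,z,q), $$ the (sign-adjusted) coefficient of the monomial $x^{dp^s-1}:=\prod_{i=1}^{n-1}\prod_{j=1}^{\mathrm{v}_i}x_{i,j}^{\,j p^s-1}$ in $\Phi_s(x,z,q)$, viewed as a polynomial in the $x_{i,j}$ with coefficients in $\mathbb{Z}[z,q]$. Here $N$ is a fixed integer independent of $s$ (it only fixes an overall sign normalization). In particular $T_0(z,q)=1$. -}

module Defs where

open import Data.Nat as ℕ using (ℕ; zero; suc; _∸_; _+_; _*_; _^_; _≡ᵇ_; _<ᵇ_; _≤ᵇ_; NonZero)
open import Data.Nat.DivMod using (_/_; _%_)
open import Data.Integer as ℤ using (ℤ; +_; ∣_∣)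
open import Data.List using (List; []; _∷_; map; concatMap; foldr; filterᵇ; upTo)
open import Data.Bool.ListAction using (and)
open import Data.Product using (_×_; _,_; ∃)
open import Data.Bool using (Bool; true; false; if_then_else_; _∧_)
open import Relation.Binary.PropositionalEquality using (_≡_)

range1 : ℕ → List ℕ
range1 n = map suc (upTo n)

vdim : ℕ → ℕ → ℕ → ℕ
vdim n k i = if i <ᵇ k then i else (if i ≤ᵇ n ∸ k then k else n ∸ i)

vars : ℕ → ℕ → List (ℕ × ℕ)
vars n k = concatMap (λ i → map (λ j → (i , j)) (range1 (vdim n k i))) (range1 (n ∸ 1))

-- Polynomials in z, q and the x_{i,j} over ℤ, as (unnormalised) formal
-- sums of terms  c · z^ez · q^eq · ∏ x_{i,j}^(ex i j).

record Term : Set where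
  constructor term
  field
    coef : ℤ
    ez   : ℕ
    eqq  : ℕ
    ex   : ℕ → ℕ → ℕ
open Term public

Poly : Set
Poly = List Term

mulT : Term → Term → Term
mulT (term c a b e) (term c' a' b' e') =
  term (c ℤ.* c') (a + a') (b + b') (λ i j → e i j + e' i j)

mulP : Poly → Poly → Poly
mulP P Q = concatMap (λ s → map (mulT s) Q) P

noX : ℕ → ℕ → ℕ
noX _ _ = 0

oneP : Poly
oneP = term (+ 1) 0 0 noX ∷ []

prodP : List Poly → Poly
prodP = foldr mulP oneP

prodOver : {A : Set} → List A → (A → Poly) → Poly
prodOver xs f = prodP (map f xs)

xv : ℕ → ℕ → ℕ → (ℕ → ℕ → ℕ)
xv i j e i' j' = if (i' ≡ᵇ i) ∧ (j' ≡ᵇ j) then e else 0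

binX : ℕ → ℕ → ℕ → ℕ → ℕ → Poly
binX i a t i' b = term (+ 1) 0 0 (xv i a 1) ∷ term (ℤ.- + 1) 0 t (xv i' b 1) ∷ []

binZ : ℕ → ℕ → ℕ → Poly
binZ t i a = term (+ 1) 1 0 noX ∷ term (ℤ.- + 1) 0 t (xv i a 1) ∷ []

bin1 : ℕ → ℕ → ℕ → Poly
bin1 t i a = term (+ 1) 0 0 noX ∷ term (ℤ.- + 1) 0 t (xv i a 1) ∷ []

-- The exponents  (p^s-1)(1-ω), (p^s-1)ω, (p^s-1)(1-2ω)/2  (exact divisions)

module _ (p r m n k s : ℕ) .{{_ : NonZero m}} where

  E1 : ℕ
  E1 = ((p ^ s ∸ 1) * (m ∸ r)) / m

  Eω : ℕ
  Eω = ((p ^ s ∸ 1) * r) / m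

  Eh : ℕ
  Eh = (((p ^ s ∸ 1) * (m ∸ 2 * r)) / m) / 2

  Δ : Poly
  Δ = prodOver (range1 (n ∸ 1)) λ i →
        prodOver (range1 (vdim n k i)) λ a →
          prodOver (range1 (vdim n k i)) λ b →
            if a <ᵇ b then binX i b 0 i a else oneP

  Φbar : Poly
  Φbar = prodP
    ( prodOver (vars n k) (λ { (i , j) → term (+ 1) 0 0 (xv i j E1) ∷ [] })
    ∷ prodOver (range1 (n ∸ 1)) (λ i →
        prodOver (range1 (vdim n k i)) λ a →
          prodOver (range1 (vdim n k i)) λ b →
            if a ≡ᵇ b then oneP else
              prodOver (upTo Eh) λ t → binX i a t i b)
    ∷ prodOver (range1 (n ∸ 2)) (λ i →
        prodOver (range1 (vdim n k i)) λ a →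
          prodOver (range1 (vdim n k (suc i))) λ b →
            prodOver (upTo Eω) λ t → binX i a t (suc i) b)
    ∷ prodOver (range1 k) (λ a →
        prodOver (upTo Eω) λ t → mulP (binZ t k a) (bin1 t (n ∸ k) a))
    ∷ [] )

  Φ : Poly
  Φ = mulP Δ Φbar

-- Polynomials in z, q over ℤ: formal sums of (c , ez , eq)

P2 : Set
P2 = List (ℤ × ℕ × ℕ)

mul2 : P2 → P2 → P2
mul2 A B = concatMap (λ { (c , a , b) → map (λ { (c' , a' , b') → (c ℤ.* c' , a + a' , b + b') }) B }) A

neg2 : P2 → P2
neg2 = map (λ { (c , a , b) → (ℤ.- c , a , b) })

sub2 : P2 → P2 → P2
sub2 A B = foldr _∷_ (neg2 B) A

frob : ℕ → P2 → P2
frob p = map (λ { (c , a , b) → (c , p * a , p * b) })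

coeff2 : P2 → ℕ → ℕ → ℤ
coeff2 A a b = foldr (λ { (c , a' , b') acc → if (a' ≡ᵇ a) ∧ (b' ≡ᵇ b) then c ℤ.+ acc else acc }) (+ 0) A

_∣₂_ : P2 → P2 → Set
D ∣₂ A = ∃ λ (Q : P2) → ∀ a b → coeff2 A a b ≡ coeff2 (mul2 Q D) a b

qint : ℕ → ℕ → P2
qint p s = map (λ i → (+ 1 , 0 , i)) (upTo (p ^ s))

isTarget : ℕ → ℕ → ℕ → ℕ → Term → Bool
isTarget p n k s t = and (map (λ { (i , j) → ex t i j ≡ᵇ (j * p ^ s ∸ 1) }) (vars n k))

coeffX : ℕ → ℕ → ℕ → ℕ → Poly → P2
coeffX p n k s P = map (λ t → (coef t , ez t , eqq t)) (filterᵇ (isTarget p n k s) P)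

-- N is the fixed sign-normalisation integer; (-1)^e depends only on the
-- parity of e, so we use |N|.
Tpoly : (p r m n k : ℕ) → .{{_ : NonZero m}} → ℤ → ℕ → P2
Tpoly p r m n k N s =
  if ((Eω p r m n k s * ∣ N ∣) % 2) ≡ᵇ 0 then C else neg2 C
  where C = coeffX p n k s (Φ p r m n k s)

{-# OPTIONS --safe #-}
-- Modulo the cyclotomic factor C_j of [p^s]_q, the q-binomial theorem collapses
-- ∏_{t<p^j} (x - q^t y) to x^{p^j} - y^{p^j}, so that the master polynomial factors as
-- Φbar_{j+t}(x, z, q) ≡ Φbar_j(x, z, q) Φbar_t(x^{p^j}, z^{p^j}, 1).  In the coefficient
-- extraction only exponents -1 modulo p^j of the first factor Φ_j = Δ Φbar_j matter; a degree
-- bound and the antisymmetry of Φ_j make its coefficients there proportional to those of the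
-- Vandermonde product Δ.  Hence T_{j+t}(z, q) ≡ T_j(z, q) T_t(z^{p^j}, 1) modulo C_j for all t,
-- and the two products in the theorem agree modulo every C_j with 1 ≤ j ≤ s.
--
-- No roots of unity are used: the quotient by C_j is represented by the ℤ-valued functionals
-- that kill its multiples, which makes it torsion-free and lets the congruences modulo the C_j
-- be combined into divisibility by their product [p^s]_q.
module Submission where

-- Write P = p^j. The proportionality to Δ rests on a balance of exponents: E1 + Eω and 2 Eh + 2 Eω
-- both equal P - 1 at level j, and v_{i-1} + v_{i+1} + [i = k] + [i = n-k] is at most 2 v_i.
-- Together they keep the degree of Φ_j in x_{i,a} strictly below P v_i + P - 1. A nonzero
-- coefficient at x^{P u + P - 1} therefore has all u_{i,a} < v_i. Antisymmetry excludes repeated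
-- entries, so u permutes 0, ..., v_i - 1 in each group, and only its sign matters. Summing these
-- signs against the terms of Φbar_t restores Δ Φbar_t = Φ_t.
--
-- Torsion-freeness is used twice. For 0 < i < P the element q^i - 1 is not invertible modulo C_j:
-- it only divides p. Nor are the C_j pairwise comaximal over the integers, so gluing the
-- congruences again costs factors of p.
--
-- For the conclusion, T(z^p, q^p) must be split modulo the same C_j. Since C_{j-1}(q^p) = C_j(q),
-- the previous splitting can be twisted by Frobenius; for j = 1, q^p is already 1. Both splittings
-- have one factor independent of t, so t and t + 1 can be exchanged between them.

-- Solving identities in commutative rings without decidable equality.

module RingSolver where
  open import Algebra.Bundles using (CommutativeRing; RawRing)
  open import Data.Nat as ℕ using (ℕ)
  open import Data.Maybe using (Maybe; just; nothing)
  open import Data.Product using (_×_; _,_)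
  open import Relation.Nullary using (yes; no)
  open import Level using (0ℓ)
  import Relation.Binary.PropositionalEquality as ≡
  import Algebra.Solver.Ring
  import Algebra.Solver.Ring.AlmostCommutativeRing as ACR
  import Algebra.Solver.Ring.NaturalCoefficients.Default

  -- Coefficients are formal differences of naturals, so that the solver can
  -- cancel without deciding equality in the ring.
  module DifferenceSolver {c ℓ} (R : CommutativeRing c ℓ) where
    open CommutativeRing R
    open import Algebra.Properties.Semiring.Mult semiring using (×-homo-+; ×1-homo-*) renaming (_×_ to _⋆_)
    open import Algebra.Properties.Ring ring
    open import Relation.Binary.Reasoning.Setoid setoid
    private
      module N = Algebra.Solver.Ring.NaturalCoefficients.Default commutativeSemiring

      Diff : RawRing 0ℓ 0ℓ
      Diff = record
        { Carrier = ℕ × ℕ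
        ; _≈_ = ≡._≡_
        ; _+_ = λ { (a , b) (c , d) → a ℕ.+ c , b ℕ.+ d }
        ; _*_ = λ { (a , b) (c , d) → a ℕ.* c ℕ.+ b ℕ.* d , a ℕ.* d ℕ.+ b ℕ.* c }
        ; -_ = λ { (a , b) → b , a }
        ; 0# = 0 , 0
        ; 1# = 1 , 0
        }

      cancel : ∀ x y z w → x + w ≈ z + y → x - y ≈ z - w
      cancel x y z w e = begin
        x - y ≈⟨ sym (+-identityʳ _) ⟩
        x - y + 0# ≈⟨ +-congˡ (sym (-‿inverseʳ w)) ⟩
        x - y + (w - w) ≈⟨ N.solve 4 (λ x y w w' → (x N.:+ y) N.:+ (w N.:+ w') N.:= (x N.:+ w) N.:+ (y N.:+ w')) refl x (- y) w (- w) ⟩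
        (x + w) + (- y - w) ≈⟨ +-congʳ e ⟩
        (z + y) + (- y - w) ≈⟨ N.solve 4 (λ x y w w' → (x N.:+ y) N.:+ (w N.:+ w') N.:= (x N.:+ w') N.:+ (y N.:+ w)) refl z y (- y) (- w) ⟩
        (z - w) + (y - y) ≈⟨ +-congˡ (-‿inverseʳ y) ⟩
        z - w + 0# ≈⟨ +-identityʳ _ ⟩
        z - w ∎

      ⟦_⟧ : ℕ × ℕ → Carrier
      ⟦ a , b ⟧ = a ⋆ 1# - b ⋆ 1#

      neg*neg : ∀ x y → - x * - y ≈ x * y
      neg*neg x y = begin
        - x * - y ≈⟨ sym (-‿distribˡ-* x (- y)) ⟩
        - (x * - y) ≈⟨ -‿cong (sym (-‿distribʳ-* x y)) ⟩
        - - (x * y) ≈⟨ -‿involutive (x * y) ⟩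
        x * y ∎

      morphism : Diff ACR.-Raw-AlmostCommutative⟶ ACR.fromCommutativeRing R
      morphism = record
        { ⟦_⟧ = ⟦_⟧
        ; +-homo = λ { (a , b) (c , d) → begin
            (a ℕ.+ c) ⋆ 1# - (b ℕ.+ d) ⋆ 1# ≈⟨ +-cong (×-homo-+ 1# a c) (-‿cong (×-homo-+ 1# b d)) ⟩
            (a ⋆ 1# + c ⋆ 1#) - (b ⋆ 1# + d ⋆ 1#) ≈⟨ +-congˡ (sym (-‿+-comm _ _)) ⟩
            (a ⋆ 1# + c ⋆ 1#) + (- (b ⋆ 1#) - (d ⋆ 1#))
              ≈⟨ N.solve 4 (λ x y w w' → (x N.:+ y) N.:+ (w N.:+ w') N.:= (x N.:+ w) N.:+ (y N.:+ w')) refl _ _ _ _ ⟩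
            ⟦ a , b ⟧ + ⟦ c , d ⟧ ∎ }
        ; *-homo = λ { (a , b) (c , d) → begin
            (a ℕ.* c ℕ.+ b ℕ.* d) ⋆ 1# - (a ℕ.* d ℕ.+ b ℕ.* c) ⋆ 1#
              ≈⟨ +-cong (prod a c b d) (-‿cong (prod a d b c)) ⟩
            (a ⋆ 1# * c ⋆ 1# + b ⋆ 1# * d ⋆ 1#) - (a ⋆ 1# * d ⋆ 1# + b ⋆ 1# * c ⋆ 1#)
              ≈⟨ +-cong (+-congˡ (sym (neg*neg _ _))) (trans (sym (-‿+-comm _ _)) (+-cong (-‿distribʳ-* _ _) (-‿distribˡ-* _ _))) ⟩
            (a ⋆ 1# * c ⋆ 1# + - (b ⋆ 1#) * - (d ⋆ 1#)) + (a ⋆ 1# * - (d ⋆ 1#) + - (b ⋆ 1#) * c ⋆ 1#)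
              ≈⟨ N.solve 4 (λ x y w w' → (x N.:* w N.:+ y N.:* w') N.:+ (x N.:* w' N.:+ y N.:* w) N.:= (x N.:+ y) N.:* (w N.:+ w')) refl _ _ _ _ ⟩
            ⟦ a , b ⟧ * ⟦ c , d ⟧ ∎ }
        ; -‿homo = λ { (a , b) → begin
            b ⋆ 1# - a ⋆ 1# ≈⟨ sym (⁻¹-anti-homo‿- (a ⋆ 1#) (b ⋆ 1#)) ⟩
            - (a ⋆ 1# - b ⋆ 1#) ∎ }
        ; 0-homo = -‿inverseʳ 0#
        ; 1-homo = trans (+-cong (+-identityʳ 1#) -0#≈0#) (+-identityʳ 1#)
        }
        where
        prod : ∀ a b c d → (a ℕ.* b ℕ.+ c ℕ.* d) ⋆ 1# ≈ a ⋆ 1# * b ⋆ 1# + c ⋆ 1# * d ⋆ 1#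
        prod a b c d = trans (×-homo-+ 1# (a ℕ.* b) (c ℕ.* d)) (+-cong (×1-homo-* a b) (×1-homo-* c d))

      _≟_ : ∀ x y → Maybe (⟦ x ⟧ ≈ ⟦ y ⟧)
      (a , b) ≟ (c , d) with a ℕ.+ d ℕ.≟ c ℕ.+ b
      ... | no _ = nothing
      ... | yes e = just (cancel _ _ _ _ (begin
        a ⋆ 1# + d ⋆ 1# ≈⟨ sym (×-homo-+ 1# a d) ⟩
        (a ℕ.+ d) ⋆ 1# ≡⟨ ≡.cong (_⋆ 1#) e ⟩
        (c ℕ.+ b) ⋆ 1# ≈⟨ ×-homo-+ 1# c b ⟩
        c ⋆ 1# + b ⋆ 1# ∎))

    open Algebra.Solver.Ring Diff (ACR.fromCommutativeRing R) morphism _≟_ public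
      using (solve; _:=_; _:+_; _:*_; _:-_; :-_; con)

-- The q-binomial theorem and its collapse modulo a cyclotomic factor.

module QBinomial where
  open RingSolver
  open import Algebra.Bundles using (CommutativeRing)
  open import Data.Nat as ℕ using (ℕ; zero; suc; z≤n; s≤s; _<_)
  import Data.Nat.Properties as ℕ
  open import Data.Nat.Divisibility using (_∣_; divides)
  open import Data.Nat.GCD using (gcd; gcd-GCD; module Bézout)
  open import Data.Nat.Solver using (module +-*-Solver)
  open import Function using (_∘_)
  open import Relation.Binary.PropositionalEquality as ≡ using (_≡_)

  -- The transposition of `c` and `suc c`. Structural recursion makes it commute with shifting the
  -- index, so that products can be handled by peeling off their first factor.
  sw : ℕ → ℕ → ℕ
  sw zero    zero          = 1
  sw zero    (suc zero)    = 0
  sw zero    (suc (suc a)) = suc (suc a)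
  sw (suc c) zero          = zero
  sw (suc c) (suc a)       = suc (sw c a)

  module RingProducts {c ℓ} (R : CommutativeRing c ℓ) where
    open CommutativeRing R
    open import Algebra.Properties.Ring ring
    open import Algebra.Properties.CommutativeSemiring.Exp commutativeSemiring public
    open import Algebra.Properties.Semiring.Mult semiring using () renaming (_×_ to _⋆_) public
    open import Relation.Binary.Reasoning.Setoid setoid
    open DifferenceSolver R

    ∏ : ℕ → (ℕ → Carrier) → Carrier
    ∏ zero    f = 1#
    ∏ (suc n) f = f 0 * ∏ n (f ∘ suc)

    ∑ : ℕ → (ℕ → Carrier) → Carrier
    ∑ zero    f = 0#
    ∑ (suc n) f = f 0 + ∑ n (f ∘ suc)

    ∏-cong : ∀ n {f g} → (∀ i → f i ≈ g i) → ∏ n f ≈ ∏ n g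
    ∏-cong zero    e = refl
    ∏-cong (suc n) e = *-cong (e 0) (∏-cong n (e ∘ suc))

    ∏-* : ∀ n f g → ∏ n (λ i → f i * g i) ≈ ∏ n f * ∏ n g
    ∏-* zero    f g = sym (*-identityʳ 1#)
    ∏-* (suc n) f g = trans (*-congˡ (∏-* n (f ∘ suc) (g ∘ suc)))
      (solve 4 (λ a b c d → (a :* b) :* (c :* d) := (a :* c) :* (b :* d)) refl _ _ _ _)

    ∏-+ : ∀ m n f → ∏ (m ℕ.+ n) f ≈ ∏ m f * ∏ n (λ i → f (m ℕ.+ i))
    ∏-+ zero    n f = sym (*-identityˡ _)
    ∏-+ (suc m) n f = trans (*-congˡ (∏-+ m n (f ∘ suc))) (sym (*-assoc _ _ _))

    ∏-sw : ∀ n c f → suc c < n → ∏ n (f ∘ sw c) ≈ ∏ n f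
    ∏-sw (suc (suc n)) zero    f _       =
      solve 3 (λ a b c → a :* (b :* c) := b :* (a :* c)) refl _ _ _
    ∏-sw (suc n)       (suc c) f (s≤s l) = *-congˡ (∏-sw n c (f ∘ suc) l)

    1^n≈1 : ∀ n → 1# ^ n ≈ 1#
    1^n≈1 zero    = refl
    1^n≈1 (suc n) = trans (*-identityˡ _) (1^n≈1 n)

    ∏-const : ∀ n {f} {w} → (∀ i → f i ≈ w) → ∏ n f ≈ w ^ n
    ∏-const zero    e = refl
    ∏-const (suc n) e = *-cong (e 0) (∏-const n (e ∘ suc))

    geometric : ∀ n y → y * ∑ n (y ^_) + 1# ≈ ∑ n (y ^_) + y ^ n
    geometric n y = go n 1# (y ^_) refl (λ _ → refl)
      where
      -- Any sequence of ratio `y` is allowed, so that the induction may drop the first term.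
      go : ∀ n u f → f 0 ≈ u → (∀ i → f (suc i) ≈ y * f i) →
           y * ∑ n f + u ≈ ∑ n f + f n
      go zero    u f f0 fs = +-cong (zeroʳ y) (sym f0)
      go (suc n) u f f0 fs = begin
        y * (f 0 + ∑ n (f ∘ suc)) + u ≈⟨ solve 4 (λ y a s u → y :* (a :+ s) :+ u := u :+ (y :* s :+ y :* a)) refl _ _ _ _ ⟩
        u + (y * ∑ n (f ∘ suc) + y * f 0) ≈⟨ +-cong (sym f0) (go n _ (f ∘ suc) (fs 0) (fs ∘ suc)) ⟩
        f 0 + (∑ n (f ∘ suc) + f (suc n)) ≈⟨ sym (+-assoc _ _ _) ⟩
        ∑ (suc n) f + f (suc n) ∎

    -- The last move of the congruence: two split products trade the factors that depend on t.
    *-exchange : ∀ a b c d → (a * b) * (c * d) ≈ (c * b) * (a * d)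
    *-exchange = solve 4 (λ a b c d → (a :* b) :* (c :* d) := (c :* b) :* (a :* d)) refl

    module Gauss (q : Carrier) where

      -- The signed q-binomial coefficient (-1)^i q^{i(i-1)/2} [n choose i]_q, given by the Pascal
      -- rule that results from splitting off the factor x - y.
      gauss : ℕ → ℕ → Carrier
      gauss zero    zero    = 1#
      gauss zero    (suc i) = 0#
      gauss (suc n) zero    = 1#
      gauss (suc n) (suc i) = q ^ suc i * gauss n (suc i) - q ^ i * gauss n i

      gauss-0 : ∀ n → gauss n 0 ≈ 1#
      gauss-0 zero    = refl
      gauss-0 (suc n) = refl

      gauss-vanish : ∀ {n i} → n < i → gauss n i ≈ 0#
      gauss-vanish {zero}  {suc i} _       = refl
      gauss-vanish {suc n} {suc i} (s≤s l) = begin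
        q ^ suc i * gauss n (suc i) - q ^ i * gauss n i
          ≈⟨ +-cong (*-congˡ (gauss-vanish (ℕ.m<n⇒m<1+n l))) (-‿cong (*-congˡ (gauss-vanish l))) ⟩
        q ^ suc i * 0# - q ^ i * 0# ≈⟨ +-cong (zeroʳ _) (-‿cong (zeroʳ _)) ⟩
        0# - 0# ≈⟨ -‿inverseʳ 0# ⟩
        0# ∎

      -- The ratio of neighbouring q-binomial coefficients with denominators cleared: (q^{i+1} - 1)
      -- g_{i+1} = (q^i - q^n) g_i. When q^n = 1 it becomes a recursion for the elements (q^i - 1)
      -- g_i.
      gauss-ratio : ∀ n i → q ^ suc i * gauss n (suc i) - gauss n (suc i)
                          ≈ q ^ i * gauss n i - q ^ n * gauss n i
      gauss-ratio zero zero = begin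
        q ^ 1 * 0# - 0# ≈⟨ +-congʳ (zeroʳ _) ⟩
        0# - 0# ≈⟨ -‿inverseʳ 0# ⟩
        0# ≈⟨ sym (-‿inverseʳ (1# * 1#)) ⟩
        1# * 1# - 1# * 1# ∎
      gauss-ratio zero (suc i) = begin
        q ^ suc (suc i) * 0# - 0# ≈⟨ +-congʳ (zeroʳ _) ⟩
        0# - 0# ≈⟨ +-cong (sym (zeroʳ _)) (-‿cong (sym (zeroʳ _))) ⟩
        q ^ suc i * 0# - 1# * 0# ∎
      gauss-ratio (suc n) zero = begin
        q * u * (q * u * g1 - u * g0) - (q * u * g1 - u * g0)
          ≈⟨ solve 4 (λ q u g1 g0 → q :* u :* (q :* u :* g1 :- u :* g0) :- (q :* u :* g1 :- u :* g0)
               := (q :* u :* (q :* u :* g1 :- g1) :- q :* u :* (u :* g0)) :+ u :* g0) refl q u g1 g0 ⟩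
        (q * u * (q * u * g1 - g1) - q * u * (u * g0)) + u * g0
          ≈⟨ +-congʳ (+-congʳ (*-congˡ (gauss-ratio n 0))) ⟩
        (q * u * (u * g0 - N * g0) - q * u * (u * g0)) + u * g0
          ≈⟨ solve 4 (λ q u g0 N → (q :* u :* (u :* g0 :- N :* g0) :- q :* u :* (u :* g0)) :+ u :* g0
               := u :* g0 :- u :* (q :* N :* g0)) refl q u g0 N ⟩
        u * g0 - u * (q * N * g0)
          ≈⟨ +-cong (*-congˡ (gauss-0 n)) (-‿cong (trans (*-identityˡ _) (*-congˡ (gauss-0 n)))) ⟩
        u * 1# - q * N * 1# ∎
        where
        u = q ^ 0
        N = q ^ n
        g0 = gauss n 0
        g1 = gauss n 1
      gauss-ratio (suc n) (suc i) = begin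
        q * (q * A) * (q * (q * A) * g2 - q * A * g1) - (q * (q * A) * g2 - q * A * g1)
          ≈⟨ solve 4 (λ q A g1 g2 → q :* (q :* A) :* (q :* (q :* A) :* g2 :- q :* A :* g1) :- (q :* (q :* A) :* g2 :- q :* A :* g1)
               := q :* (q :* A) :* (q :* (q :* A) :* g2 :- g2) :- q :* A :* (q :* (q :* A) :* g1 :- g1)) refl q A g1 g2 ⟩
        q * (q * A) * (q * (q * A) * g2 - g2) - q * A * (q * (q * A) * g1 - g1)
          ≈⟨ +-congʳ (*-congˡ (gauss-ratio n (suc i))) ⟩
        q * (q * A) * (q * A * g1 - N * g1) - q * A * (q * (q * A) * g1 - g1)
          ≈⟨ solve 4 (λ q A g1 N → q :* (q :* A) :* (q :* A :* g1 :- N :* g1) :- q :* A :* (q :* (q :* A) :* g1 :- g1)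
               := (q :* A :* (q :* A :* g1) :- q :* N :* (q :* A :* g1)) :- q :* A :* (q :* A :* g1 :- g1)) refl q A g1 N ⟩
        (q * A * (q * A * g1) - q * N * (q * A * g1)) - q * A * (q * A * g1 - g1)
          ≈⟨ +-congˡ (-‿cong (*-congˡ (gauss-ratio n i))) ⟩
        (q * A * (q * A * g1) - q * N * (q * A * g1)) - q * A * (A * g0 - N * g0)
          ≈⟨ solve 5 (λ q A g0 g1 N → (q :* A :* (q :* A :* g1) :- q :* N :* (q :* A :* g1)) :- q :* A :* (A :* g0 :- N :* g0)
               := q :* A :* (q :* A :* g1 :- A :* g0) :- q :* N :* (q :* A :* g1 :- A :* g0)) refl q A g0 g1 N ⟩
        q * A * (q * A * g1 - A * g0) - q * N * (q * A * g1 - A * g0) ∎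
        where
        A = q ^ i
        N = q ^ n
        g0 = gauss n i
        g1 = gauss n (suc i)
        g2 = gauss n (suc (suc i))

      gauss-top : ∀ n → gauss (suc n) (suc n) ≈ - (q ^ n * gauss n n)
      gauss-top n = trans (+-congʳ (trans (*-congˡ (gauss-vanish (ℕ.n<1+n n))) (zeroʳ _))) (+-identityˡ _)

      -- The exponent n(n-1)/2 equals n u for n = 2u + 1, a multiple of n, so the power of q
      -- disappears once q^n = 1; the sign is (-1)^n.
      gauss-top-odd : ∀ u {n} → n ≡ suc (2 ℕ.* u) → gauss n n ≈ - (q ^ (n ℕ.* u))
      gauss-top-odd zero ≡.refl = trans (gauss-top 0) (-‿cong (*-identityʳ _))
      gauss-top-odd (suc u) e with ≡.trans e (≡.cong suc (ℕ.*-suc 2 u))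
      ... | ≡.refl = begin
        gauss (3 ℕ.+ w) (3 ℕ.+ w) ≈⟨ gauss-top (2 ℕ.+ w) ⟩
        - (q ^ (2 ℕ.+ w) * gauss (2 ℕ.+ w) (2 ℕ.+ w)) ≈⟨ -‿cong (*-congˡ (gauss-top (1 ℕ.+ w))) ⟩
        - (q ^ (2 ℕ.+ w) * - (q ^ (1 ℕ.+ w) * gauss (1 ℕ.+ w) (1 ℕ.+ w))) ≈⟨ -‿cong (*-congˡ (-‿cong (*-congˡ (gauss-top-odd u ≡.refl)))) ⟩
        - (q ^ (2 ℕ.+ w) * - (q ^ (1 ℕ.+ w) * - (q ^ ((1 ℕ.+ w) ℕ.* u))))
          ≈⟨ solve 3 (λ a b c → :- (a :* (:- (b :* (:- c)))) := :- (a :* (b :* c))) refl _ _ _ ⟩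
        - (q ^ (2 ℕ.+ w) * (q ^ (1 ℕ.+ w) * q ^ ((1 ℕ.+ w) ℕ.* u)))
          ≈⟨ -‿cong (sym (trans (^-homo-* q (2 ℕ.+ w) _) (*-congˡ (^-homo-* q (1 ℕ.+ w) _)))) ⟩
        - (q ^ ((2 ℕ.+ w) ℕ.+ ((1 ℕ.+ w) ℕ.+ (1 ℕ.+ w) ℕ.* u)))
          ≡⟨ ≡.cong (λ e → - (q ^ e)) (NS.solve 1 (λ u → (NS.con 2 NS.:+ NS.con 2 NS.:* u) NS.:+ ((NS.con 1 NS.:+ NS.con 2 NS.:* u) NS.:+ (NS.con 1 NS.:+ NS.con 2 NS.:* u) NS.:* u)
               NS.:= (NS.con 3 NS.:+ NS.con 2 NS.:* u) NS.:* (NS.con 1 NS.:+ u)) ≡.refl u) ⟩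
        - (q ^ ((3 ℕ.+ w) ℕ.* suc u)) ∎
        where
        w = 2 ℕ.* u
        module NS = +-*-Solver

      -- The binary form with terms f(i) x^{n-i} y^i, in Horner form.
      homog : ℕ → (ℕ → Carrier) → Carrier → Carrier → Carrier
      homog zero    f x y = f 0
      homog (suc n) f x y = x ^ suc n * f 0 + y * homog n (f ∘ suc) x y

      homog-cong : ∀ n {f g} x y → (∀ i → f i ≈ g i) → homog n f x y ≈ homog n g x y
      homog-cong zero    x y e = e 0
      homog-cong (suc n) x y e = +-cong (*-congˡ (e 0)) (*-congˡ (homog-cong n x y (e ∘ suc)))

      homog-linear : ∀ n a f x y → homog n (λ i → a * f i) x y ≈ a * homog n f x y
      homog-linear zero    a f x y = refl
      homog-linear (suc n) a f x y = trans (+-congˡ (*-congˡ (homog-linear n a (f ∘ suc) x y)))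
        (solve 5 (λ X a f y h → X :* (a :* f) :+ y :* (a :* h) := a :* (X :* f :+ y :* h)) refl _ _ _ _ _)

      homog-scale : ∀ n f x y → homog n f x (q * y) ≈ homog n (λ i → q ^ i * f i) x y
      homog-scale zero    f x y = sym (*-identityˡ _)
      homog-scale (suc n) f x y = +-cong (*-congˡ (sym (*-identityˡ _))) (begin
        (q * y) * homog n (f ∘ suc) x (q * y) ≈⟨ *-congˡ (homog-scale n (f ∘ suc) x y) ⟩
        (q * y) * homog n (λ i → q ^ i * f (suc i)) x y ≈⟨ solve 3 (λ q y h → (q :* y) :* h := y :* (q :* h)) refl _ _ _ ⟩
        y * (q * homog n (λ i → q ^ i * f (suc i)) x y) ≈⟨ *-congˡ (sym (homog-linear n q _ x y)) ⟩
        y * homog n (λ i → q * (q ^ i * f (suc i))) x y ≈⟨ *-congˡ (homog-cong n x y (λ i → sym (*-assoc q _ _))) ⟩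
        y * homog n (λ i → q ^ suc i * f (suc i)) x y ∎)

      diff : (ℕ → Carrier) → ℕ → Carrier
      diff f zero    = f 0
      diff f (suc i) = f (suc i) - f i

      homog-diff : ∀ n f x y → f (suc n) ≈ 0# → (x - y) * homog n f x y ≈ homog (suc n) (diff f) x y
      homog-diff zero f x y z = begin
        (x - y) * f 0 ≈⟨ solve 3 (λ x y a → (x :- y) :* a := x :* a :+ y :* (:- a)) refl _ _ _ ⟩
        x * f 0 + y * (- f 0) ≈⟨ +-cong (*-congʳ (sym (*-identityʳ x))) (*-congˡ (trans (sym (+-identityˡ _)) (+-congʳ (sym z)))) ⟩
        x ^ 1 * f 0 + y * (f 1 - f 0) ∎
      homog-diff (suc n) f x y z = begin
        (x - y) * (X * f 0 + y * homog n (f ∘ suc) x y)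
          ≈⟨ solve 5 (λ x y X a h → (x :- y) :* (X :* a :+ y :* h) := x :* X :* a :+ y :* ((x :- y) :* h :- X :* a)) refl _ _ _ _ _ ⟩
        x * X * f 0 + y * ((x - y) * homog n (f ∘ suc) x y - X * f 0)
          ≈⟨ +-congˡ (*-congˡ (+-congʳ (homog-diff n (f ∘ suc) x y z))) ⟩
        x * X * f 0 + y * ((X * f 1 + y * homog n _ x y) - X * f 0)
          ≈⟨ +-congˡ (*-congˡ (solve 4 (λ X a b h → (X :* b :+ h) :- X :* a := X :* (b :- a) :+ h) refl _ _ _ _)) ⟩
        x * X * f 0 + y * (X * (f 1 - f 0) + y * homog n _ x y) ∎
        where X = x ^ suc n

      homog-top : ∀ n f x y → (∀ {i} → i < n → f i ≈ 0#) → homog n f x y ≈ y ^ n * f n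
      homog-top zero    f x y v = sym (*-identityˡ _)
      homog-top (suc n) f x y v = begin
        x ^ suc n * f 0 + y * homog n (f ∘ suc) x y ≈⟨ +-cong (trans (*-congˡ (v (s≤s z≤n))) (zeroʳ _)) (*-congˡ (homog-top n (f ∘ suc) x y (λ l → v (s≤s l)))) ⟩
        0# + y * (y ^ n * f (suc n)) ≈⟨ trans (+-identityˡ _) (sym (*-assoc _ _ _)) ⟩
        y ^ suc n * f (suc n) ∎

      qprod : ℕ → Carrier → Carrier → Carrier
      qprod n x y = ∏ n (λ t → x - q ^ t * y)

      qprod-shift : ∀ n a x y → ∏ n (λ t → x - q ^ (a ℕ.+ t) * y) ≈ qprod n x (q ^ a * y)
      qprod-shift n a x y = ∏-cong n λ t → +-congˡ (-‿cong (begin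
        q ^ (a ℕ.+ t) * y ≈⟨ *-congʳ (^-homo-* q a t) ⟩
        q ^ a * q ^ t * y ≈⟨ solve 3 (λ a b c → a :* b :* c := b :* (a :* c)) refl _ _ _ ⟩
        q ^ t * (q ^ a * y) ∎))

      -- Without its first factor x - y the product is the shorter one at q y, and this rescaling
      -- multiplies the i-th coefficient by q^i. Multiplication by x - y then reproduces the Pascal
      -- rule of `gauss`.
      qbinomial : ∀ n x y → qprod n x y ≈ homog n (gauss n) x y
      qbinomial zero    x y = refl
      qbinomial (suc n) x y = begin
        (x - 1# * y) * ∏ n (λ t → x - q ^ suc t * y)
          ≈⟨ *-cong (+-congˡ (-‿cong (*-identityˡ y)))
                    (∏-cong n λ t → +-congˡ (-‿cong (solve 3 (λ a b c → a :* b :* c := b :* (a :* c)) refl q (q ^ t) y))) ⟩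
        (x - y) * qprod n x (q * y) ≈⟨ *-congˡ (qbinomial n x (q * y)) ⟩
        (x - y) * homog n (gauss n) x (q * y) ≈⟨ *-congˡ (homog-scale n (gauss n) x y) ⟩
        (x - y) * homog n f x y
          ≈⟨ homog-diff n f x y (trans (*-congˡ (gauss-vanish (ℕ.n<1+n n))) (zeroʳ _)) ⟩
        homog (suc n) (diff f) x y
          ≈⟨ homog-cong (suc n) {diff f} {gauss (suc n)} x y (λ { zero → trans (*-identityˡ _) (gauss-0 n) ; (suc i) → refl }) ⟩
        homog (suc n) (gauss (suc n)) x y ∎
        where f = λ i → q ^ i * gauss n i

      -- A substitute for a primitive root of unity of order P = p h. `gcd-h` is what is required of
      -- P as a prime power with h = P / p, and `u` records that P is odd, which fixes the sign of
      -- y^P.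
      module Cyclotomic (p h : ℕ)
        (cyclotomic : ∑ p ((q ^ h) ^_) ≈ 0#)
        (torsion-free : ∀ a → p ⋆ a ≈ 0# → a ≈ 0#)
        (gcd-h : ∀ i → 0 < i → i < p ℕ.* h → gcd i (p ℕ.* h) ∣ h)
        (u : ℕ) (odd : p ℕ.* h ≡ suc (2 ℕ.* u)) where

        private
          P = p ℕ.* h

        q^P : q ^ P ≈ 1#
        q^P = begin
          q ^ (p ℕ.* h) ≡⟨ ≡.cong (q ^_) (ℕ.*-comm p h) ⟩
          q ^ (h ℕ.* p) ≈⟨ sym (^-assocʳ q h p) ⟩
          (q ^ h) ^ p ≈⟨ sym (+-identityˡ _) ⟩
          0# + (q ^ h) ^ p ≈⟨ +-congʳ (sym cyclotomic) ⟩
          s + (q ^ h) ^ p ≈⟨ sym (geometric p (q ^ h)) ⟩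
          q ^ h * s + 1# ≈⟨ +-congʳ (trans (*-congˡ cyclotomic) (zeroʳ _)) ⟩
          0# + 1# ≈⟨ +-identityˡ 1# ⟩
          1# ∎
          where s = ∑ p ((q ^ h) ^_)

        q^-* : ∀ i j a → q ^ j * a ≈ a → q ^ (i ℕ.+ j) * a ≈ q ^ i * a
        q^-* i j a fj = trans (*-congʳ (^-homo-* q i j)) (trans (*-assoc _ _ _) (*-congˡ fj))

        q^-multiple : ∀ k i a → q ^ i * a ≈ a → q ^ (k ℕ.* i) * a ≈ a
        q^-multiple zero    i a f = *-identityˡ a
        q^-multiple (suc k) i a f = trans (q^-* i (k ℕ.* i) a (q^-multiple k i a f)) f

        -- Bézout's identity over the naturals leaves a multiple of `P` or `i` next to the gcd; this
        -- is harmless because both powers of q fix `a`.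
        q^-gcd : ∀ i a → q ^ i * a ≈ a → q ^ gcd i P * a ≈ a
        q^-gcd i a f with Bézout.identity (gcd-GCD i P)
        ... | Bézout.+- x y e = trans (sym (q^-* (gcd i P) (y ℕ.* P) a (q^-multiple y P a (trans (*-congʳ q^P) (*-identityˡ a)))))
          (trans (*-congʳ (reflexive (≡.cong (q ^_) e))) (q^-multiple x i a f))
        ... | Bézout.-+ x y e = trans (sym (q^-* (gcd i P) (x ℕ.* i) a (q^-multiple x i a f)))
          (trans (*-congʳ (reflexive (≡.cong (q ^_) e))) (q^-multiple y P a (trans (*-congʳ q^P) (*-identityˡ a))))

        ∑-fixed : ∀ n f a → (∀ i → f i * a ≈ a) → ∑ n f * a ≈ n ⋆ a
        ∑-fixed zero    f a e = zeroˡ a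
        ∑-fixed (suc n) f a e = trans (distribʳ _ _ _) (+-cong (e 0) (∑-fixed n (f ∘ suc) a (e ∘ suc)))

        -- If q^i fixes `a`, so does q^{gcd(i,P)} and hence q^h. Then the vanishing sum of the
        -- powers of q^h acts on `a` as multiplication by p, and torsion-freeness gives `a` = 0.
        regular : ∀ i a → 0 < i → i < P → q ^ i * a ≈ a → a ≈ 0#
        regular i a 0<i i<P f = torsion-free a (begin
          p ⋆ a ≈⟨ sym (∑-fixed p ((q ^ h) ^_) a q^h-fixes) ⟩
          ∑ p ((q ^ h) ^_) * a ≈⟨ *-congʳ cyclotomic ⟩
          0# * a ≈⟨ zeroˡ a ⟩
          0# ∎)
          where
          q^h : q ^ h * a ≈ a
          q^h with gcd-h i 0<i i<P
          ... | divides k e = trans (*-congʳ (reflexive (≡.cong (q ^_) e))) (q^-multiple k (gcd i P) a (q^-gcd i a f))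
          q^h-fixes : ∀ i → (q ^ h) ^ i * a ≈ a
          q^h-fixes zero    = *-identityˡ a
          q^h-fixes (suc i) = trans (*-assoc _ _ _) (trans (*-congˡ (q^h-fixes i)) q^h)

        -- With q^P = 1, `gauss-ratio` reads (q^{i+1} - 1) g_{i+1} = (q^i - 1) g_i, and the chain
        -- starts at zero for i = 0. With `regular` this removes all middle coefficients.
        gauss-P-fixed : ∀ i → q ^ i * gauss P i ≈ gauss P i
        gauss-P-fixed zero    = *-identityˡ _
        gauss-P-fixed (suc i) = x∙y⁻¹≈ε⇒x≈y _ _ (begin
          q ^ suc i * gauss P (suc i) - gauss P (suc i) ≈⟨ gauss-ratio P i ⟩
          q ^ i * gauss P i - q ^ P * gauss P i
            ≈⟨ +-cong (gauss-P-fixed i) (-‿cong (trans (*-congʳ q^P) (*-identityˡ _))) ⟩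
          gauss P i - gauss P i ≈⟨ -‿inverseʳ _ ⟩
          0# ∎)

        gauss-P-top : gauss P P ≈ - 1#
        gauss-P-top = trans (gauss-top-odd u odd) (-‿cong (begin
          q ^ (P ℕ.* u) ≈⟨ sym (^-assocʳ q P u) ⟩
          (q ^ P) ^ u ≈⟨ ^-congˡ u q^P ⟩
          1# ^ u ≈⟨ 1^n≈1 u ⟩
          1# ∎))

        qprod-P : ∀ x y → qprod P x y ≈ x ^ P - y ^ P
        qprod-P x y = trans (qbinomial P x y) (collapse P (gauss P) odd (gauss-0 P) gauss-P-top
          (λ {i} 0<i i<P → regular i _ 0<i i<P (gauss-P-fixed i)))
          where
          -- `P` becomes a variable here so that it can be matched as a successor.
          collapse : ∀ n f → n ≡ suc (2 ℕ.* u) → f 0 ≈ 1# → f n ≈ - 1# → (∀ {i} → 0 < i → i < n → f i ≈ 0#) →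
                     homog n f x y ≈ x ^ n - y ^ n
          collapse (suc n) f _ f0 fn v = begin
            x ^ suc n * f 0 + y * homog n (f ∘ suc) x y
              ≈⟨ +-cong (trans (*-congˡ f0) (*-identityʳ _)) (*-congˡ (homog-top n (f ∘ suc) x y (λ l → v (s≤s z≤n) (s≤s l)))) ⟩
            x ^ suc n + y * (y ^ n * f (suc n)) ≈⟨ +-congˡ (trans (sym (*-assoc _ _ _)) (*-congˡ fn)) ⟩
            x ^ suc n + y ^ suc n * - 1# ≈⟨ +-congˡ (trans (sym (-‿distribʳ-* _ _)) (-‿cong (*-identityʳ _))) ⟩
            x ^ suc n - y ^ suc n ∎

        -- After the first `a` factors, each block of P consecutive ones collapses to x^P - (q^c
        -- y)^P = x^P - y^P. The idle powers of `1#` make the second factor literally a `qprod` at q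
        -- = 1.
        qprod-blocks : ∀ a b x y → qprod (a ℕ.+ P ℕ.* b) x y ≈ qprod a x y * ∏ b (λ t → x ^ P - 1# ^ t * y ^ P)
        qprod-blocks a b x y = begin
          qprod (a ℕ.+ P ℕ.* b) x y ≈⟨ blocks b a ⟩
          qprod a x y * (x ^ P - y ^ P) ^ b ≈⟨ *-congˡ (sym (∏-const b λ t → +-congˡ (-‿cong (trans (*-congʳ (1^n≈1 t)) (*-identityˡ _))))) ⟩
          qprod a x y * ∏ b (λ t → x ^ P - 1# ^ t * y ^ P) ∎
          where
          [q^ay]^P : ∀ a → (q ^ a * y) ^ P ≈ y ^ P
          [q^ay]^P a = begin
            (q ^ a * y) ^ P ≈⟨ ^-distrib-* (q ^ a) y P ⟩
            (q ^ a) ^ P * y ^ P ≈⟨ *-congʳ (trans (^-assocʳ q a P) (trans (reflexive (≡.cong (q ^_) (ℕ.*-comm a P))) (sym (^-assocʳ q P a)))) ⟩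
            (q ^ P) ^ a * y ^ P ≈⟨ *-congʳ (trans (^-congˡ a q^P) (1^n≈1 a)) ⟩
            1# * y ^ P ≈⟨ *-identityˡ _ ⟩
            y ^ P ∎
          blocks : ∀ b a → qprod (a ℕ.+ P ℕ.* b) x y ≈ qprod a x y * (x ^ P - y ^ P) ^ b
          blocks zero a = trans (reflexive (≡.cong (λ e → qprod e x y) (≡.trans (≡.cong (a ℕ.+_) (ℕ.*-zeroʳ P)) (ℕ.+-identityʳ a)))) (sym (*-identityʳ _))
          blocks (suc b) a = begin
            qprod (a ℕ.+ P ℕ.* suc b) x y
              ≡⟨ ≡.cong (λ e → qprod e x y) (≡.trans (≡.cong (a ℕ.+_) (ℕ.*-suc P b)) (≡.sym (ℕ.+-assoc a P _))) ⟩
            qprod ((a ℕ.+ P) ℕ.+ P ℕ.* b) x y ≈⟨ blocks b (a ℕ.+ P) ⟩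
            qprod (a ℕ.+ P) x y * W ^ b ≈⟨ *-congʳ (∏-+ a P _) ⟩
            qprod a x y * ∏ P (λ t → x - q ^ (a ℕ.+ t) * y) * W ^ b ≈⟨ *-congʳ (*-congˡ (trans (qprod-shift P a x y) (trans (qprod-P x _) (+-congˡ (-‿cong ([q^ay]^P a)))))) ⟩
            qprod a x y * W * W ^ b ≈⟨ *-assoc _ _ _ ⟩
            qprod a x y * W ^ suc b ∎
            where W = x ^ P - y ^ P

-- Divisors of prime powers and the exponents of the master polynomial.

module Arithmetic where
  open import Defs
  open import Data.Empty using (⊥-elim)
  open import Data.Nat
  open import Data.Nat.Properties
  open import Data.Nat.Divisibility
  open import Data.Nat.DivMod
  open import Data.Nat.GCD using (gcd; gcd[m,n]∣m; gcd[m,n]∣n)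
  open import Data.Nat.Coprimality using (Coprime; coprime-divisor)
  open import Data.Nat.Primality using (Prime; prime⇒irreducible; prime⇒nonZero)
  open import Data.Nat.Solver using (module +-*-Solver)
  open import Data.Product using (_,_; ∃)
  open import Data.Sum using (inj₁; inj₂)
  open import Relation.Nullary using (¬_; yes; no)
  open import Relation.Binary.PropositionalEquality
  open +-*-Solver using (solve; con; _:+_; _:*_; _:=_)

  module PrimePower {p : ℕ} (pr : Prime p) where

    private instance
      p≢0 : NonZero p
      p≢0 = prime⇒nonZero pr

    coprime-to-prime : ∀ {c} → ¬ p ∣ c → Coprime c p
    coprime-to-prime p∤c (d∣c , d∣p) with prime⇒irreducible pr d∣p
    ... | inj₁ d≡1 = d≡1
    ... | inj₂ refl = ⊥-elim (p∤c d∣c)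

    coprime-divisor-of-power : ∀ {c} → ¬ p ∣ c → ∀ n → c ∣ p ^ n → c ∣ 1
    coprime-divisor-of-power p∤c zero    c∣ = c∣
    coprime-divisor-of-power p∤c (suc n) c∣ =
      coprime-divisor-of-power p∤c n (coprime-divisor (coprime-to-prime p∤c) c∣)

    -- If p divides the cofactor it can be cancelled; otherwise the cofactor is coprime to p and
    -- divides a power of p, so it is 1 and `d` is not proper.
    proper-divisor-of-power : ∀ j {d} → d ∣ p ^ suc j → d < p ^ suc j → d ∣ p ^ j
    proper-divisor-of-power j {d} (divides c e) d< with p ∣? c
    ... | yes (divides c' refl) = divides c' (*-cancelˡ-≡ _ _ p (trans e
            (solve 3 (λ c p d → c :* p :* d := p :* (c :* d)) refl c' p d)))
    ... | no p∤c with ∣1⇒≡1 (coprime-divisor-of-power p∤c (suc j) (divides d (trans e (*-comm c d))))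
    ...   | refl = ⊥-elim (<-irrefl (sym (trans e (*-identityˡ d))) d<)

    gcd-proper : ∀ j i → 0 < i → i < p ^ suc j → gcd i (p ^ suc j) ∣ p ^ j
    gcd-proper j i@(suc _) _ i< = proper-divisor-of-power j (gcd[m,n]∣n i (p ^ suc j))
      (≤-<-trans (∣⇒≤ (gcd[m,n]∣m i (p ^ suc j))) i<)

  Odd : ℕ → Set
  Odd n = ∃ λ u → n ≡ suc (2 * u)

  odd-* : ∀ {a b} → Odd a → Odd b → Odd (a * b)
  odd-* (u , refl) (v , refl) = u + v + 2 * u * v ,
    solve 2 (λ u v → (con 1 :+ con 2 :* u) :* (con 1 :+ con 2 :* v) := con 1 :+ con 2 :* (u :+ v :+ con 2 :* u :* v)) refl u v

  odd-^ : ∀ {p} → Odd p → ∀ n → Odd (p ^ n)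
  odd-^ o zero    = 0 , refl
  odd-^ o (suc n) = odd-* o (odd-^ o n)

  ¬2∣⇒odd : ∀ n → ¬ 2 ∣ n → Odd n
  ¬2∣⇒odd n 2∤n with n % 2 | m%n<n n 2 | m≡m%n+[m/n]*n n 2
  ... | 0 | _ | eq = ⊥-elim (2∤n (divides (n / 2) eq))
  ... | 1 | _ | eq = n / 2 , trans eq (cong suc (*-comm (n / 2) 2))
  ... | suc (suc _) | s≤s (s≤s ()) | _

  module Exponents (p r m l n k : ℕ) .{{_ : NonZero m}} (2r≤m : 2 * r ≤ m) (p≡ : p ≡ l * m + 1) (p-odd : Odd p) where

    -- (p^s - 1) / m
    L : ℕ → ℕ
    L zero    = 0
    L (suc s) = p * L s + l

    p^s≡ : ∀ s → p ^ s ≡ suc (m * L s)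
    p^s≡ zero    = cong suc (sym (*-zeroʳ m))
    p^s≡ (suc s) = begin
      p * p ^ s ≡⟨ cong (p *_) (p^s≡ s) ⟩
      p * suc (m * L s) ≡⟨ *-suc p _ ⟩
      p + p * (m * L s) ≡⟨ cong (_+ p * (m * L s)) p≡ ⟩
      l * m + 1 + p * (m * L s) ≡⟨ solve 4 (λ l m p x → l :* m :+ con 1 :+ p :* (m :* x) := con 1 :+ m :* (p :* x :+ l)) refl l m p (L s) ⟩
      suc (m * (p * L s + l)) ∎
      where open ≡-Reasoning

    p^s∸1≡ : ∀ s → p ^ s ∸ 1 ≡ m * L s
    p^s∸1≡ s = cong (_∸ 1) (p^s≡ s)

    -- This is p^{j+t} - 1 = (p^j - 1) + p^j (p^t - 1) divided by m. All three exponents are fixed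
    -- multiples of `L`, so they inherit this splitting, the very shape in which `qprod-blocks`
    -- counts factors.
    L-+ : ∀ j t → L (j + t) ≡ L j + p ^ j * L t
    L-+ zero    t = sym (+-identityʳ (L t))
    L-+ (suc j) t = trans (cong (λ x → p * x + l) (L-+ j t))
      (solve 5 (λ p a b c l → p :* (a :+ b :* c) :+ l := p :* a :+ l :+ p :* b :* c) refl p (L j) (p ^ j) (L t) l)

    quotient-m : ∀ s x → ((p ^ s ∸ 1) * x) / m ≡ L s * x
    quotient-m s x = trans (cong (λ y → (y * x) / m) (p^s∸1≡ s))
      (trans (cong (_/ m) (trans (*-assoc m (L s) x) (*-comm m _))) (m*n/n≡m (L s * x) m))

    private
      e1 = E1 p r m n k
      eω = Eω p r m n k
      eh = Eh p r m n k

    r≤m : r ≤ m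
    r≤m = ≤-trans (m≤m+n r (r + 0)) 2r≤m

    Eω≡ : ∀ s → eω s ≡ L s * r
    Eω≡ s = quotient-m s r

    E1+Eω : ∀ s → e1 s + eω s ≡ p ^ s ∸ 1
    E1+Eω s = begin
      e1 s + eω s ≡⟨ cong₂ _+_ (quotient-m s (m ∸ r)) (Eω≡ s) ⟩
      L s * (m ∸ r) + L s * r ≡⟨ sym (*-distribˡ-+ (L s) (m ∸ r) r) ⟩
      L s * (m ∸ r + r) ≡⟨ cong (L s *_) (m∸n+n≡m r≤m) ⟩
      L s * m ≡⟨ *-comm (L s) m ⟩
      m * L s ≡⟨ sym (p^s∸1≡ s) ⟩
      p ^ s ∸ 1 ∎
      where open ≡-Reasoning

    L-split-m : ∀ s → L s * (m ∸ 2 * r) + 2 * (L s * r) ≡ p ^ s ∸ 1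
    L-split-m s = begin
      L s * (m ∸ 2 * r) + 2 * (L s * r) ≡⟨ cong (L s * (m ∸ 2 * r) +_) (solve 2 (λ x r → con 2 :* (x :* r) := x :* (con 2 :* r)) refl (L s) r) ⟩
      L s * (m ∸ 2 * r) + L s * (2 * r) ≡⟨ sym (*-distribˡ-+ (L s) (m ∸ 2 * r) (2 * r)) ⟩
      L s * (m ∸ 2 * r + 2 * r) ≡⟨ cong (L s *_) (m∸n+n≡m 2r≤m) ⟩
      L s * m ≡⟨ *-comm (L s) m ⟩
      m * L s ≡⟨ sym (p^s∸1≡ s) ⟩
      p ^ s ∸ 1 ∎
      where open ≡-Reasoning

    -- The halving in `Eh` is exact: p^s - 1 is even because p is odd, and it differs from L(s)(m -
    -- 2r) by the even number 2 L(s) r.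
    2Eh : ∀ s → 2 * eh s ≡ L s * (m ∸ 2 * r)
    2Eh s = trans (cong (λ x → 2 * (x / 2)) (quotient-m s (m ∸ 2 * r)))
      (trans (*-comm 2 (L s * (m ∸ 2 * r) / 2)) (m/n*n≡m (∣m+n∣m⇒∣n 2∣sum (m∣m*n (L s * r)))))
      where
      2∣sum : 2 ∣ 2 * (L s * r) + L s * (m ∸ 2 * r)
      2∣sum with odd-^ p-odd s
      ... | u , e = divides u (trans (+-comm (2 * (L s * r)) _) (trans (L-split-m s) (trans (cong (_∸ 1) e) (*-comm 2 u))))

    2Eh+2Eω : ∀ s → 2 * eh s + 2 * eω s ≡ p ^ s ∸ 1
    2Eh+2Eω s = trans (cong₂ _+_ (2Eh s) (cong (2 *_) (Eω≡ s))) (L-split-m s)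

    split-* : ∀ j t x → L (j + t) * x ≡ L j * x + p ^ j * (L t * x)
    split-* j t x = trans (cong (_* x) (L-+ j t))
      (solve 4 (λ a b c x → (a :+ b :* c) :* x := a :* x :+ b :* (c :* x)) refl (L j) (p ^ j) (L t) x)

    E1-+ : ∀ j t → e1 (j + t) ≡ e1 j + p ^ j * e1 t
    E1-+ j t rewrite quotient-m (j + t) (m ∸ r) | quotient-m j (m ∸ r) | quotient-m t (m ∸ r) = split-* j t (m ∸ r)

    Eω-+ : ∀ j t → eω (j + t) ≡ eω j + p ^ j * eω t
    Eω-+ j t rewrite Eω≡ (j + t) | Eω≡ j | Eω≡ t = split-* j t r

    Eh-+ : ∀ j t → eh (j + t) ≡ eh j + p ^ j * eh t
    Eh-+ j t = *-cancelˡ-≡ _ _ 2 (begin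
      2 * eh (j + t) ≡⟨ 2Eh (j + t) ⟩
      L (j + t) * (m ∸ 2 * r) ≡⟨ split-* j t (m ∸ 2 * r) ⟩
      L j * (m ∸ 2 * r) + p ^ j * (L t * (m ∸ 2 * r)) ≡⟨ sym (cong₂ (λ x y → x + p ^ j * y) (2Eh j) (2Eh t)) ⟩
      2 * eh j + p ^ j * (2 * eh t) ≡⟨ solve 3 (λ a b c → con 2 :* a :+ b :* (con 2 :* c) := con 2 :* (a :+ b :* c)) refl (eh j) (p ^ j) (eh t) ⟩
      2 * (eh j + p ^ j * eh t) ∎)
      where open ≡-Reasoning

    -- For odd p, L(s+2) = p^2 L(s) + (p + 1) l has the parity of L(s). Hence T_{s+1} and T_{s-1}
    -- carry the same sign.
    Eω-parity : ∀ s N → (eω (2 + s) * N) % 2 ≡ (eω s * N) % 2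
    Eω-parity s N = go p-odd
      where
      go : Odd p → (eω (2 + s) * N) % 2 ≡ (eω s * N) % 2
      go (u , e) = begin
        (eω (2 + s) * N) % 2 ≡⟨ cong (λ x → (x * N) % 2) (Eω≡ (2 + s)) ⟩
        ((p * (p * L s + l) + l) * r * N) % 2 ≡⟨ cong (λ p → ((p * (p * L s + l) + l) * r * N) % 2) e ⟩
        ((suc (2 * u) * (suc (2 * u) * L s + l) + l) * r * N) % 2
          ≡⟨ cong (_% 2) (solve 5 (λ u x l r N → let p = con 1 :+ con 2 :* u in
               (p :* (p :* x :+ l) :+ l) :* r :* N := x :* r :* N :+ (con 2 :* u :* (con 1 :+ u) :* x :+ (con 1 :+ u) :* l) :* r :* N :* con 2) refl u (L s) l r N) ⟩
        (L s * r * N + (2 * u * (1 + u) * L s + (1 + u) * l) * r * N * 2) % 2 ≡⟨ [m+kn]%n≡m%n (L s * r * N) ((2 * u * (1 + u) * L s + (1 + u) * l) * r * N) 2 ⟩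
        (L s * r * N) % 2 ≡⟨ cong (λ x → (x * N) % 2) (sym (Eω≡ s)) ⟩
        (eω s * N) % 2 ∎
        where open ≡-Reasoning

-- The master polynomial in an arbitrary commutative ring and its symmetries.

module Master where
  open import Defs using (vdim)
  open RingSolver
  open QBinomial
  open import Algebra.Bundles using (CommutativeRing)
  open import Algebra.Morphism.Structures using (module RingMorphisms)
  open import Data.Bool using (true; false; if_then_else_; T)
  open import Data.Nat as ℕ using (ℕ; zero; suc; _∸_; _≡ᵇ_; _<ᵇ_; s≤s; _<_)
  import Data.Nat.Properties as ℕ
  open import Data.Empty using (⊥-elim)
  open import Function using (_∘_)
  open import Relation.Nullary using (¬_)
  open import Relation.Binary.PropositionalEquality as ≡ using (_≡_)

  ≡ᵇ-refl : ∀ i → (i ≡ᵇ i) ≡ true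
  ≡ᵇ-refl zero    = ≡.refl
  ≡ᵇ-refl (suc i) = ≡ᵇ-refl i

  ≡ᵇ-≢ : ∀ {i j} → ¬ (i ≡ j) → (i ≡ᵇ j) ≡ false
  ≡ᵇ-≢ {i} {j} i≢j with i ≡ᵇ j in e
  ... | false = ≡.refl
  ... | true  = ⊥-elim (i≢j (ℕ.≡ᵇ⇒≡ i j (≡.subst T (≡.sym e) _)))

  if-same : ∀ {A : Set} b {x : A} → (if b then x else x) ≡ x
  if-same true  = ≡.refl
  if-same false = ≡.refl

  swapIn : ℕ → ℕ → ℕ → ℕ → ℕ
  swapIn i₀ c i a = if i ≡ᵇ i₀ then sw c a else a

  sw-≡ᵇ : ∀ c a b → (sw c a ≡ᵇ sw c b) ≡ (a ≡ᵇ b)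
  sw-≡ᵇ zero    zero          zero          = ≡.refl
  sw-≡ᵇ zero    zero          (suc zero)    = ≡.refl
  sw-≡ᵇ zero    zero          (suc (suc b)) = ≡.refl
  sw-≡ᵇ zero    (suc zero)    zero          = ≡.refl
  sw-≡ᵇ zero    (suc zero)    (suc zero)    = ≡.refl
  sw-≡ᵇ zero    (suc zero)    (suc (suc b)) = ≡.refl
  sw-≡ᵇ zero    (suc (suc a)) zero          = ≡.refl
  sw-≡ᵇ zero    (suc (suc a)) (suc zero)    = ≡.refl
  sw-≡ᵇ zero    (suc (suc a)) (suc (suc b)) = ≡.refl
  sw-≡ᵇ (suc c) zero          zero          = ≡.refl
  sw-≡ᵇ (suc c) zero          (suc b)       = ≡.refl
  sw-≡ᵇ (suc c) (suc a)       zero          = ≡.refl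
  sw-≡ᵇ (suc c) (suc a)       (suc b)       = sw-≡ᵇ c a b

  swapIn-≡ᵇ : ∀ i₀ c i a b → (swapIn i₀ c i a ≡ᵇ swapIn i₀ c i b) ≡ (a ≡ᵇ b)
  swapIn-≡ᵇ i₀ c i a b with i ≡ᵇ i₀
  ... | true  = sw-≡ᵇ c a b
  ... | false = ≡.refl

  module MasterPolynomial {c ℓ} (R : CommutativeRing c ℓ) (n k : ℕ) where
    open CommutativeRing R
    open RingProducts R
    open Gauss using (qprod)
    open DifferenceSolver R
    open import Algebra.Properties.Ring ring
    open import Relation.Binary.Reasoning.Setoid setoid

    v : ℕ → ℕ
    v = vdim n k

    monomials : ℕ → (ℕ → ℕ → Carrier) → Carrier
    monomials e X = ∏ (n ∸ 1) λ i → ∏ (v (suc i)) λ a → X (suc i) (suc a) ^ e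

    withinGroups : ℕ → Carrier → (ℕ → ℕ → Carrier) → Carrier
    withinGroups h q X = ∏ (n ∸ 1) λ i → ∏ (v (suc i)) λ a → ∏ (v (suc i)) λ b →
      if a ≡ᵇ b then 1# else qprod q h (X (suc i) (suc a)) (X (suc i) (suc b))

    betweenGroups : ℕ → Carrier → (ℕ → ℕ → Carrier) → Carrier
    betweenGroups w q X = ∏ (n ∸ 2) λ i → ∏ (v (suc i)) λ a → ∏ (v (suc (suc i))) λ b →
      qprod q w (X (suc i) (suc a)) (X (suc (suc i)) (suc b))

    ends : ℕ → Carrier → Carrier → (ℕ → ℕ → Carrier) → Carrier
    ends w z q X = ∏ k λ a → ∏ w λ t → (z - q ^ t * X k (suc a)) * (1# - q ^ t * X (n ∸ k) (suc a))

    -- The exponents, z, q and the points are all free, so that the same expression can be evaluated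
    -- at P-th powers and at q = 1. The final `1#` mirrors the end of the fold in `prodP`.
    master : (e w h : ℕ) → Carrier → Carrier → (ℕ → ℕ → Carrier) → Carrier
    master e w h z q X = monomials e X * (withinGroups h q X * (betweenGroups w q X * (ends w z q X * 1#)))

    vandermonde : ℕ → (ℕ → Carrier) → Carrier
    vandermonde m Y = ∏ m λ a → ∏ m λ b → if a <ᵇ b then Y b - Y a else 1#

    discriminant : (ℕ → ℕ → Carrier) → Carrier
    discriminant X = ∏ (n ∸ 1) λ i → vandermonde (v (suc i)) (X (suc i) ∘ suc)

    if-cong : ∀ b {x y x' y'} → x ≈ x' → y ≈ y' → (if b then x else y) ≈ (if b then x' else y')
    if-cong true  e f = e
    if-cong false e f = f

    qprod-cong : ∀ q m {x y x' y'} → x ≈ x' → y ≈ y' → qprod q m x y ≈ qprod q m x' y'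
    qprod-cong q m e f = ∏-cong m λ t → +-cong e (-‿cong (*-congˡ f))

    ends-split : ∀ w z q X → ends w z q X ≈ ∏ k (λ a → qprod q w z (X k (suc a))) * ∏ k (λ a → qprod q w 1# (X (n ∸ k) (suc a)))
    ends-split w z q X = trans (∏-cong k λ a → ∏-* w _ _) (∏-* k _ _)

    module Multiplicative (q : Carrier) (P : ℕ)
      (blocks : ∀ a b x y → qprod q (a ℕ.+ P ℕ.* b) x y ≈ qprod q a x y * qprod 1# b (x ^ P) (y ^ P)) where

      ∏-split : ∀ m {f g h} → (∀ i → f i ≈ g i * h i) → ∏ m f ≈ ∏ m g * ∏ m h
      ∏-split m {f} {g} {h} e = trans (∏-cong m e) (∏-* m g h)

      master-* : ∀ e w h e' w' h' z X →
        master (e ℕ.+ P ℕ.* e') (w ℕ.+ P ℕ.* w') (h ℕ.+ P ℕ.* h') z q X ≈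
        master e w h z q X * master e' w' h' (z ^ P) 1# (λ i a → X i a ^ P)
      master-* e w h e' w' h' z X = begin
        master (e ℕ.+ P ℕ.* e') (w ℕ.+ P ℕ.* w') (h ℕ.+ P ℕ.* h') z q X
          ≈⟨ *-cong monomials-* (*-cong within-* (*-cong between-* (*-congʳ ends-*))) ⟩
        (_ * _) * ((_ * _) * ((_ * _) * ((_ * _) * 1#)))
          ≈⟨ *-congˡ (*-congˡ (*-congˡ (*-congˡ (sym (*-identityʳ 1#))))) ⟩
        (_ * _) * ((_ * _) * ((_ * _) * ((_ * _) * (1# * 1#))))
          ≈⟨ solve 10 (λ a b c d u a' b' c' d' u' → (a :* a') :* ((b :* b') :* ((c :* c') :* ((d :* d') :* (u :* u'))))
               := (a :* (b :* (c :* (d :* u)))) :* (a' :* (b' :* (c' :* (d' :* u'))))) refl _ _ _ _ _ _ _ _ _ _ ⟩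
        master e w h z q X * master e' w' h' (z ^ P) 1# X' ∎
        where
        X' : ℕ → ℕ → Carrier
        X' i a = X i a ^ P
        monomials-* : monomials (e ℕ.+ P ℕ.* e') X ≈ monomials e X * monomials e' X'
        monomials-* = ∏-split (n ∸ 1) λ i → ∏-split (v (suc i)) λ a →
          trans (^-homo-* (X (suc i) (suc a)) e (P ℕ.* e')) (*-congˡ (sym (^-assocʳ (X (suc i) (suc a)) P e')))
        within-* : withinGroups (h ℕ.+ P ℕ.* h') q X ≈ withinGroups h q X * withinGroups h' 1# X'
        within-* = ∏-split (n ∸ 1) λ i → ∏-split (v (suc i)) λ a → ∏-split (v (suc i)) λ b → pair (a ≡ᵇ b) _ _
          where
          pair : ∀ t x y → (if t then 1# else qprod q (h ℕ.+ P ℕ.* h') x y) ≈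
                 (if t then 1# else qprod q h x y) * (if t then 1# else qprod 1# h' (x ^ P) (y ^ P))
          pair true  x y = sym (*-identityʳ 1#)
          pair false x y = blocks h h' x y
        between-* : betweenGroups (w ℕ.+ P ℕ.* w') q X ≈ betweenGroups w q X * betweenGroups w' 1# X'
        between-* = ∏-split (n ∸ 2) λ i → ∏-split (v (suc i)) λ a → ∏-split (v (suc (suc i))) λ b → blocks w w' _ _
        ends-* : ends (w ℕ.+ P ℕ.* w') z q X ≈ ends w z q X * ends w' (z ^ P) 1# X'
        ends-* = begin
          ends (w ℕ.+ P ℕ.* w') z q X
            ≈⟨ ends-split (w ℕ.+ P ℕ.* w') z q X ⟩
          _ ≈⟨ *-cong (∏-split k λ a → blocks w w' z _)
                      (∏-split k λ a → trans (blocks w w' 1# _) (*-congˡ (qprod-cong 1# w' (1^n≈1 P) refl))) ⟩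
          (_ * _) * (_ * _)
            ≈⟨ solve 4 (λ a b c d → (a :* b) :* (c :* d) := (a :* c) :* (b :* d)) refl _ _ _ _ ⟩
          (_ * _) * (_ * _)
            ≈⟨ *-cong (sym (ends-split w z q X)) (sym (ends-split w' (z ^ P) 1# X')) ⟩
          ends w z q X * ends w' (z ^ P) 1# X' ∎

    qprod-cong-q : ∀ {q q'} m {x y x' y'} → q ≈ q' → x ≈ x' → y ≈ y' → qprod q m x y ≈ qprod q' m x' y'
    qprod-cong-q m e f g = ∏-cong m λ t → +-cong f (-‿cong (*-cong (^-congˡ t e) g))

    master-cong : ∀ e w h {z z' q q' X X'} → z ≈ z' → q ≈ q' → (∀ i a → X i a ≈ X' i a) →
      master e w h z q X ≈ master e w h z' q' X'
    master-cong e w h ez eq eX = *-cong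
      (∏-cong (n ∸ 1) λ i → ∏-cong (v (suc i)) λ a → ^-congˡ e (eX _ _))
      (*-cong (∏-cong (n ∸ 1) λ i → ∏-cong (v (suc i)) λ a → ∏-cong (v (suc i)) λ b →
                 if-cong (a ≡ᵇ b) refl (qprod-cong-q h eq (eX _ _) (eX _ _)))
      (*-cong (∏-cong (n ∸ 2) λ i → ∏-cong (v (suc i)) λ a → ∏-cong (v (suc (suc i))) λ b →
                 qprod-cong-q w eq (eX _ _) (eX _ _))
      (*-congʳ (∏-cong k λ a → ∏-cong w λ t → *-cong
        (+-cong ez (-‿cong (*-cong (^-congˡ t eq) (eX _ _))))
        (+-congˡ (-‿cong (*-cong (^-congˡ t eq) (eX _ _))))))))

    vandermonde-suc : ∀ m Y → vandermonde (suc m) Y ≈ ∏ m (λ b → Y (suc b) - Y 0) * vandermonde m (Y ∘ suc)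
    vandermonde-suc m Y = *-cong (*-identityˡ _) (∏-cong m λ a → *-identityˡ _)

    vandermonde-cong : ∀ m {Y Y'} → (∀ a → Y a ≈ Y' a) → vandermonde m Y ≈ vandermonde m Y'
    vandermonde-cong m e = ∏-cong m λ a → ∏-cong m λ b → if-cong (a <ᵇ b) (+-cong (e b) (-‿cong (e a))) refl

    -- For the first two points, their own difference changes sign while their rows of differences
    -- with the later points are exchanged. For later pairs, the first row is only permuted and
    -- induction applies to the rest.
    vandermonde-sw : ∀ m d Y → suc d < m → vandermonde m (Y ∘ sw d) ≈ - vandermonde m Y
    vandermonde-sw (suc (suc m)) zero Y _ = begin
      vandermonde (suc (suc m)) (Y ∘ sw 0)
        ≈⟨ trans (vandermonde-suc (suc m) (Y ∘ sw 0)) (*-congˡ (vandermonde-suc m (Y ∘ sw 0 ∘ suc))) ⟩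
      ((Y 0 - Y 1) * _) * (_ * _)
        ≈⟨ solve 5 (λ a b A B V → ((a :- b) :* A) :* (B :* V) := :- (((b :- a) :* B) :* (A :* V))) refl _ _ _ _ _ ⟩
      - (((Y 1 - Y 0) * _) * (_ * _))
        ≈⟨ -‿cong (sym (trans (vandermonde-suc (suc m) Y) (*-congˡ (vandermonde-suc m (Y ∘ suc))))) ⟩
      - vandermonde (suc (suc m)) Y ∎
    vandermonde-sw (suc m) (suc d) Y (s≤s l) = begin
      vandermonde (suc m) (Y ∘ sw (suc d)) ≈⟨ vandermonde-suc m (Y ∘ sw (suc d)) ⟩
      _ * vandermonde m (Y ∘ suc ∘ sw d) ≈⟨ *-cong (∏-sw m d (λ b → Y (suc b) - Y 0) l) (vandermonde-sw m d (Y ∘ suc) l) ⟩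
      _ * - vandermonde m (Y ∘ suc) ≈⟨ sym (-‿distribʳ-* _ _) ⟩
      - (_ * vandermonde m (Y ∘ suc)) ≈⟨ -‿cong (sym (vandermonde-suc m Y)) ⟩
      - vandermonde (suc m) Y ∎

    ∏-neg : ∀ m {f g} i → i < m → f i ≈ - g i → (∀ j → ¬ (j ≡ i) → f j ≈ g j) → ∏ m f ≈ - ∏ m g
    ∏-neg (suc m) zero    _       e o = trans (*-cong e (∏-cong m λ j → o (suc j) λ ())) (sym (-‿distribˡ-* _ _))
    ∏-neg (suc m) (suc i) (s≤s l) e o = trans
      (*-cong (o 0 λ ()) (∏-neg m i l e λ j j≢i → o (suc j) λ e' → j≢i (ℕ.suc-injective e')))
      (sym (-‿distribʳ-* _ _))

    module Swap (i₁ d : ℕ) (i₁< : i₁ < n ∸ 1) (d< : suc d < v (suc i₁))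
      (v-k : v k ≡ k) (v-n∸k : v (n ∸ k) ≡ k) where
      private
        ρ = swapIn (suc i₁) d

      ∏-swapIn : ∀ i f → ∏ (v i) (f ∘ ρ i) ≈ ∏ (v i) f
      ∏-swapIn i f with i ≡ᵇ suc i₁ in e
      ... | false = refl
      ... | true with ℕ.≡ᵇ⇒≡ i (suc i₁) (≡.subst T (≡.sym e) _)
      ...   | ≡.refl = ∏-sw (v i) d f d<

      module _ (X X' : ℕ → ℕ → Carrier) (X'≈ : ∀ i a → X' i (suc a) ≈ X i (suc (ρ i a))) where

        master-swap : ∀ e w h z q → master e w h z q X' ≈ master e w h z q X
        master-swap e w h z q = *-cong
          (∏-cong (n ∸ 1) λ i → trans (∏-cong (v (suc i)) λ a → ^-congˡ e (X'≈ _ _)) (∏-swapIn (suc i) _))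
          (*-cong (∏-cong (n ∸ 1) λ i → trans
                    (∏-cong (v (suc i)) λ a → trans
                      (∏-cong (v (suc i)) λ b → trans
                        (if-cong (a ≡ᵇ b) refl (qprod-cong q h (X'≈ _ _) (X'≈ _ _)))
                        (reflexive (≡.cong (λ t → if t then 1# else qprod q h (X (suc i) (suc (ρ (suc i) a))) (X (suc i) (suc (ρ (suc i) b)))) (≡.sym (swapIn-≡ᵇ (suc i₁) d (suc i) a b)))))
                      (∏-swapIn (suc i) (λ b → if ρ (suc i) a ≡ᵇ b then 1# else qprod q h (X (suc i) (suc (ρ (suc i) a))) (X (suc i) (suc b)))))
                    (∏-swapIn (suc i) (λ a → ∏ (v (suc i)) λ b → if a ≡ᵇ b then 1# else qprod q h (X (suc i) (suc a)) (X (suc i) (suc b)))))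
          (*-cong (∏-cong (n ∸ 2) λ i → trans
                    (∏-cong (v (suc i)) λ a → trans
                      (∏-cong (v (suc (suc i))) λ b → qprod-cong q w (X'≈ _ _) (X'≈ _ _))
                      (∏-swapIn (suc (suc i)) (λ b → qprod q w (X (suc i) (suc (ρ (suc i) a))) (X (suc (suc i)) (suc b)))))
                    (∏-swapIn (suc i) (λ a → ∏ (v (suc (suc i))) λ b → qprod q w (X (suc i) (suc a)) (X (suc (suc i)) (suc b)))))
          (*-congʳ {x = 1#} ends-swap)))
          where
          -- `ends` runs up to `k`, not up to the group size; the two agree for the groups k and n -
          -- k, so the transposition only permutes the factors.
          atEnd : ∀ i → v i ≡ k → ∀ y → ∏ k (λ a → qprod q w y (X' i (suc a))) ≈ ∏ k (λ a → qprod q w y (X i (suc a)))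
          atEnd i e y = trans (∏-cong k λ a → qprod-cong q w refl (X'≈ i a))
            (≡.subst (λ m → ∏ m (f ∘ ρ i) ≈ ∏ m f) e (∏-swapIn i f))
            where f = λ a → qprod q w y (X i (suc a))
          ends-swap : ends w z q X' ≈ ends w z q X
          ends-swap = trans (ends-split w z q X')
            (trans (*-cong (atEnd k v-k z) (atEnd (n ∸ k) v-n∸k 1#)) (sym (ends-split w z q X)))

        discriminant-swap : discriminant X' ≈ - discriminant X
        discriminant-swap = ∏-neg (n ∸ 1) i₁ i₁<
          (trans (vandermonde-cong (v (suc i₁)) (λ a → trans (X'≈ _ a) (reflexive (≡.cong (λ t → X (suc i₁) (suc (if t then sw d a else a))) (≡ᵇ-refl i₁)))))
            (vandermonde-sw (v (suc i₁)) d (X (suc i₁) ∘ suc) d<))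
          (λ j j≢ → vandermonde-cong (v (suc j)) (λ a → trans (X'≈ _ a) (reflexive (≡.cong (λ t → X (suc j) (suc (if t then sw d a else a))) (≡ᵇ-≢ j≢)))))

  module MasterHomomorphism {c ℓ c' ℓ'} (R : CommutativeRing c ℓ) (S : CommutativeRing c' ℓ')
    (f : CommutativeRing.Carrier R → CommutativeRing.Carrier S)
    (f-hom : RingMorphisms.IsRingHomomorphism (CommutativeRing.rawRing R) (CommutativeRing.rawRing S) f) (n k : ℕ) where
    private
      module R = CommutativeRing R
      module RP = RingProducts R
      module RM = MasterPolynomial R n k
    open CommutativeRing S
    open RingProducts S
    open MasterPolynomial S n k
    open RingMorphisms.IsRingHomomorphism f-hom

    ^-homo : ∀ x m → f (x RP.^ m) ≈ f x ^ m
    ^-homo x zero    = 1#-homo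
    ^-homo x (suc m) = trans (*-homo _ _) (*-congˡ (^-homo x m))

    ∏-homo : ∀ m {g h} → (∀ i → f (g i) ≈ h i) → f (RP.∏ m g) ≈ ∏ m h
    ∏-homo zero    e = 1#-homo
    ∏-homo (suc m) e = trans (*-homo _ _) (*-cong (e 0) (∏-homo m (e ∘ suc)))

    minus-homo : ∀ {x y x' y'} → f x ≈ x' → f y ≈ y' → f (x R.- y) ≈ x' - y'
    minus-homo e g = trans (+-homo _ _) (+-cong e (trans (-‿homo _) (-‿cong g)))

    if-homo : ∀ b {x y x' y'} → f x ≈ x' → f y ≈ y' → f (if b then x else y) ≈ (if b then x' else y')
    if-homo true  e g = e
    if-homo false e g = g

    qfactor-homo : ∀ q t {x y x'} → f x ≈ x' → f (x R.- (q RP.^ t) R.* y) ≈ x' - f q ^ t * f y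
    qfactor-homo q t e = minus-homo e (trans (*-homo _ _) (*-congʳ (^-homo q t)))

    master-homo : ∀ e w h z q X → f (RM.master e w h z q X) ≈ master e w h (f z) (f q) (λ i a → f (X i a))
    master-homo e w h z q X = trans (*-homo _ _) (*-cong
      (∏-homo (n ∸ 1) λ i → ∏-homo (v (suc i)) λ a → ^-homo _ e)
      (trans (*-homo _ _) (*-cong
        (∏-homo (n ∸ 1) λ i → ∏-homo (v (suc i)) λ a → ∏-homo (v (suc i)) λ b →
          if-homo (a ≡ᵇ b) 1#-homo (∏-homo h λ t → qfactor-homo q t refl))
      (trans (*-homo _ _) (*-cong
        (∏-homo (n ∸ 2) λ i → ∏-homo (v (suc i)) λ a → ∏-homo (v (suc (suc i))) λ b → ∏-homo w λ t → qfactor-homo q t refl)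
      (trans (*-homo _ _) (*-cong
        (∏-homo k λ a → ∏-homo w λ t → trans (*-homo _ _) (*-cong (qfactor-homo q t refl) (qfactor-homo q t 1#-homo)))
        1#-homo)))))))

    discriminant-homo : ∀ X → f (RM.discriminant X) ≈ discriminant (λ i a → f (X i a))
    discriminant-homo X = ∏-homo (n ∸ 1) λ i → ∏-homo (v (suc i)) λ a → ∏-homo (v (suc i)) λ b →
      if-homo (a <ᵇ b) (minus-homo refl refl) 1#-homo

-- Polynomials as functionals on tests, and the quotient rings they define.

module Quotients where
  open import Defs
  open QBinomial
  open import Algebra.Bundles using (CommutativeRing)
  open import Algebra.Morphism.Structures using (module RingMorphisms)
  open import Data.Nat as ℕ using (ℕ; zero; suc; NonZero)
  import Data.Nat.Properties as ℕ
  open import Data.Integer as ℤ using (ℤ; +_; 0ℤ; 1ℤ; _+_; _*_; -_)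
  import Data.Integer.Properties as ℤ
  open import Data.Integer.Tactic.RingSolver using (solve-∀)
  open import Data.List using ([]; _∷_; _++_; map)
  open import Data.Product using (_×_; _,_; proj₁; proj₂)
  open import Function using (_∘_)
  open import Level using (0ℓ)
  open import Relation.Binary.PropositionalEquality

  -- Exponents of z, q and x, in this order.
  Exponent : Set
  Exponent = ℕ × ℕ × (ℕ → ℕ → ℕ)

  exponent : Term → Exponent
  exponent t = ez t , eqq t , ex t

  infixl 6 _⊕_
  _⊕_ : Exponent → Exponent → Exponent
  (a , b , e) ⊕ (a' , b' , e') = a ℕ.+ a' , b ℕ.+ b' , λ i j → e i j ℕ.+ e' i j

  𝟎 : Exponent
  𝟎 = 0 , 0 , noX

  infix 4 _≐_
  record _≐_ (m m' : Exponent) : Set where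
    constructor ≐[_,_,_]
    field
      z≡ : proj₁ m ≡ proj₁ m'
      q≡ : proj₁ (proj₂ m) ≡ proj₁ (proj₂ m')
      x≡ : ∀ i j → proj₂ (proj₂ m) i j ≡ proj₂ (proj₂ m') i j
  open _≐_ public

  ≐-refl : ∀ {m} → m ≐ m
  ≐-refl = ≐[ refl , refl , (λ _ _ → refl) ]

  ≐-sym : ∀ {m m'} → m ≐ m' → m' ≐ m
  ≐-sym ≐[ e , f , g ] = ≐[ sym e , sym f , (λ i j → sym (g i j)) ]

  ≐-trans : ∀ {m m' m''} → m ≐ m' → m' ≐ m'' → m ≐ m''
  ≐-trans ≐[ e , f , g ] ≐[ e' , f' , g' ] = ≐[ trans e e' , trans f f' , (λ i j → trans (g i j) (g' i j)) ]

  ⊕-cong : ∀ {m m' o o'} → m ≐ m' → o ≐ o' → m ⊕ o ≐ m' ⊕ o'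
  ⊕-cong ≐[ e , f , g ] ≐[ e' , f' , g' ] = ≐[ cong₂ ℕ._+_ e e' , cong₂ ℕ._+_ f f' , (λ i j → cong₂ ℕ._+_ (g i j) (g' i j)) ]

  ⊕-comm : ∀ m o → m ⊕ o ≐ o ⊕ m
  ⊕-comm (a , b , e) (a' , b' , e') = ≐[ ℕ.+-comm a a' , ℕ.+-comm b b' , (λ i j → ℕ.+-comm (e i j) (e' i j)) ]

  ⊕-assoc : ∀ m o r → (m ⊕ o) ⊕ r ≐ m ⊕ (o ⊕ r)
  ⊕-assoc (a , b , e) (a' , b' , e') (a'' , b'' , e'') =
    ≐[ ℕ.+-assoc a a' a'' , ℕ.+-assoc b b' b'' , (λ i j → ℕ.+-assoc (e i j) (e' i j) (e'' i j)) ]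

  Test : Set
  Test = Exponent → ℤ

  -- Reading a formal sum as a functional identifies lists with the same collected terms, although
  -- exponents are functions and have no decidable equality.
  ⟦_⟧ : Poly → Test → ℤ
  ⟦ [] ⟧    φ = 0ℤ
  ⟦ t ∷ P ⟧ φ = coef t * φ (exponent t) + ⟦ P ⟧ φ

  ⟦⟧-cong : ∀ P {φ ψ : Test} → (∀ m → φ m ≡ ψ m) → ⟦ P ⟧ φ ≡ ⟦ P ⟧ ψ
  ⟦⟧-cong []      e = refl
  ⟦⟧-cong (t ∷ P) e = cong₂ _+_ (cong (coef t *_) (e _)) (⟦⟧-cong P e)

  ⟦++⟧ : ∀ P Q φ → ⟦ P ++ Q ⟧ φ ≡ ⟦ P ⟧ φ + ⟦ Q ⟧ φ
  ⟦++⟧ []      Q φ = sym (ℤ.+-identityˡ _)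
  ⟦++⟧ (t ∷ P) Q φ = trans (cong (_+_ (coef t * φ (exponent t))) (⟦++⟧ P Q φ)) (sym (ℤ.+-assoc (coef t * φ (exponent t)) _ _))

  ⟦⟧-+ : ∀ P φ ψ → ⟦ P ⟧ (λ m → φ m + ψ m) ≡ ⟦ P ⟧ φ + ⟦ P ⟧ ψ
  ⟦⟧-+ []      φ ψ = refl
  ⟦⟧-+ (t ∷ P) φ ψ = trans (cong (_+_ (coef t * (φ (exponent t) + ψ (exponent t)))) (⟦⟧-+ P φ ψ))
    (lemma (coef t) _ _ _ _)
    where
    lemma : ∀ c x y u v → c * (x + y) + (u + v) ≡ (c * x + u) + (c * y + v)
    lemma = solve-∀

  ⟦⟧-* : ∀ P c φ → ⟦ P ⟧ (λ m → c * φ m) ≡ c * ⟦ P ⟧ φ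
  ⟦⟧-* []      c φ = sym (ℤ.*-zeroʳ c)
  ⟦⟧-* (t ∷ P) c φ = trans (cong (_+_ (coef t * (c * φ (exponent t)))) (⟦⟧-* P c φ)) (lemma (coef t) c _ _)
    where
    lemma : ∀ d c x u → d * (c * x) + c * u ≡ c * (d * x + u)
    lemma = solve-∀

  ⟦⟧-0 : ∀ P → ⟦ P ⟧ (λ _ → 0ℤ) ≡ 0ℤ
  ⟦⟧-0 P = ⟦⟧-* P 0ℤ (λ _ → 0ℤ)

  -- Interchange of finite sums; it is the source of commutativity of `mulP`.
  ⟦⟧-swap : ∀ P Q (F : Exponent → Exponent → ℤ) →
    ⟦ P ⟧ (λ m → ⟦ Q ⟧ (F m)) ≡ ⟦ Q ⟧ (λ o → ⟦ P ⟧ (λ m → F m o))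
  ⟦⟧-swap []      Q F = sym (⟦⟧-0 Q)
  ⟦⟧-swap (t ∷ P) Q F = sym (begin
    ⟦ Q ⟧ (λ o → coef t * F (exponent t) o + ⟦ P ⟧ (λ m → F m o))
      ≡⟨ ⟦⟧-+ Q (λ o → coef t * F (exponent t) o) (λ o → ⟦ P ⟧ (λ m → F m o)) ⟩
    ⟦ Q ⟧ (λ o → coef t * F (exponent t) o) + ⟦ Q ⟧ (λ o → ⟦ P ⟧ (λ m → F m o))
      ≡⟨ cong₂ _+_ (⟦⟧-* Q (coef t) (F (exponent t))) (sym (⟦⟧-swap P Q F)) ⟩
    coef t * ⟦ Q ⟧ (F (exponent t)) + ⟦ P ⟧ (λ m → ⟦ Q ⟧ (F m)) ∎)
    where open ≡-Reasoning

  substitute : (Exponent → Exponent) → Poly → Poly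
  substitute f = map λ t → term (coef t) (proj₁ (f (exponent t))) (proj₁ (proj₂ (f (exponent t)))) (proj₂ (proj₂ (f (exponent t))))

  ⟦substitute⟧ : ∀ f P φ → ⟦ substitute f P ⟧ φ ≡ ⟦ P ⟧ (φ ∘ f)
  ⟦substitute⟧ f []      φ = refl
  ⟦substitute⟧ f (t ∷ P) φ = cong (_+_ (coef t * φ (f (exponent t)))) (⟦substitute⟧ f P φ)

  negate : Poly → Poly
  negate = map λ t → term (- coef t) (ez t) (eqq t) (ex t)

  ⟦negate⟧ : ∀ P φ → ⟦ negate P ⟧ φ ≡ - ⟦ P ⟧ φ
  ⟦negate⟧ []      φ = refl
  ⟦negate⟧ (t ∷ P) φ = trans (cong₂ _+_ (sym (ℤ.neg-distribˡ-* (coef t) _)) (⟦negate⟧ P φ)) (sym (ℤ.neg-distrib-+ (coef t * _) _))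

  ⟦mulP⟧ : ∀ P Q φ → ⟦ mulP P Q ⟧ φ ≡ ⟦ P ⟧ (λ m → ⟦ Q ⟧ (λ o → φ (m ⊕ o)))
  ⟦mulP⟧ []      Q φ = refl
  ⟦mulP⟧ (s ∷ P) Q φ = trans (⟦++⟧ (map (mulT s) Q) _ φ) (cong₂ _+_ (row Q) (⟦mulP⟧ P Q φ))
    where
    row : ∀ Q → ⟦ map (mulT s) Q ⟧ φ ≡ coef s * ⟦ Q ⟧ (λ o → φ (exponent s ⊕ o))
    row []      = sym (ℤ.*-zeroʳ (coef s))
    row (t ∷ Q) = trans (cong (_+_ (coef s * coef t * φ (exponent s ⊕ exponent t))) (row Q)) (lemma (coef s) (coef t) _ _)
      where
      lemma : ∀ c d x u → c * d * x + c * u ≡ c * (d * x + u)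
      lemma = solve-∀

  -- A test function is admissible for C if it kills the ideal generated by C.
  record Admissible (C : Poly) (φ : Test) : Set where
    field
      ext  : ∀ {m m'} → m ≐ m' → φ m ≡ φ m'
      kill : ∀ m → ⟦ C ⟧ (λ o → φ (m ⊕ o)) ≡ 0ℤ
  open Admissible public

  module _ {C : Poly} where

    shift-admissible : ∀ {φ} m → Admissible C φ → Admissible C (λ o → φ (m ⊕ o))
    shift-admissible m g .ext e = ext g (⊕-cong ≐-refl e)
    shift-admissible m g .kill o = trans (⟦⟧-cong C λ r → ext g (≐-sym (⊕-assoc m o r))) (kill g (m ⊕ o))

    -- Multiplication by `Q` transposes to this operation on tests. Its admissibility makes `mulP`
    -- respect the equivalence.
    convolve-admissible : ∀ {φ} Q → Admissible C φ → Admissible C (λ m → ⟦ Q ⟧ (λ o → φ (m ⊕ o)))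
    convolve-admissible Q g .ext e = ⟦⟧-cong Q λ o → ext g (⊕-cong e ≐-refl)
    convolve-admissible {φ} Q g .kill m = begin
      ⟦ C ⟧ (λ r → ⟦ Q ⟧ (λ o → φ ((m ⊕ r) ⊕ o))) ≡⟨ ⟦⟧-swap C Q (λ r o → φ ((m ⊕ r) ⊕ o)) ⟩
      ⟦ Q ⟧ (λ o → ⟦ C ⟧ (λ r → φ ((m ⊕ r) ⊕ o)))
        ≡⟨ ⟦⟧-cong Q (λ o → trans (⟦⟧-cong C λ r → ext g (swap₂ m r o)) (kill g (m ⊕ o))) ⟩
      ⟦ Q ⟧ (λ _ → 0ℤ) ≡⟨ ⟦⟧-0 Q ⟩
      0ℤ ∎
      where
      open ≡-Reasoning
      swap₂ : ∀ m r o → (m ⊕ r) ⊕ o ≐ (m ⊕ o) ⊕ r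
      swap₂ m r o = ≐-trans (⊕-assoc m r o) (≐-trans (⊕-cong (≐-refl {m}) (⊕-comm r o)) (≐-sym (⊕-assoc m o r)))

  infix 4 _≋[_]_
  record _≋[_]_ (P C Q : Poly) : Set where
    constructor ≋-by
    field
      at : ∀ {φ} → Admissible C φ → ⟦ P ⟧ φ ≡ ⟦ Q ⟧ φ
  open _≋[_]_ public

  -- The quotient of ℤ[z,q,x] by the largest ideal with the same admissible test
  -- functions as C; being defined by integer-valued functionals it is torsion-free.
  quotientRing : Poly → CommutativeRing 0ℓ 0ℓ
  quotientRing C = record
    { Carrier = Poly ; _≈_ = _≋[ C ]_ ; _+_ = _++_ ; _*_ = mulP ; -_ = negate ; 0# = [] ; 1# = oneP
    ; isCommutativeRing = record
      { isRing = record
        { +-isAbelianGroup = record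
          { isGroup = record
            { isMonoid = record
              { isSemigroup = record
                { isMagma = record
                  { isEquivalence = record
                    { refl = ≋-by λ _ → refl ; sym = λ e → ≋-by λ g → sym (at e g) ; trans = λ e f → ≋-by λ g → trans (at e g) (at f g) }
                  ; ∙-cong = λ {P} {P'} {Q} {Q'} e f → ≋-by λ {φ} g →
                      trans (⟦++⟧ P Q φ) (trans (cong₂ _+_ (at e g) (at f g)) (sym (⟦++⟧ P' Q' φ))) }
                ; assoc = λ P Q R → ≋-by λ {φ} g → trans (trans (⟦++⟧ (P ++ Q) R φ) (cong (_+ ⟦ R ⟧ φ) (⟦++⟧ P Q φ)))
                    (trans (ℤ.+-assoc (⟦ P ⟧ φ) _ _) (sym (trans (⟦++⟧ P (Q ++ R) φ) (cong (_+_ (⟦ P ⟧ φ)) (⟦++⟧ Q R φ))))) }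
              ; identity = (λ P → ≋-by λ g → refl) , λ P → ≋-by λ {φ} g → trans (⟦++⟧ P [] φ) (ℤ.+-identityʳ _) }
            ; inverse = (λ P → ≋-by λ {φ} g → trans (⟦++⟧ (negate P) P φ) (trans (cong (_+ ⟦ P ⟧ φ) (⟦negate⟧ P φ)) (ℤ.+-inverseˡ (⟦ P ⟧ φ))))
                      , (λ P → ≋-by λ {φ} g → trans (⟦++⟧ P (negate P) φ) (trans (cong (_+_ (⟦ P ⟧ φ)) (⟦negate⟧ P φ)) (ℤ.+-inverseʳ (⟦ P ⟧ φ))))
            ; ⁻¹-cong = λ {P} {Q} e → ≋-by λ {φ} g → trans (⟦negate⟧ P φ) (trans (cong -_ (at e g)) (sym (⟦negate⟧ Q φ))) }
          ; comm = λ P Q → ≋-by λ {φ} g → trans (⟦++⟧ P Q φ) (trans (ℤ.+-comm (⟦ P ⟧ φ) _) (sym (⟦++⟧ Q P φ))) }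
        ; *-cong = λ {P} {P'} {Q} {Q'} e f → ≋-by λ {φ} g → begin
            ⟦ mulP P Q ⟧ φ ≡⟨ ⟦mulP⟧ P Q φ ⟩
            ⟦ P ⟧ (λ m → ⟦ Q ⟧ (λ o → φ (m ⊕ o))) ≡⟨ at e (convolve-admissible Q g) ⟩
            ⟦ P' ⟧ (λ m → ⟦ Q ⟧ (λ o → φ (m ⊕ o))) ≡⟨ ⟦⟧-cong P' (λ m → at f (shift-admissible m g)) ⟩
            ⟦ P' ⟧ (λ m → ⟦ Q' ⟧ (λ o → φ (m ⊕ o))) ≡⟨ sym (⟦mulP⟧ P' Q' φ) ⟩
            ⟦ mulP P' Q' ⟧ φ ∎
        ; *-assoc = λ P Q R → ≋-by λ {φ} g → begin
            ⟦ mulP (mulP P Q) R ⟧ φ ≡⟨ trans (⟦mulP⟧ (mulP P Q) R φ) (⟦mulP⟧ P Q _) ⟩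
            ⟦ P ⟧ (λ m → ⟦ Q ⟧ (λ o → ⟦ R ⟧ (λ r → φ ((m ⊕ o) ⊕ r))))
              ≡⟨ (⟦⟧-cong P λ m → ⟦⟧-cong Q λ o → ⟦⟧-cong R λ r → ext g (⊕-assoc m o r)) ⟩
            ⟦ P ⟧ (λ m → ⟦ Q ⟧ (λ o → ⟦ R ⟧ (λ r → φ (m ⊕ (o ⊕ r)))))
              ≡⟨ (⟦⟧-cong P λ m → sym (⟦mulP⟧ Q R _)) ⟩
            ⟦ P ⟧ (λ m → ⟦ mulP Q R ⟧ (λ o → φ (m ⊕ o))) ≡⟨ sym (⟦mulP⟧ P (mulP Q R) φ) ⟩
            ⟦ mulP P (mulP Q R) ⟧ φ ∎
        ; *-identity = *-idˡ , (λ P → ≋-by λ g → trans (at (*-comm' P oneP) g) (at (*-idˡ P) g))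
        ; distrib = (λ P Q R → ≋-by λ {φ} g → begin
            ⟦ mulP P (Q ++ R) ⟧ φ ≡⟨ ⟦mulP⟧ P (Q ++ R) φ ⟩
            ⟦ P ⟧ (λ m → ⟦ Q ++ R ⟧ (λ o → φ (m ⊕ o))) ≡⟨ ⟦⟧-cong P (λ m → ⟦++⟧ Q R _) ⟩
            ⟦ P ⟧ (λ m → ⟦ Q ⟧ (λ o → φ (m ⊕ o)) + ⟦ R ⟧ (λ o → φ (m ⊕ o))) ≡⟨ ⟦⟧-+ P _ _ ⟩
            _ ≡⟨ sym (cong₂ _+_ (⟦mulP⟧ P Q φ) (⟦mulP⟧ P R φ)) ⟩
            ⟦ mulP P Q ⟧ φ + ⟦ mulP P R ⟧ φ ≡⟨ sym (⟦++⟧ (mulP P Q) (mulP P R) φ) ⟩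
            ⟦ mulP P Q ++ mulP P R ⟧ φ ∎)
          , (λ P Q R → ≋-by λ {φ} g → begin
            ⟦ mulP (Q ++ R) P ⟧ φ ≡⟨ trans (⟦mulP⟧ (Q ++ R) P φ) (⟦++⟧ Q R _) ⟩
            _ ≡⟨ sym (cong₂ _+_ (⟦mulP⟧ Q P φ) (⟦mulP⟧ R P φ)) ⟩
            ⟦ mulP Q P ⟧ φ + ⟦ mulP R P ⟧ φ ≡⟨ sym (⟦++⟧ (mulP Q P) (mulP R P) φ) ⟩
            ⟦ mulP Q P ++ mulP R P ⟧ φ ∎)
        }
      ; *-comm = *-comm' } }
    where
    open ≡-Reasoning
    *-comm' : ∀ P Q → mulP P Q ≋[ C ] mulP Q P
    *-comm' P Q = ≋-by λ {φ} g → begin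
      ⟦ mulP P Q ⟧ φ ≡⟨ ⟦mulP⟧ P Q φ ⟩
      ⟦ P ⟧ (λ m → ⟦ Q ⟧ (λ o → φ (m ⊕ o))) ≡⟨ ⟦⟧-swap P Q (λ m o → φ (m ⊕ o)) ⟩
      ⟦ Q ⟧ (λ o → ⟦ P ⟧ (λ m → φ (m ⊕ o))) ≡⟨ (⟦⟧-cong Q λ o → ⟦⟧-cong P λ m → ext g (⊕-comm m o)) ⟩
      ⟦ Q ⟧ (λ o → ⟦ P ⟧ (λ m → φ (o ⊕ m))) ≡⟨ sym (⟦mulP⟧ Q P φ) ⟩
      ⟦ mulP Q P ⟧ φ ∎
    *-idˡ : ∀ P → mulP oneP P ≋[ C ] P
    *-idˡ P = ≋-by λ {φ} g → trans (⟦mulP⟧ oneP P φ) (trans (ℤ.+-identityʳ _) (ℤ.*-identityˡ _))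

  torsion-free : ∀ C p .{{_ : NonZero p}} P → (let open RingProducts (quotientRing C) in (p ⋆ P) ≋[ C ] [] → P ≋[ C ] [])
  torsion-free C p P e = ≋-by λ {φ} g → ℤ.*-cancelˡ-≡ (+ p) (⟦ P ⟧ φ) 0ℤ
    (trans (trans (sym (⟦⋆⟧ p φ)) (at e g)) (sym (ℤ.*-zeroʳ (+ p))))
    where
    open RingProducts (quotientRing C)
    ⟦⋆⟧ : ∀ n φ → ⟦ n ⋆ P ⟧ φ ≡ + n * ⟦ P ⟧ φ
    ⟦⋆⟧ zero    φ = refl
    ⟦⋆⟧ (suc n) φ = trans (⟦++⟧ P (n ⋆ P) φ) (trans (cong (_+_ (⟦ P ⟧ φ)) (⟦⋆⟧ n φ)) (sym (ℤ.suc-* (+ n) (⟦ P ⟧ φ))))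

  -- `f-kill` is the dual form of the demand that the image of `C` lie in the ideal of `C'`:
  -- admissible tests pull back to admissible tests, which makes the substitution a ring
  -- homomorphism of quotients.
  record IsSubstitution (C C' : Poly) (f : Exponent → Exponent) : Set where
    field
      f-cong   : ∀ {m m'} → m ≐ m' → f m ≐ f m'
      f-⊕    : ∀ m o → f (m ⊕ o) ≐ f m ⊕ f o
      f-𝟎    : f 𝟎 ≐ 𝟎
      f-kill : ∀ {φ} → Admissible C' φ → ∀ m → ⟦ C ⟧ (λ o → φ (f (m ⊕ o))) ≡ 0ℤ

    pullback : ∀ {φ} → Admissible C' φ → Admissible C (φ ∘ f)
    pullback g .ext e  = ext g (f-cong e)
    pullback g .kill m = f-kill g m

    substitute-cong : ∀ {P Q} → P ≋[ C ] Q → substitute f P ≋[ C' ] substitute f Q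
    substitute-cong {P} {Q} e = ≋-by λ {φ} g → trans (⟦substitute⟧ f P φ) (trans (at e (pullback g)) (sym (⟦substitute⟧ f Q φ)))

    substitute-hom : RingMorphisms.IsRingHomomorphism (CommutativeRing.rawRing (quotientRing C)) (CommutativeRing.rawRing (quotientRing C')) (substitute f)
    substitute-hom = record
      { isSemiringHomomorphism = record
        { isNearSemiringHomomorphism = record
          { +-isMonoidHomomorphism = record
            { isMagmaHomomorphism = record
              { isRelHomomorphism = record { cong = substitute-cong }
              ; homo = λ P Q → ≋-by λ {φ} g → trans (⟦substitute⟧ f (P ++ Q) φ) (trans (⟦++⟧ P Q (φ ∘ f))
                  (sym (trans (⟦++⟧ (substitute f P) (substitute f Q) φ) (cong₂ _+_ (⟦substitute⟧ f P φ) (⟦substitute⟧ f Q φ))))) }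
            ; ε-homo = ≋-by λ _ → refl }
          ; *-homo = λ P Q → ≋-by λ {φ} g → begin
              ⟦ substitute f (mulP P Q) ⟧ φ ≡⟨ trans (⟦substitute⟧ f (mulP P Q) φ) (⟦mulP⟧ P Q (φ ∘ f)) ⟩
              ⟦ P ⟧ (λ m → ⟦ Q ⟧ (λ o → φ (f (m ⊕ o)))) ≡⟨ (⟦⟧-cong P λ m → ⟦⟧-cong Q λ o → ext g (f-⊕ m o)) ⟩
              ⟦ P ⟧ (λ m → ⟦ Q ⟧ (λ o → φ (f m ⊕ f o))) ≡⟨ (⟦⟧-cong P λ m → sym (⟦substitute⟧ f Q _)) ⟩
              ⟦ P ⟧ (λ m → ⟦ substitute f Q ⟧ (λ o → φ (f m ⊕ o))) ≡⟨ sym (⟦substitute⟧ f P _) ⟩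
              _ ≡⟨ sym (⟦mulP⟧ (substitute f P) (substitute f Q) φ) ⟩
              ⟦ mulP (substitute f P) (substitute f Q) ⟧ φ ∎ }
        ; 1#-homo = ≋-by λ {φ} g → cong (λ x → 1ℤ * x + 0ℤ) (ext g f-𝟎) }
      ; -‿homo = λ P → ≋-by λ {φ} g → trans (⟦substitute⟧ f (negate P) φ) (trans (⟦negate⟧ P (φ ∘ f))
          (sym (trans (⟦negate⟧ (substitute f P) φ) (cong -_ (⟦substitute⟧ f P φ))))) }
      where open ≡-Reasoning

-- The literal products of term lists as ring expressions.

module Evaluation where
  open import Defs
  open QBinomial
  open Master
  open Quotients
  open import Algebra.Bundles using (CommutativeRing)
  open import Data.Bool using (true; false; if_then_else_; _∧_)
  open import Data.Nat as ℕ using (ℕ; zero; suc; _∸_; _≡ᵇ_; _<ᵇ_; NonZero)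
  import Data.Nat.Properties as ℕ
  open import Data.Integer as ℤ using (ℤ; +_)
  open import Data.List using (List; []; _∷_; _++_; map; concatMap; applyUpTo; upTo)
  open import Data.List.Properties using (map-∘)
  open import Function using (_∘_; id)
  open import Relation.Binary.PropositionalEquality as ≡ using (_≡_)

  zVar : Poly
  zVar = term (+ 1) 1 0 noX ∷ []

  qVar : Poly
  qVar = term (+ 1) 0 1 noX ∷ []

  xVar : ℕ → ℕ → Poly
  xVar i j = term (+ 1) 0 0 (xv i j 1) ∷ []

  if-+ : ∀ b x y → (if b then x ℕ.+ y else 0) ≡ (if b then x else 0) ℕ.+ (if b then y else 0)
  if-+ true  x y = ≡.refl
  if-+ false x y = ≡.refl

  module InQuotient (C : Poly) where
    open CommutativeRing (quotientRing C)
    open RingProducts (quotientRing C)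

    single-cong : ∀ {s t} → coef s ≡ coef t → exponent s ≐ exponent t → (s ∷ []) ≋[ C ] (t ∷ [])
    single-cong {s} ≡.refl e = ≋-by λ g → ≡.cong (λ x → coef s ℤ.* x ℤ.+ ℤ.0ℤ) (ext g e)

    prodOver-applyUpTo : ∀ {A B : Set} n (g : ℕ → A) (h : A → B) f → prodOver (map h (applyUpTo g n)) f ≡ ∏ n (f ∘ h ∘ g)
    prodOver-applyUpTo zero    g h f = ≡.refl
    prodOver-applyUpTo (suc n) g h f = ≡.cong (mulP (f (h (g 0)))) (prodOver-applyUpTo n (g ∘ suc) h f)

    prodOver-range1 : ∀ n {f g} → (∀ i → f (suc i) ≈ g i) → prodOver (range1 n) f ≈ ∏ n g
    prodOver-range1 n {f} e = trans (reflexive (prodOver-applyUpTo n id suc f)) (∏-cong n e)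

    prodOver-upTo : ∀ n {f g} → (∀ i → f i ≈ g i) → prodOver (upTo n) f ≈ ∏ n g
    prodOver-upTo n {f} e = trans (reflexive (go n id)) (∏-cong n e)
      where
      go : ∀ n (g : ℕ → ℕ) → prodOver (applyUpTo g n) f ≡ ∏ n (f ∘ g)
      go zero    g = ≡.refl
      go (suc n) g = ≡.cong (mulP (f (g 0))) (go n (g ∘ suc))

    prodOver-++ : ∀ {A : Set} (xs ys : List A) f → prodOver (xs ++ ys) f ≈ prodOver xs f * prodOver ys f
    prodOver-++ []       ys f = sym (*-identityˡ _)
    prodOver-++ (x ∷ xs) ys f = trans (*-congˡ {x = f x} (prodOver-++ xs ys f)) (sym (*-assoc (f x) _ _))

    prodOver-concatMap : ∀ {A B : Set} n (u : ℕ → A) (g : A → List B) f →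
      prodOver (concatMap g (map u (upTo n))) f ≈ ∏ n (λ i → prodOver (g (u i)) f)
    prodOver-concatMap n u g f = go n id
      where
      go : ∀ n (w : ℕ → ℕ) → prodOver (concatMap g (map u (applyUpTo w n))) f ≈ ∏ n (λ i → prodOver (g (u (w i))) f)
      go zero    w = refl
      go (suc n) w = trans (prodOver-++ (g (u (w 0))) _ f) (*-congˡ {x = prodOver (g (u (w 0))) f} (go n (w ∘ suc)))

    xVar^ : ∀ i j e → xVar i j ^ e ≈ (term (+ 1) 0 0 (xv i j e) ∷ [])
    xVar^ i j zero    = single-cong ≡.refl ≐[ ≡.refl , ≡.refl , (λ i' j' → ≡.sym (if-same ((i' ≡ᵇ i) ∧ (j' ≡ᵇ j)))) ]
    xVar^ i j (suc e) = trans (*-congˡ {x = xVar i j} (xVar^ i j e))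
      (single-cong ≡.refl ≐[ ≡.refl , ≡.refl , (λ i' j' → ≡.sym (if-+ ((i' ≡ᵇ i) ∧ (j' ≡ᵇ j)) 1 e)) ])

    qVar^ : ∀ t → qVar ^ t ≈ (term (+ 1) 0 t noX ∷ [])
    qVar^ zero    = refl
    qVar^ (suc t) = *-congˡ {x = qVar} (qVar^ t)

    subtract-qx : ∀ u t i b → (u ∷ term (ℤ.- + 1) 0 t (xv i b 1) ∷ []) ≈ (u ∷ []) - qVar ^ t * xVar i b
    subtract-qx u t i b = +-congˡ {x = u ∷ []} (trans
      (single-cong ≡.refl ≐[ ≡.refl , ≡.sym (ℕ.+-identityʳ t) , (λ _ _ → ≡.refl) ])
      (-‿cong {x = mulP (term (+ 1) 0 t noX ∷ []) (xVar i b)} (*-congʳ {x = xVar i b} {term (+ 1) 0 t noX ∷ []} {qVar ^ t} (sym (qVar^ t)))))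

    open MasterPolynomial (quotientRing C) using (master; discriminant)

    module _ (p r m n k s : ℕ) .{{_ : NonZero m}} where

      -- The bridge from lists of terms to ring algebra, where both factorisation and symmetry can
      -- be proved factor by factor.
      Φbar≈master : Φbar p r m n k s ≈ master n k (E1 p r m n k s) (Eω p r m n k s) (Eh p r m n k s) zVar qVar xVar
      Φbar≈master = *-cong
        (trans (prodOver-concatMap (n ∸ 1) suc _ _) (∏-cong (n ∸ 1) λ i →
          trans (reflexive (≡.cong prodP (≡.sym (map-∘ (range1 (vdim n k (suc i)))))))
            (prodOver-range1 (vdim n k (suc i)) λ a → sym (xVar^ (suc i) (suc a) (E1 p r m n k s)))))
        (*-cong
          (prodOver-range1 (n ∸ 1) λ i → prodOver-range1 (vdim n k (suc i)) λ a → prodOver-range1 (vdim n k (suc i)) λ b →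
            pair (a ≡ᵇ b) (prodOver-upTo (Eh p r m n k s) λ t → subtract-qx _ t (suc i) (suc b)))
        (*-cong
          (prodOver-range1 (n ∸ 2) λ i → prodOver-range1 (vdim n k (suc i)) λ a → prodOver-range1 (vdim n k (suc (suc i))) λ b →
            prodOver-upTo (Eω p r m n k s) λ t → subtract-qx _ t (suc (suc i)) (suc b))
        (*-congʳ {x = oneP}
          (prodOver-range1 k λ a → prodOver-upTo (Eω p r m n k s) λ t → *-cong (subtract-qx (term (+ 1) 1 0 noX) t k (suc a)) (subtract-qx (term (+ 1) 0 0 noX) t (n ∸ k) (suc a))))))
        where
        pair : ∀ b {x y} → x ≈ y → (if b then oneP else x) ≈ (if b then oneP else y)
        pair true  e = refl
        pair false e = e

      Δ≈discriminant : Δ p r m n k s ≈ discriminant n k xVar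
      Δ≈discriminant = prodOver-range1 (n ∸ 1) λ i → prodOver-range1 (vdim n k (suc i)) λ a → prodOver-range1 (vdim n k (suc i)) λ b →
        pair (a <ᵇ b) (trans (subtract-qx (term (+ 1) 0 0 (xv (suc i) (suc b) 1)) 0 (suc i) (suc a)) (+-congˡ {x = xVar (suc i) (suc b)} (-‿cong (*-identityˡ (xVar (suc i) (suc a))))))
        where
        pair : ∀ b {x y} → x ≈ y → (if b then x else oneP) ≈ (if b then y else oneP)
        pair true  e = e
        pair false e = refl

-- Alternating functions of exponent vectors.

module AlternatingFunctions where
  open QBinomial
  open Master
  open import Data.Nat
  open import Data.Nat.Properties
  open import Data.Integer as ℤ using (ℤ; 0ℤ; +_)
  open import Data.Product using (_×_; _,_; ∃)
  open import Data.Sum using (inj₁; inj₂)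
  open import Function using (_∘_)
  open import Relation.Nullary using (¬_; Dec; yes; no)
  open import Relation.Nullary.Decidable using (_×-dec_)
  open import Relation.Binary.PropositionalEquality

  self-negative : ∀ {x} → x ≡ ℤ.- x → x ≡ 0ℤ
  self-negative {+ zero} _ = refl

  swapIn-self : ∀ i c a → swapIn i c i a ≡ sw c a
  swapIn-self i c a rewrite ≡ᵇ-refl i = refl

  swapIn-other : ∀ {i₀ i} c a → ¬ (i ≡ i₀) → swapIn i₀ c i a ≡ a
  swapIn-other c a i≢ rewrite ≡ᵇ-≢ i≢ = refl

  sw-self : ∀ c → sw c c ≡ suc c
  sw-self zero    = refl
  sw-self (suc c) = cong suc (sw-self c)

  sw-next : ∀ c → sw c (suc c) ≡ c
  sw-next zero    = refl
  sw-next (suc c) = cong suc (sw-next c)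

  sw-equal : ∀ (f : ℕ → ℕ) c → f c ≡ f (suc c) → ∀ a → f (sw c a) ≡ f a
  sw-equal f zero    e zero          = sym e
  sw-equal f zero    e (suc zero)    = e
  sw-equal f zero    e (suc (suc a)) = refl
  sw-equal f (suc c) e zero          = refl
  sw-equal f (suc c) e (suc a)       = sw-equal (f ∘ suc) c e a

  -- Earlier positions weigh more, so exchanging the two entries of a descent lowers the sum. This
  -- is the termination measure for sorting.
  weightedSum : ℕ → (ℕ → ℕ) → ℕ
  weightedSum zero    f = 0
  weightedSum (suc v) f = suc v * f 0 + weightedSum v (f ∘ suc)

  weightedSum-cong : ∀ v {f g} → (∀ a → f a ≡ g a) → weightedSum v f ≡ weightedSum v g
  weightedSum-cong zero    e = refl
  weightedSum-cong (suc v) e = cong₂ (λ x y → suc v * x + y) (e 0) (weightedSum-cong v (e ∘ suc))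

  weightedSum-sw : ∀ v c f → suc c < v → f (suc c) < f c → weightedSum v (f ∘ sw c) < weightedSum v f
  weightedSum-sw (suc (suc v)) zero f _ l = begin-strict
    (f 1 + suc v * f 1) + (suc v * f 0 + r) <⟨ +-monoˡ-< (suc v * f 0 + r) (+-monoˡ-< (suc v * f 1) l) ⟩
    (f 0 + suc v * f 1) + (suc v * f 0 + r) ≡⟨ solve 4 (λ x y z r → (x :+ y) :+ (z :+ r) := (x :+ z) :+ (y :+ r)) refl (f 0) (suc v * f 1) (suc v * f 0) r ⟩
    (f 0 + suc v * f 0) + (suc v * f 1 + r) ∎
    where
    open import Data.Nat.Solver using (module +-*-Solver)
    open +-*-Solver using (solve; _:+_; _:=_)
    open ≤-Reasoning
    r = weightedSum v (f ∘ suc ∘ suc)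
  weightedSum-sw (suc v) (suc c) f (s≤s l) d = +-monoʳ-< (suc v * f 0) (weightedSum-sw v c (f ∘ suc) l d)

  total : ℕ → (ℕ → ℕ) → ℕ
  total zero    g = 0
  total (suc N) g = g 0 + total N (g ∘ suc)

  total-cong : ∀ N {g h} → (∀ i → g i ≡ h i) → total N g ≡ total N h
  total-cong zero    e = refl
  total-cong (suc N) e = cong₂ _+_ (e 0) (total-cong N (e ∘ suc))

  total-< : ∀ N {g h} i → i < N → g i < h i → (∀ j → ¬ (j ≡ i) → g j ≡ h j) → total N g < total N h
  total-< (suc N) {g} zero    _       d o = +-mono-<-≤ d (≤-reflexive (total-cong N λ j → o (suc j) λ ()))
  total-< (suc N) {g} (suc i) (s≤s l) d o = +-mono-≤-< (≤-reflexive (o 0 λ ()))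
    (total-< N i l d λ j j≢ → o (suc j) (j≢ ∘ suc-injective))

  -- Induction upwards from 0 gives a at most f(a); induction downwards from the largest index,
  -- where f stays below v, gives the converse.
  increasing⇒id : ∀ v (f : ℕ → ℕ) → (∀ a → suc a < v → f a < f (suc a)) → (∀ {a} → a < v → f a < v) →
    ∀ {a} → a < v → f a ≡ a
  increasing⇒id v f inc bd {a} a<v = ≤-antisym (upper (v ∸ suc a) a (m+[n∸m]≡n a<v)) (lower a a<v)
    where
    lower : ∀ a → a < v → a ≤ f a
    lower zero    _ = z≤n
    lower (suc a) l = ≤-<-trans (lower a (<-trans (n<1+n a) l)) (inc a l)
    upper : ∀ d a → suc a + d ≡ v → f a ≤ a
    upper zero    a e = s≤s⁻¹ (subst (f a <_) (trans (sym e) (cong suc (+-identityʳ a))) (bd (subst (a <_) e (m≤m+n (suc a) 0))))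
    upper (suc d) a e = s≤s⁻¹ (≤-trans (inc a (subst (suc a <_) e' (m≤m+n (2 + a) d))) (upper d (suc a) e'))
      where
      e' : suc (suc a) + d ≡ v
      e' = trans (sym (+-suc (suc a) d)) e

  -- Variables are numbered from 1 while transpositions count from 0, hence `suc c`: the entries c +
  -- 1 and c + 2 are exchanged.
  permute : ℕ → ℕ → (ℕ → ℕ → ℕ) → ℕ → ℕ → ℕ
  permute i₀ c u i j = u i (swapIn i₀ (suc c) i j)

  -- Sorting by adjacent transpositions (with a weighted sum as termination measure) reduces every
  -- exponent vector to one with a repeated entry, one outside the boxes [0, v_i), or the staircase.
  module Alternating (N : ℕ) (v : ℕ → ℕ) where

    Agree : (u w : ℕ → ℕ → ℕ) → Set
    Agree u w = ∀ {i a} → i < N → a < v (suc i) → u (suc i) (suc a) ≡ w (suc i) (suc a)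

    alternating-vanishes : (K : (ℕ → ℕ → ℕ) → ℤ) →
      (∀ {u w} → Agree u w → K u ≡ K w) →
      (∀ u {i c} → i < N → suc c < v (suc i) → K (permute (suc i) c u) ≡ ℤ.- K u) →
      (∀ u {i a} → i < N → a < v (suc i) → v (suc i) ≤ u (suc i) (suc a) → K u ≡ 0ℤ) →
      K (λ _ j → j ∸ 1) ≡ 0ℤ →
      ∀ u → K u ≡ 0ℤ
    alternating-vanishes K K-cong K-swap K-support K-base u = go (suc (μ u)) u ≤-refl
      where
      μ : (ℕ → ℕ → ℕ) → ℕ
      μ u = total N λ i → weightedSum (v (suc i)) (u (suc i) ∘ suc)

      Descent : (ℕ → ℕ → ℕ) → ℕ → Set
      Descent u i = ∃ λ c → c < v (suc i) × (suc c < v (suc i) × u (suc i) (2 + c) ≤ u (suc i) (suc c))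

      descent? : ∀ u → Dec (∃ λ i → i < N × Descent u i)
      descent? u = anyUpTo? (λ i → anyUpTo? (λ c → (suc c <? v (suc i)) ×-dec (u (suc i) (2 + c) ≤? u (suc i) (suc c))) (v (suc i))) N

      big? : ∀ u → Dec (∃ λ i → i < N × ∃ λ a → a < v (suc i) × v (suc i) ≤ u (suc i) (suc a))
      big? u = anyUpTo? (λ i → anyUpTo? (λ a → v (suc i) ≤? u (suc i) (suc a)) (v (suc i))) N

      permute-self : ∀ u i c a → permute (suc i) c u (suc i) (suc a) ≡ u (suc i) (suc (sw c a))
      permute-self u i c a = cong (u (suc i)) (swapIn-self (suc i) (suc c) (suc a))

      permute-other : ∀ u i c j a → ¬ (j ≡ i) → permute (suc i) c u (suc j) (suc a) ≡ u (suc j) (suc a)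
      permute-other u i c j a j≢i = cong (u (suc j)) (swapIn-other (suc c) (suc a) (j≢i ∘ suc-injective))

      go : ∀ b u → μ u < b → K u ≡ 0ℤ
      go (suc b) u μ< with descent? u
      -- Descents are taken in the weak sense. Equal neighbours make `u` invariant under a
      -- sign-changing swap, so K(u) is its own negative; a strict descent is swapped and lowers the
      -- measure.
      ... | yes (i , i<N , c , _ , c< , d) with m≤n⇒m<n∨m≡n d
      ...   | inj₂ e = self-negative (trans (K-cong fixed) (K-swap u i<N c<))
        where
        fixed : Agree u (permute (suc i) c u)
        fixed {j} {a} _ _ with j ≟ i
        ... | yes refl = sym (trans (permute-self u i c a) (sw-equal (u (suc i) ∘ suc) c (sym e) a))
        ... | no j≢i   = sym (permute-other u i c j a j≢i)
      ...   | inj₁ d' = ℤ-neg (trans (sym (K-swap u i<N c<)) (go b (permute (suc i) c u) (<-≤-trans μ-drops (s≤s⁻¹ μ<))))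
        where
        ℤ-neg : ∀ {x} → ℤ.- x ≡ 0ℤ → x ≡ 0ℤ
        ℤ-neg {+ zero} _ = refl
        μ-drops : μ (permute (suc i) c u) < μ u
        μ-drops = total-< N i i<N
          (subst (_< weightedSum (v (suc i)) (u (suc i) ∘ suc))
            (sym (weightedSum-cong (v (suc i)) (permute-self u i c)))
            (weightedSum-sw (v (suc i)) c (u (suc i) ∘ suc) c< d'))
          λ j j≢ → weightedSum-cong (v (suc j)) λ a → permute-other u i c j a j≢
      -- All groups are now strictly increasing, and such a vector inside the boxes is the
      -- staircase.
      go (suc b) u μ< | no ascending with big? u
      ... | yes (i , i<N , a , a< , big) = K-support u i<N a< big
      ... | no bounded = trans (K-cong staircase) K-base
        where
        staircase : Agree u (λ _ j → j ∸ 1)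
        staircase {i} i<N = increasing⇒id (v (suc i)) (u (suc i) ∘ suc)
          (λ c c< → ≰⇒> λ d → ascending (i , i<N , c , <-trans (n<1+n c) c< , c< , d))
          (λ {a} a< → ≰⇒> λ big → bounded (i , i<N , a , a< , big))

-- Degree bounds in a single variable.

module Degrees where
  open import Defs
  open Master using (≡ᵇ-refl; ≡ᵇ-≢; if-same)
  open AlternatingFunctions using (total; total-cong)
  open import Data.Bool using (true; false; if_then_else_)
  import Data.Integer as ℤ
  open import Data.Nat
  open import Data.Nat.Properties
  open import Data.Nat.Solver using (module +-*-Solver)
  open import Data.List using (List; []; _∷_; _++_; map; concatMap; applyUpTo; upTo)
  open import Data.List.Relation.Unary.All as All using (All; []; _∷_)
  open import Data.List.Relation.Unary.All.Properties using (++⁺; map⁺)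
  open import Data.List.Properties using (map-∘)
  open import Data.Product using (_×_; _,_)
  open import Function using (_∘_; id)
  open import Relation.Nullary using (¬_; yes; no)
  open import Relation.Binary.PropositionalEquality
  open +-*-Solver using (solve; con; _:+_; _:*_; _:=_)

  total-≤ : ∀ N {g h} → (∀ i → g i ≤ h i) → total N g ≤ total N h
  total-≤ zero    e = z≤n
  total-≤ (suc N) e = +-mono-≤ (e 0) (total-≤ N (e ∘ suc))

  total-+ : ∀ N g h → total N (λ i → g i + h i) ≡ total N g + total N h
  total-+ zero    g h = refl
  total-+ (suc N) g h = trans (cong ((g 0 + h 0) +_) (total-+ N (g ∘ suc) (h ∘ suc)))
    (solve 4 (λ a b c d → a :+ b :+ (c :+ d) := a :+ c :+ (b :+ d)) refl (g 0) (h 0) _ _)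

  total-* : ∀ N c g → total N (λ i → c * g i) ≡ c * total N g
  total-* zero    c g = sym (*-zeroʳ c)
  total-* (suc N) c g = trans (cong (c * g 0 +_) (total-* N c (g ∘ suc))) (sym (*-distribˡ-+ c (g 0) _))

  total-const : ∀ N c → total N (λ _ → c) ≡ N * c
  total-const zero    c = refl
  total-const (suc N) c = cong (c +_) (total-const N c)

  total-0 : ∀ N → total N (λ _ → 0) ≡ 0
  total-0 N = trans (total-const N 0) (*-zeroʳ N)

  total-at : ∀ N i (g : ℕ → ℕ) → total N (λ j → if i ≡ᵇ j then g j else 0) ≤ g i
  total-at zero    i       g = z≤n
  total-at (suc N) zero    g = ≤-reflexive (trans (cong (g 0 +_) (total-0 N)) (+-identityʳ (g 0)))
  total-at (suc N) (suc i) g = total-at N i (g ∘ suc)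

  private
    [_==_] : ℕ → ℕ → ℕ
    [ a == b ] = if a ≡ᵇ b then 1 else 0

  total-indicator : ∀ N i → i < N → total N (λ j → [ i == j ]) ≡ 1
  total-indicator (suc N) zero    _       = cong suc (total-0 N)
  total-indicator (suc N) (suc i) (s≤s l) = total-indicator N i l

  -- Each variable of a group of size V + 1 meets V others, in either position of the pair. This is
  -- its degree in the Vandermonde product.
  ordered-pairs : ∀ V a₀ → a₀ ≤ V → total (suc V) (λ a → total (suc V) λ b →
    if a <ᵇ b then [ a₀ == b ] + [ a₀ == a ] else 0) ≡ V
  ordered-pairs V zero _ = trans (cong₂ _+_ (trans (total-const V 1) (*-identityʳ V))
    (trans (total-cong V λ a → trans (total-cong V λ b → if-same (a <ᵇ b)) (total-0 V)) (total-0 V))) (+-identityʳ V)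
  ordered-pairs (suc V) (suc a₀) (s≤s l) = cong₂ _+_
    (trans (total-cong (suc V) λ b → +-identityʳ [ a₀ == b ]) (total-indicator (suc V) a₀ (s≤s l)))
    (ordered-pairs V a₀ l)

  -- Both orders of a pair occur in the product within a group, so each variable is met twice as
  -- often as in the Vandermonde product.
  distinct-pairs : ∀ V a₀ → a₀ ≤ V → total (suc V) (λ a → total (suc V) λ b →
    if a ≡ᵇ b then 0 else ([ a₀ == a ] + [ a₀ == b ])) ≡ 2 * V
  distinct-pairs V zero _ = cong₂ _+_ (trans (total-const V 1) (*-identityʳ V))
    (trans (total-cong V λ a → cong suc (trans (total-cong V λ b → if-same (a ≡ᵇ b)) (total-0 V)))
      (trans (total-const V 1) (trans (*-identityʳ V) (sym (+-identityʳ V)))))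
  distinct-pairs (suc V) (suc a₀) (s≤s l) = begin
    total (suc V) (λ b → [ a₀ == b ]) + total (suc V) (λ a → [ a₀ == a ] + 0 + f a)
      ≡⟨ cong₂ _+_ (total-indicator (suc V) a₀ (s≤s l)) (total-+ (suc V) (λ a → [ a₀ == a ] + 0) f) ⟩
    1 + (total (suc V) (λ a → [ a₀ == a ] + 0) + total (suc V) f)
      ≡⟨ cong₂ (λ x y → 1 + (x + y)) (trans (total-cong (suc V) λ a → +-identityʳ [ a₀ == a ]) (total-indicator (suc V) a₀ (s≤s l))) (distinct-pairs V a₀ l) ⟩
    1 + (1 + 2 * V) ≡⟨ sym (*-suc 2 V) ⟩
    2 * suc V ∎
    where
    open ≡-Reasoning
    f : ℕ → ℕ
    f a = total (suc V) λ b → if a ≡ᵇ b then 0 else ([ a₀ == a ] + [ a₀ == b ])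

  -- The bound concerns every listed term, before any cancellation, so it adds up over products term
  -- by term.
  DegreeBound : ℕ → ℕ → ℕ → Poly → Set
  DegreeBound i a B = All (λ t → ex t i a ≤ B)

  module _ {i a : ℕ} where

    degree-weaken : ∀ {B B' P} → B ≤ B' → DegreeBound i a B P → DegreeBound i a B' P
    degree-weaken l = All.map (λ e → ≤-trans e l)

    degree-oneP : DegreeBound i a 0 oneP
    degree-oneP = z≤n ∷ []

    degree-mulP : ∀ {B B' P Q} → DegreeBound i a B P → DegreeBound i a B' Q → DegreeBound i a (B + B') (mulP P Q)
    degree-mulP []       Qs = []
    degree-mulP (l ∷ Ps) Qs = ++⁺ (map⁺ (All.map (+-mono-≤ l) Qs)) (degree-mulP Ps Qs)

    degree-prodOver : ∀ {A : Set} n (g : ℕ → A) f {d} → (∀ j → DegreeBound i a (d j) (f (g j))) →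
      DegreeBound i a (total n d) (prodOver (applyUpTo g n) f)
    degree-prodOver zero    g f e = degree-oneP
    degree-prodOver (suc n) g f e = degree-mulP (e 0) (degree-prodOver n (g ∘ suc) f (e ∘ suc))

    degree-map-prodOver : ∀ {A B : Set} n (w : ℕ → A) (g : A → B) f {d} → (∀ j → DegreeBound i a (d j) (f (g (w j)))) →
      DegreeBound i a (total n d) (prodOver (map g (applyUpTo w n)) f)
    degree-map-prodOver zero    w g f e = degree-oneP
    degree-map-prodOver (suc n) w g f e = degree-mulP (e 0) (degree-map-prodOver n (w ∘ suc) g f (e ∘ suc))

    degree-range1 : ∀ n {f d} → (∀ j → DegreeBound i a (d j) (f (suc j))) → DegreeBound i a (total n d) (prodOver (range1 n) f)
    degree-range1 n {f} e = degree-map-prodOver n id suc f e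

    degree-upTo : ∀ n {f B} → (∀ t → DegreeBound i a B (f t)) → DegreeBound i a (n * B) (prodOver (upTo n) f)
    degree-upTo n {f} {B} e = subst (λ x → DegreeBound i a x _) (total-const n B) (degree-prodOver n id f e)

    degree-++-prodOver : ∀ {A B : Set} n (w : ℕ → A) (g : A → B) ys f {d B'} → (∀ j → DegreeBound i a (d j) (f (g (w j)))) →
      DegreeBound i a B' (prodOver ys f) → DegreeBound i a (total n d + B') (prodOver (map g (applyUpTo w n) ++ ys) f)
    degree-++-prodOver zero    w g ys f e tail = tail
    degree-++-prodOver (suc n) w g ys f {d} {B'} e tail = degree-weaken (≤-reflexive (sym (+-assoc (d 0) (total n (d ∘ suc)) B')))
      (degree-mulP (e 0) (degree-++-prodOver n (w ∘ suc) g ys f (e ∘ suc) tail))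

    degree-vars : ∀ n k f {d : ℕ → ℕ → ℕ} → (∀ i' a' → DegreeBound i a (d i' a') (f (suc i' , suc a'))) →
      DegreeBound i a (total (n ∸ 1) λ i' → total (vdim n k (suc i')) (d i')) (prodOver (vars n k) f)
    degree-vars n k f {d} e = go (n ∸ 1) id
      where
      G : ℕ → List (ℕ × ℕ)
      G i = map (λ j → (i , j)) (range1 (vdim n k i))
      D : ℕ → ℕ
      D i' = total (vdim n k (suc i')) (d i')
      go : ∀ N w → DegreeBound i a (total N (D ∘ w)) (prodOver (concatMap G (map suc (applyUpTo w N))) f)
      go zero    w = degree-oneP
      go (suc N) w = subst (λ xs → DegreeBound i a (total (suc N) (D ∘ w)) (prodOver (xs ++ concatMap G (map suc (applyUpTo (w ∘ suc) N))) f))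
        (map-∘ (upTo (vdim n k (suc (w 0)))))
        (degree-++-prodOver (vdim n k (suc (w 0))) id (λ j → (suc (w 0) , suc j)) (concatMap G (map suc (applyUpTo (w ∘ suc) N))) f
          {d (w 0)} {total N (D ∘ w ∘ suc)} (e (w 0)) (go N (w ∘ suc)))

    degree-binX : ∀ i₁ a₁ t i₂ a₂ → DegreeBound i a (xv i₁ a₁ 1 i a + xv i₂ a₂ 1 i a) (binX i₁ a₁ t i₂ a₂)
    degree-binX i₁ a₁ t i₂ a₂ = m≤m+n _ _ ∷ m≤n+m _ _ ∷ []

    degree-ends : ∀ t k k' a' → DegreeBound i a (xv k a' 1 i a + xv k' a' 1 i a) (mulP (binZ t k a') (bin1 t k' a'))
    degree-ends t k k' a' =
      degree-mulP {P = binZ t k a'} {bin1 t k' a'} (z≤n ∷ ≤-refl ∷ []) (z≤n ∷ ≤-refl ∷ [])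

  total-xv : ∀ N i i₀ a₀ e → total N (λ a → xv i (suc a) e i₀ (suc a₀)) ≤ (if i₀ ≡ᵇ i then e else 0)
  total-xv N i i₀ a₀ e with i₀ ≡ᵇ i
  ... | true  = total-at N a₀ (λ _ → e)
  ... | false = ≤-reflexive (total-0 N)

  module Degree (p r m n k s : ℕ) .{{_ : NonZero m}} (i₀ a₀ V : ℕ) (v≡ : vdim n k (suc i₀) ≡ suc V) (a₀≤V : a₀ ≤ V) where
    private
      i = suc i₀
      a = suc a₀
      w = Eω p r m n k s
      h = Eh p r m n k s
      e = E1 p r m n k s
      v = vdim n k

      same-group : (f : ℕ → ℕ → ℕ → ℕ) (bd : ℕ) → (∀ i' a b → ¬ (i₀ ≡ i') → f i' a b ≡ 0) →
        total (suc V) (λ a → total (suc V) (f i₀ a)) ≤ bd →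
        total (n ∸ 1) (λ i' → total (v (suc i')) λ a → total (v (suc i')) (f i' a)) ≤ bd
      same-group f bd off on = ≤-trans (total-≤ (n ∸ 1) row) (total-at (n ∸ 1) i₀ (λ _ → bd))
        where
        row : ∀ i' → total (v (suc i')) (λ a → total (v (suc i')) (f i' a)) ≤ (if i₀ ≡ᵇ i' then bd else 0)
        row i' with i₀ ≟ i'
        ... | no i₀≢i' rewrite ≡ᵇ-≢ i₀≢i' = ≤-reflexive (trans (total-cong (v (suc i')) λ a →
                trans (total-cong (v (suc i')) λ b → off i' a b i₀≢i') (total-0 (v (suc i')))) (total-0 (v (suc i'))))
        ... | yes refl rewrite ≡ᵇ-refl i₀ | v≡ = on

      off-xv : ∀ {i'} a' c → ¬ (i₀ ≡ i') → xv (suc i') a' c i a ≡ 0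
      off-xv {i'} a' c ne rewrite ≡ᵇ-≢ ne = refl

      on-xv : ∀ a' c → xv i (suc a') c i a ≡ (if a₀ ≡ᵇ a' then c else 0)
      on-xv a' c rewrite ≡ᵇ-refl i₀ = refl

    degree-Δ : DegreeBound i a V (Δ p r m n k s)
    degree-Δ = degree-weaken
      (same-group (λ i' a' b' → if a' <ᵇ b' then xv (suc i') (suc b') 1 i a + xv (suc i') (suc a') 1 i a else 0) V
        (λ i' a' b' ne → trans (cong₂ (λ x y → if a' <ᵇ b' then x + y else 0) (off-xv (suc b') 1 ne) (off-xv (suc a') 1 ne)) (if-same (a' <ᵇ b')))
        (≤-reflexive (trans (total-cong (suc V) λ a' → total-cong (suc V) λ b' →
           cong₂ (λ x y → if a' <ᵇ b' then x + y else 0) (on-xv b' 1) (on-xv a' 1)) (ordered-pairs V a₀ a₀≤V))))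
      (degree-range1 (n ∸ 1) λ i' → degree-range1 (v (suc i')) λ a' → degree-range1 (v (suc i')) λ b' → pair (a' <ᵇ b') i' a' b')
      where
      pair : ∀ t i' a' b' → DegreeBound i a (if t then xv (suc i') (suc b') 1 i a + xv (suc i') (suc a') 1 i a else 0)
        (if t then binX (suc i') (suc b') 0 (suc i') (suc a') else oneP)
      pair true  i' a' b' = degree-binX (suc i') (suc b') 0 (suc i') (suc a')
      pair false i' a' b' = degree-oneP

    degree-monomials : DegreeBound i a e (prodOver (vars n k) (λ { (i , j) → term (ℤ.+ 1) 0 0 (xv i j e) ∷ [] }))
    degree-monomials = degree-weaken
      (≤-trans (total-≤ (n ∸ 1) λ i' → total-xv (v (suc i')) (suc i') i a₀ e) (total-at (n ∸ 1) i₀ (λ _ → e)))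
      (degree-vars n k _ {λ i' a' → xv (suc i') (suc a') e i a} λ i' a' → ≤-refl ∷ [])

    degree-within : DegreeBound i a (h * (2 * V)) (prodOver (range1 (n ∸ 1)) (λ i →
          prodOver (range1 (vdim n k i)) λ a →
            prodOver (range1 (vdim n k i)) λ b →
              if a ≡ᵇ b then oneP else
                prodOver (upTo h) λ t → binX i a t i b))
    degree-within = degree-weaken
      (same-group (λ i' a' b' → if a' ≡ᵇ b' then 0 else h * (xv (suc i') (suc a') 1 i a + xv (suc i') (suc b') 1 i a)) (h * (2 * V))
        (λ i' a' b' ne → trans (cong₂ (λ x y → if a' ≡ᵇ b' then 0 else h * (x + y)) (off-xv (suc a') 1 ne) (off-xv (suc b') 1 ne)) (if-zero (a' ≡ᵇ b')))
        (≤-reflexive (begin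
          total (suc V) (λ a' → total (suc V) λ b' → if a' ≡ᵇ b' then 0 else h * (xv i (suc a') 1 i a + xv i (suc b') 1 i a))
            ≡⟨ (total-cong (suc V) λ a' → trans (total-cong (suc V) λ b' →
                 trans (cong₂ (λ x y → if a' ≡ᵇ b' then 0 else h * (x + y)) (on-xv a' 1) (on-xv b' 1)) (if-*′ (a' ≡ᵇ b') _))
                 (total-* (suc V) h (λ b' → if a' ≡ᵇ b' then 0 else ([ a₀ == a' ] + [ a₀ == b' ])))) ⟩
          total (suc V) (λ a' → h * total (suc V) λ b' → if a' ≡ᵇ b' then 0 else ([ a₀ == a' ] + [ a₀ == b' ]))
            ≡⟨ total-* (suc V) h (λ a' → total (suc V) λ b' → if a' ≡ᵇ b' then 0 else ([ a₀ == a' ] + [ a₀ == b' ])) ⟩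
          h * total (suc V) (λ a' → total (suc V) λ b' → if a' ≡ᵇ b' then 0 else ([ a₀ == a' ] + [ a₀ == b' ]))
            ≡⟨ cong (h *_) (distinct-pairs V a₀ a₀≤V) ⟩
          h * (2 * V) ∎)))
      (degree-range1 (n ∸ 1) λ i' → degree-range1 (v (suc i')) λ a' → degree-range1 (v (suc i')) λ b' → pair (a' ≡ᵇ b') i' a' b')
      where
      open ≡-Reasoning
      if-zero : ∀ t → (if t then 0 else h * 0) ≡ 0
      if-zero true  = refl
      if-zero false = *-zeroʳ h
      if-*′ : ∀ t x → (if t then 0 else h * x) ≡ h * (if t then 0 else x)
      if-*′ true  x = sym (*-zeroʳ h)
      if-*′ false x = refl
      pair : ∀ t i' a' b' → DegreeBound i a (if t then 0 else h * (xv (suc i') (suc a') 1 i a + xv (suc i') (suc b') 1 i a))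
        (if t then oneP else prodOver (upTo h) λ t → binX (suc i') (suc a') t (suc i') (suc b'))
      pair true  i' a' b' = degree-oneP
      pair false i' a' b' = degree-upTo h λ t → degree-binX (suc i') (suc a') t (suc i') (suc b')

    -- A variable meets every variable of the two neighbouring groups, here `suc i` and `i₀`, in w
    -- factors each. For an outermost group the absent neighbour only makes the bound weaker.
    degree-between : DegreeBound i a (w * (v (suc i) + v i₀)) (prodOver (range1 (n ∸ 2)) (λ i →
          prodOver (range1 (vdim n k i)) λ a →
            prodOver (range1 (vdim n k (suc i))) λ b →
              prodOver (upTo w) λ t → binX i a t (suc i) b))
    degree-between = degree-weaken bound
      (degree-range1 (n ∸ 2) λ i' → degree-range1 (v (suc i')) λ a' → degree-range1 (v (suc (suc i'))) λ b' →
        degree-upTo w λ t → degree-binX (suc i') (suc a') t (suc (suc i')) (suc b'))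
      where
      open ≤-Reasoning
      row : ∀ i' → total (v (suc i')) (λ a' → total (v (suc (suc i'))) λ b' → w * (xv (suc i') (suc a') 1 i a + xv (suc (suc i')) (suc b') 1 i a))
          ≤ w * ((if i₀ ≡ᵇ i' then v (suc (suc i')) else 0) + (if i₀ ≡ᵇ suc i' then v (suc i') else 0))
      row i' = begin
        total v₁ (λ a' → total v₂ λ b' → w * (X a' + Y b'))
          ≡⟨ total-cong v₁ (λ a' → trans (total-* v₂ w _) (cong (w *_) (trans (total-+ v₂ _ Y) (cong (_+ total v₂ Y) (total-const v₂ (X a')))))) ⟩
        total v₁ (λ a' → w * (v₂ * X a' + total v₂ Y))
          ≡⟨ trans (total-* v₁ w _) (cong (w *_) (trans (total-+ v₁ _ _) (cong₂ _+_ (total-* v₁ v₂ X) (total-const v₁ _)))) ⟩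
        w * (v₂ * total v₁ X + v₁ * total v₂ Y)
          ≤⟨ *-monoʳ-≤ w (+-mono-≤ (*-monoʳ-≤ v₂ (total-xv v₁ (suc i') i a₀ 1)) (*-monoʳ-≤ v₁ (total-xv v₂ (suc (suc i')) i a₀ 1))) ⟩
        w * (v₂ * (if i₀ ≡ᵇ i' then 1 else 0) + v₁ * (if i₀ ≡ᵇ suc i' then 1 else 0))
          ≡⟨ cong₂ (λ x y → w * (x + y)) (select (i₀ ≡ᵇ i') v₂) (select (i₀ ≡ᵇ suc i') v₁) ⟩
        w * ((if i₀ ≡ᵇ i' then v₂ else 0) + (if i₀ ≡ᵇ suc i' then v₁ else 0)) ∎
        where
        v₁ = v (suc i')
        v₂ = v (suc (suc i'))
        X Y : ℕ → ℕ
        X a' = xv (suc i') (suc a') 1 i a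
        Y b' = xv (suc (suc i')) (suc b') 1 i a
        select : ∀ t x → x * (if t then 1 else 0) ≡ (if t then x else 0)
        select true  x = *-identityʳ x
        select false x = *-zeroʳ x
      below : ∀ N i₀ → total N (λ i' → if i₀ ≡ᵇ suc i' then v (suc i') else 0) ≤ v i₀
      below N zero     = ≤-trans (≤-reflexive (total-0 N)) z≤n
      below N (suc i₁) = total-at N i₁ (v ∘ suc)
      bound : total (n ∸ 2) (λ i' → total (v (suc i')) (λ a' → total (v (suc (suc i'))) λ b' → w * (xv (suc i') (suc a') 1 i a + xv (suc (suc i')) (suc b') 1 i a)))
          ≤ w * (v (suc i) + v i₀)
      bound = begin
        _ ≤⟨ total-≤ (n ∸ 2) row ⟩
        _ ≡⟨ trans (total-* (n ∸ 2) w _) (cong (w *_) (total-+ (n ∸ 2) _ _)) ⟩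
        w * (total (n ∸ 2) (λ i' → if i₀ ≡ᵇ i' then v (suc (suc i')) else 0) + total (n ∸ 2) (λ i' → if i₀ ≡ᵇ suc i' then v (suc i') else 0))
          ≤⟨ *-monoʳ-≤ w (+-mono-≤ (total-at (n ∸ 2) i₀ (λ i' → v (suc (suc i')))) (below (n ∸ 2) i₀)) ⟩
        w * (v (suc i) + v i₀) ∎

    degree-ends-factor : DegreeBound i a (w * ([ i == k ] + [ i == n ∸ k ])) (prodOver (range1 k) (λ a →
          prodOver (upTo w) λ t → mulP (binZ t k a) (bin1 t (n ∸ k) a)))
    degree-ends-factor = degree-weaken bound
      (degree-range1 k λ a' → degree-upTo w λ t → degree-ends t k (n ∸ k) (suc a'))
      where
      open ≤-Reasoning
      bound : total k (λ a' → w * (xv k (suc a') 1 i a + xv (n ∸ k) (suc a') 1 i a)) ≤ w * ([ i == k ] + [ i == n ∸ k ])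
      bound = begin
        _ ≡⟨ trans (total-* k w _) (cong (w *_) (total-+ k _ _)) ⟩
        _ ≤⟨ *-monoʳ-≤ w (+-mono-≤ (total-xv k k i a₀ 1) (total-xv k (n ∸ k) i a₀ 1)) ⟩
        w * ([ i == k ] + [ i == n ∸ k ]) ∎

    degree-Φ : DegreeBound i a (V + (e + (h * (2 * V) + (w * (v (suc i) + v i₀) + (w * ([ i == k ] + [ i == n ∸ k ]) + 0))))) (Φ p r m n k s)
    degree-Φ = degree-mulP degree-Δ (degree-mulP degree-monomials (degree-mulP degree-within
      (degree-mulP degree-between (degree-mulP degree-ends-factor degree-oneP))))

-- The leading monomial of the Vandermonde product.

module LeadingTerm where
  open import Defs
  open Quotients using (⟦_⟧)
  open Master using (if-same)
  open AlternatingFunctions using (total; total-cong; module Alternating)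
  open Degrees
  open import Data.Bool using (Bool; true; false; if_then_else_; T)
  open import Data.Bool.ListAction using (and)
  open import Data.Empty using (⊥-elim)
  import Data.Integer as ℤ
  import Data.Integer.Properties as ℤ
  open import Data.Nat
  open import Data.Nat.Properties
  open import Data.List using ([]; _∷_; map; applyUpTo)
  open import Data.List.Relation.Unary.All as All using (All; []; _∷_)
  open import Data.List.Relation.Unary.All.Properties using (++⁺; map⁺; map⁻; concat⁺; concat⁻; applyUpTo⁺₁; applyUpTo⁻)
  open import Data.Product using (_,_; proj₂)
  open import Function using (_∘_; id)
  open import Relation.Nullary using (¬_)
  open import Relation.Binary.PropositionalEquality

  T-and⁺ : ∀ {bs} → All T bs → T (and bs)
  T-and⁺ []                    = _
  T-and⁺ {true ∷ bs} (_ ∷ ps)  = T-and⁺ ps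

  T-and⁻ : ∀ bs → T (and bs) → All T bs
  T-and⁻ []          _ = []
  T-and⁻ (true ∷ bs) t = _ ∷ T-and⁻ bs t

  T-ext : ∀ {b c} → (T b → T c) → (T c → T b) → b ≡ c
  T-ext {true}  {true}  _ _ = refl
  T-ext {true}  {false} f _ = ⊥-elim (f _)
  T-ext {false} {true}  _ g = ⊥-elim (g _)
  T-ext {false} {false} _ _ = refl

  total-cong< : ∀ N {g h} → (∀ {i} → i < N → g i ≡ h i) → total N g ≡ total N h
  total-cong< zero    e = refl
  total-cong< (suc N) e = cong₂ _+_ (e (s≤s z≤n)) (total-cong< N (λ l → e (s≤s l)))

  total-pick : ∀ N i (g : ℕ → ℕ) → i < N → total N (λ j → if j ≡ᵇ i then g j else 0) ≡ g i
  total-pick (suc N) zero    g _       = trans (cong (g 0 +_) (total-0 N)) (+-identityʳ (g 0))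
  total-pick (suc N) (suc i) g (s≤s l) = total-pick N i (g ∘ suc) l

  total-pick′ : ∀ N i (g : ℕ → ℕ) → i < N → total N (λ j → if i ≡ᵇ j then g j else 0) ≡ g i
  total-pick′ (suc N) zero    g _       = trans (cong (g 0 +_) (total-0 N)) (+-identityʳ (g 0))
  total-pick′ (suc N) (suc i) g (s≤s l) = total-pick′ N i (g ∘ suc) l

  -- Taking the larger index from each factor x_b - x_a selects x_{a₀} once for every smaller index,
  -- that is `a₀` times.
  staircase : ∀ V a₀ → a₀ < V → total V (λ a → total V λ b → if a <ᵇ b then (if a₀ ≡ᵇ b then 1 else 0) else 0) ≡ a₀
  staircase (suc V) zero     _       = cong₂ _+_ (total-0 V)
    (trans (total-cong V λ a → trans (total-cong V λ b → if-same (a <ᵇ b)) (total-0 V)) (total-0 V))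
  staircase (suc V) (suc a₀) (s≤s l) = cong₂ _+_ (total-pick′ V a₀ (λ _ → 1) l) (staircase V a₀ l)

  module Variables (n k : ℕ) where
    private
      N = n ∸ 1
      v = vdim n k
    open Alternating N v using (Agree) public

    agrees : (e u : ℕ → ℕ → ℕ) → Bool
    agrees e u = and (map (λ { (i , j) → e i j ≡ᵇ u i j }) (vars n k))

    agrees⁺ : ∀ {e u} → Agree e u → T (agrees e u)
    agrees⁺ {e} {u} ag = T-and⁺ (map⁺ (concat⁺ (map⁺ (map⁺ (applyUpTo⁺₁ id N λ {i} i< →
      map⁺ (map⁺ (applyUpTo⁺₁ id (v (suc i)) λ a< → ≡⇒≡ᵇ _ _ (ag i< a<))))))))

    agrees⁻ : ∀ {e u} → T (agrees e u) → Agree e u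
    agrees⁻ {e} {u} t {i} {a} i< a< = ≡ᵇ⇒≡ _ _
      (applyUpTo⁻ id (v (suc i)) (map⁻ (map⁻ (applyUpTo⁻ id N (map⁻ (map⁻ (concat⁻ (map⁻ (T-and⁻ _ t))))) i<))) a<)

    indicator : (e u : ℕ → ℕ → ℕ) → ℤ.ℤ
    indicator e u = if agrees e u then ℤ.1ℤ else ℤ.0ℤ

    indicator-yes : ∀ {e u} → Agree e u → indicator e u ≡ ℤ.1ℤ
    indicator-yes {e} {u} ag with agrees e u | agrees⁺ {e} {u} ag
    ... | true | _ = refl

    indicator-no : ∀ {e u} → ¬ Agree e u → indicator e u ≡ ℤ.0ℤ
    indicator-no {e} {u} na with agrees e u in eq
    ... | true  = ⊥-elim (na (agrees⁻ {e} {u} (subst T (sym eq) _)))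
    ... | false = refl

    indicator-cong : ∀ {e u e' u'} → (Agree e u → Agree e' u') → (Agree e' u' → Agree e u) → indicator e u ≡ indicator e' u'
    indicator-cong {e} {u} {e'} {u'} f g = cong (λ b → if b then ℤ.1ℤ else ℤ.0ℤ)
      (T-ext (λ t → agrees⁺ {e'} {u'} (f (agrees⁻ {e} {u} t))) (λ t → agrees⁺ {e} {u} (g (agrees⁻ {e'} {u'} t))))

    -- An additive weight that ranks x_b above x_a in the same group for a < b. It plays the role of
    -- a monomial order.
    weight : (ℕ → ℕ → ℕ) → ℕ
    weight e = total N λ i → total (v (suc i)) λ a → a * e (suc i) (suc a)

    weight-+ : ∀ e e' → weight (λ i j → e i j + e' i j) ≡ weight e + weight e'
    weight-+ e e' = trans (total-cong N λ i → trans (total-cong (v (suc i)) λ a → *-distribˡ-+ a (e (suc i) (suc a)) _) (total-+ (v (suc i)) _ _)) (total-+ N _ _)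

    weight-cong : ∀ {e e'} → Agree e e' → weight e ≡ weight e'
    weight-cong ag = total-cong< N λ i< → total-cong< (v (suc _)) λ {a} a< → cong (a *_) (ag i< a<)

    weight-xv : ∀ {i a} → i < N → a < v (suc i) → weight (xv (suc i) (suc a) 1) ≡ a
    weight-xv {i} {a} i< a< = trans (total-cong N row) (total-pick N i (λ _ → a) i<)
      where
      row : ∀ i' → total (v (suc i')) (λ a' → a' * xv (suc i) (suc a) 1 (suc i') (suc a')) ≡ (if i' ≡ᵇ i then a else 0)
      row i' with i' ≡ᵇ i in eq
      ... | false = trans (total-cong (v (suc i')) λ a' → *-zeroʳ a') (total-0 (v (suc i')))
      ... | true with ≡ᵇ⇒≡ i' i (subst T (sym eq) _)
      ...   | refl = trans (total-cong (v (suc i)) λ a' → select (a' ≡ᵇ a) a') (total-pick (v (suc i)) a id a<)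
        where
        select : ∀ t x → x * (if t then 1 else 0) ≡ (if t then x else 0)
        select true  x = *-identityʳ x
        select false x = *-zeroʳ x

    -- The leading term heads the list. `binX` lists the larger variable first and `mulP` multiplies
    -- heads first, so the property passes to products without searching or collecting terms.
    data Leading (u : ℕ → ℕ → ℕ) : Poly → Set where
      leading : ∀ {t ts} → coef t ≡ ℤ.1ℤ → (∀ i j → ex t i j ≡ u i j) →
                All (λ t' → weight (ex t') < weight (ex t)) ts → Leading u (t ∷ ts)

    leading-oneP : Leading (λ _ _ → 0) oneP
    leading-oneP = leading refl (λ _ _ → refl) []

    leading-mulP : ∀ {u u' P Q} → Leading u P → Leading u' Q → Leading (λ i j → u i j + u' i j) (mulP P Q)
    leading-mulP {P = t ∷ ts} {s ∷ ss} (leading c e l) (leading c' e' l') = leading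
      (cong₂ ℤ._*_ c c') (λ i j → cong₂ _+_ (e i j) (e' i j))
      (++⁺ (map⁺ (All.map (λ {s'} s'<s → below t s' (+-monoʳ-< (weight (ex t)) s'<s)) l'))
           (rest ts l))
      where
      below : ∀ t' s' → weight (ex t') + weight (ex s') < weight (ex t) + weight (ex s) →
              weight (ex (mulT t' s')) < weight (ex (mulT t s))
      below t' s' b = subst₂ _<_ (sym (weight-+ (ex t') (ex s'))) (sym (weight-+ (ex t) (ex s))) b
      rest : ∀ ts → All (λ t' → weight (ex t') < weight (ex t)) ts → All (λ t' → weight (ex t') < weight (ex (mulT t s))) (mulP ts (s ∷ ss))
      rest []        []       = []
      rest (t' ∷ ts) (b ∷ bs) = ++⁺ (map⁺ (below t' s (+-mono-<-≤ b ≤-refl) ∷ All.map (λ {s'} s'<s → below t' s' (+-mono-< b s'<s)) l'))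
        (rest ts bs)

    leading-range1 : ∀ m {f} {u : ℕ → ℕ → ℕ → ℕ} → (∀ {i} → i < m → Leading (u i) (f (suc i))) → Leading (λ i j → total m (λ i' → u i' i j)) (prodOver (range1 m) f)
    leading-range1 m {f} {u} e = go m id e
      where
      go : ∀ m (w : ℕ → ℕ) → (∀ {i} → i < m → Leading (u (w i)) (f (suc (w i)))) →
        Leading (λ i j → total m (λ i' → u (w i') i j)) (prodOver (map suc (applyUpTo w m)) f)
      go zero    w e = leading-oneP
      go (suc m) w e = leading-mulP (e (s≤s z≤n)) (go m (w ∘ suc) (λ l → e (s≤s l)))

    module _ (p r m s : ℕ) .{{_ : NonZero m}} where

      private
        pairExponent : ℕ → ℕ → ℕ → ℕ → ℕ → ℕ
        pairExponent i' a' b' i j = if a' <ᵇ b' then xv (suc i') (suc b') 1 i j else 0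

      leading-Δ : Leading (λ i j → total N λ i' → total (v (suc i')) λ a' → total (v (suc i')) λ b' → pairExponent i' a' b' i j) (Δ p r m n k s)
      leading-Δ = leading-range1 N λ {i'} i'< → leading-range1 (v (suc i')) λ {a'} a'< → leading-range1 (v (suc i')) λ {b'} b'< → pair i' a' b' i'< a'< b'<
        where
        pair : ∀ i' a' b' → i' < N → a' < v (suc i') → b' < v (suc i') →
          Leading (pairExponent i' a' b') (if a' <ᵇ b' then binX (suc i') (suc b') 0 (suc i') (suc a') else oneP)
        pair i' a' b' i'< a'< b'< with a' <ᵇ b' in eq
        ... | false = leading-oneP
        ... | true  = leading refl (λ _ _ → refl)
          (subst₂ _<_ (sym (weight-xv i'< a'<)) (sym (weight-xv i'< b'<)) (<ᵇ⇒< a' b' (subst T (sym eq) _)) ∷ [])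

      Δ-exponent : Agree (λ i j → total N λ i' → total (v (suc i')) λ a' → total (v (suc i')) λ b' → pairExponent i' a' b' i j) (λ _ j → j ∸ 1)
      Δ-exponent {i} {a} i< a< = trans (total-cong N row) (total-pick′ N i (λ _ → a) i<)
        where
        row : ∀ i' → total (v (suc i')) (λ a' → total (v (suc i')) λ b' → pairExponent i' a' b' (suc i) (suc a)) ≡ (if i ≡ᵇ i' then a else 0)
        row i' with i ≡ᵇ i' in eq
        ... | false = trans (total-cong (v (suc i')) λ a' → trans (total-cong (v (suc i')) λ b' → if-same (a' <ᵇ b')) (total-0 (v (suc i')))) (total-0 (v (suc i')))
        ... | true with ≡ᵇ⇒≡ i i' (subst T (sym eq) _)
        ...   | refl = staircase (v (suc i)) a a<

      -- The leading term has the staircase exponent and coefficient 1. All other terms have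
      -- strictly smaller weight and cannot share that exponent.
      coefficient-Δ : ⟦ Δ p r m n k s ⟧ (λ o → indicator (proj₂ (proj₂ o)) (λ _ j → j ∸ 1)) ≡ ℤ.1ℤ
      coefficient-Δ with Δ p r m n k s | leading-Δ
      ... | t ∷ ts | leading c e l = cong₂ ℤ._+_ (cong₂ ℤ._*_ c (indicator-yes {ex t} {λ _ j → j ∸ 1} top)) (tail ts l)
        where
        top : Agree (ex t) (λ _ j → j ∸ 1)
        top i< a< = trans (e _ _) (Δ-exponent i< a<)
        tail : ∀ ts → All (λ t' → weight (ex t') < weight (ex t)) ts →
          ⟦ ts ⟧ (λ o → indicator (proj₂ (proj₂ o)) (λ _ j → j ∸ 1)) ≡ ℤ.0ℤ
        tail []        []       = refl
        tail (t' ∷ ts) (b ∷ bs) = cong₂ ℤ._+_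
          (trans (cong (coef t' ℤ.*_) (indicator-no {ex t'} {λ _ j → j ∸ 1} λ ag →
            <-irrefl (trans (weight-cong {ex t'} {λ _ j → j ∸ 1} ag) (sym (weight-cong {ex t} {λ _ j → j ∸ 1} top))) b)) (ℤ.*-zeroʳ (coef t')))
          (tail ts bs)

-- Concavity of the group sizes.

module GroupSizes where
  open import Defs
  open Master using (≡ᵇ-refl; ≡ᵇ-≢)
  open import Data.Bool using (Bool; true; false; if_then_else_; T)
  open import Data.Empty using (⊥-elim)
  open import Data.Nat
  open import Data.Nat.Properties
  open import Data.Nat.Solver using (module +-*-Solver)
  open import Relation.Nullary using (¬_; yes; no)
  open import Relation.Binary.Definitions using (tri<; tri≈; tri>)
  open import Relation.Binary.PropositionalEquality
  open +-*-Solver using (solve; con; _:+_; _:*_; _:=_)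

  <ᵇ-true : ∀ {a b} → a < b → (a <ᵇ b) ≡ true
  <ᵇ-true {a} {b} l with a <ᵇ b | <⇒<ᵇ l
  ... | true | _ = refl

  <ᵇ-false : ∀ {a b} → ¬ a < b → (a <ᵇ b) ≡ false
  <ᵇ-false {a} {b} nl with a <ᵇ b in eq
  ... | true  = ⊥-elim (nl (<ᵇ⇒< a b (subst T (sym eq) _)))
  ... | false = refl

  ≤ᵇ-true : ∀ {a b} → a ≤ b → (a ≤ᵇ b) ≡ true
  ≤ᵇ-true {a} {b} l with a ≤ᵇ b | ≤⇒≤ᵇ l
  ... | true | _ = refl

  ≤ᵇ-false : ∀ {a b} → ¬ a ≤ b → (a ≤ᵇ b) ≡ false
  ≤ᵇ-false {a} {b} nl with a ≤ᵇ b in eq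
  ... | true  = ⊥-elim (nl (≤ᵇ⇒≤ a b (subst T (sym eq) _)))
  ... | false = refl

  suc-<-∸1 : ∀ {i} n → i < n ∸ 1 → suc i < n
  suc-<-∸1 (suc n) l = s≤s l

  module Dimensions (n k : ℕ) (2k≤n : 2 * k ≤ n) where
    private
      v = vdim n k

    k≤n : k ≤ n
    k≤n = ≤-trans (m≤m+n k (k + 0)) 2k≤n

    k≤n∸k : k ≤ n ∸ k
    k≤n∸k = subst (_≤ n ∸ k) (trans (m+n∸m≡n k (k + 0)) (+-identityʳ k)) (∸-monoˡ-≤ k 2k≤n)

    n∸[n∸k] : n ∸ (n ∸ k) ≡ k
    n∸[n∸k] = m∸[m∸n]≡n k≤n

    v-low : ∀ {i} → i < k → v i ≡ i
    v-low i<k rewrite <ᵇ-true i<k = refl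

    v-middle : ∀ {i} → k ≤ i → i ≤ n ∸ k → v i ≡ k
    v-middle k≤i i≤ rewrite <ᵇ-false (≤⇒≯ k≤i) | ≤ᵇ-true i≤ = refl

    v-high : ∀ {i} → n ∸ k < i → v i ≡ n ∸ i
    v-high {i} l rewrite <ᵇ-false (≤⇒≯ (≤-trans k≤n∸k (<⇒≤ l))) | ≤ᵇ-false (<⇒≱ l) = refl

    v-k : v k ≡ k
    v-k = v-middle ≤-refl k≤n∸k

    v-n∸k : v (n ∸ k) ≡ k
    v-n∸k = v-middle k≤n∸k ≤-refl

    v≤k : ∀ i → v i ≤ k
    v≤k i with i <? k | i ≤? n ∸ k
    ... | yes l  | _     = subst (_≤ k) (sym (v-low l)) (<⇒≤ l)
    ... | no ¬l | yes l' = ≤-reflexive (v-middle (≮⇒≥ ¬l) l')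
    ... | no _   | no ¬l = ≤-trans (≤-reflexive (v-high (≰⇒> ¬l))) (≤-trans (∸-monoʳ-≤ n (<⇒≤ (≰⇒> ¬l))) (≤-reflexive n∸[n∸k]))

    v≤i : ∀ i → v i ≤ i
    v≤i i with i <? k
    ... | yes l = ≤-reflexive (v-low l)
    ... | no ¬l = ≤-trans (v≤k i) (≮⇒≥ ¬l)

    v≤n∸i : ∀ i → v i ≤ n ∸ i
    v≤n∸i i with i ≤? n ∸ k
    ... | yes l = ≤-trans (v≤k i) (≤-trans (≤-reflexive (sym n∸[n∸k])) (∸-monoʳ-≤ n l))
    ... | no ¬l = ≤-reflexive (v-high (≰⇒> ¬l))

    n∸-suc : ∀ {i} → i < n → n ∸ i ≡ suc (n ∸ suc i)
    n∸-suc {i} i<n = +-∸-assoc 1 i<n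

    ≡ᵇ-≡ : ∀ {a b} → a ≡ b → (a ≡ᵇ b) ≡ true
    ≡ᵇ-≡ {a} refl = ≡ᵇ-refl a

    bits : Bool → Bool → ℕ
    bits b c = (if b then 1 else 0) + (if c then 1 else 0)

    indicators : ∀ {a b c} → ¬ (a ≡ b) → ¬ (a ≡ c) → bits (a ≡ᵇ b) (a ≡ᵇ c) ≡ 0
    indicators ab ac rewrite ≡ᵇ-≢ ab | ≡ᵇ-≢ ac = refl

    -- The sizes v_i form a trapezoid with slopes 1, 0, -1. Its second difference is -1 at each of
    -- the corners k and n - k, and the indicators count exactly these corners.
    v-concave : ∀ i → i < n ∸ 1 → v (2 + i) + v i + bits (suc i ≡ᵇ k) (suc i ≡ᵇ n ∸ k) ≤ 2 * v (suc i)
    v-concave i i< with <-cmp (suc i) k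
    ... | tri< l _ _ = begin
        v (2 + i) + v i + _ ≤⟨ +-mono-≤ (+-mono-≤ (v≤i (2 + i)) (v≤i i)) (≤-reflexive (indicators (<⇒≢ l) (<⇒≢ (<-≤-trans l k≤n∸k)))) ⟩
        2 + i + i + 0 ≡⟨ solve 1 (λ i → con 2 :+ i :+ i :+ con 0 := con 2 :* (con 1 :+ i)) refl i ⟩
        2 * suc i ≡⟨ cong (2 *_) (sym (v-low l)) ⟩
        2 * v (suc i) ∎
      where open ≤-Reasoning
    ... | tri≈ _ refl _ with suc i ≟ n ∸ suc i
    ...   | no ne = begin
        v (2 + i) + v i + _ ≤⟨ +-mono-≤ (+-mono-≤ (v≤k (2 + i)) (v≤i i)) (≤-reflexive (cong₂ bits (≡ᵇ-refl (suc i)) (≡ᵇ-≢ ne))) ⟩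
        suc i + i + 1 ≡⟨ solve 1 (λ i → con 1 :+ i :+ i :+ con 1 := con 2 :* (con 1 :+ i)) refl i ⟩
        2 * suc i ≡⟨ cong (2 *_) (sym v-k) ⟩
        2 * v (suc i) ∎
      where open ≤-Reasoning
    -- When n = 2k both corners coincide and the trapezoid is a triangle: the second difference at
    -- the peak is -2.
    ...   | yes e = begin
        v (2 + i) + v i + _ ≤⟨ +-mono-≤ (+-mono-≤ (≤-trans (v≤n∸i (2 + i)) (≤-reflexive n∸2+i)) (v≤i i)) (≤-reflexive (cong₂ bits (≡ᵇ-refl (suc i)) (≡ᵇ-≡ e))) ⟩
        i + i + 2 ≡⟨ solve 1 (λ i → i :+ i :+ con 2 := con 2 :* (con 1 :+ i)) refl i ⟩
        2 * suc i ≡⟨ cong (2 *_) (sym v-k) ⟩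
        2 * v (suc i) ∎
      where
      open ≤-Reasoning
      n∸2+i : n ∸ (2 + i) ≡ i
      n∸2+i = suc-injective (trans (sym (n∸-suc (suc-<-∸1 n i<))) (sym e))
    v-concave i i< | tri> _ _ k<I with <-cmp (suc i) (n ∸ k)
    ... | tri< l ne _ = begin
        v (2 + i) + v i + _ ≤⟨ +-mono-≤ (+-mono-≤ (v≤k (2 + i)) (v≤k i)) (≤-reflexive (indicators (>⇒≢ k<I) ne)) ⟩
        k + k + 0 ≡⟨ solve 1 (λ k → k :+ k :+ con 0 := con 2 :* k) refl k ⟩
        2 * k ≡⟨ cong (2 *_) (sym (v-middle (<⇒≤ k<I) (<⇒≤ l))) ⟩
        2 * v (suc i) ∎
      where open ≤-Reasoning
    ... | tri≈ _ e _ = begin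
        v (2 + i) + v i + _ ≤⟨ +-mono-≤ (+-mono-≤ (v≤n∸i (2 + i)) (v≤k i)) (≤-reflexive (cong₂ bits (≡ᵇ-≢ (>⇒≢ k<I)) (≡ᵇ-≡ e))) ⟩
        n ∸ (2 + i) + k + 1 ≡⟨ solve 2 (λ a k → a :+ k :+ con 1 := (con 1 :+ a) :+ k) refl (n ∸ (2 + i)) k ⟩
        suc (n ∸ (2 + i)) + k ≡⟨ cong (_+ k) (trans (sym (n∸-suc (suc-<-∸1 n i<))) (trans (cong (n ∸_) e) n∸[n∸k])) ⟩
        k + k ≡⟨ cong (k +_) (sym (+-identityʳ k)) ⟩
        2 * k ≡⟨ cong (2 *_) (sym (v-middle (<⇒≤ k<I) (≤-reflexive e))) ⟩
        2 * v (suc i) ∎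
      where open ≤-Reasoning
    ... | tri> _ ne l = begin
        v (2 + i) + v i + _ ≤⟨ +-mono-≤ (+-mono-≤ (v≤n∸i (2 + i)) (v≤n∸i i)) (≤-reflexive (indicators (>⇒≢ k<I) ne)) ⟩
        n ∸ (2 + i) + (n ∸ i) + 0 ≡⟨ cong (λ x → n ∸ (2 + i) + x + 0) (trans (n∸-suc (<-trans (n<1+n i) I<n)) (cong suc (n∸-suc I<n))) ⟩
        n ∸ (2 + i) + (2 + (n ∸ (2 + i))) + 0 ≡⟨ solve 1 (λ a → a :+ (con 2 :+ a) :+ con 0 := con 2 :* (con 1 :+ a)) refl (n ∸ (2 + i)) ⟩
        2 * suc (n ∸ (2 + i)) ≡⟨ cong (2 *_) (trans (sym (n∸-suc I<n)) (sym (v-high l))) ⟩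
        2 * v (suc i) ∎
      where
      open ≤-Reasoning
      I<n : suc i < n
      I<n = suc-<-∸1 n i<

-- Antisymmetry of Φ under adjacent transpositions.

module Transpositions where
  open import Defs
  open QBinomial
  open Master
  open Quotients
  open Evaluation
  open AlternatingFunctions
  open GroupSizes
  open import Algebra.Bundles using (CommutativeRing)
  open import Data.Bool using (true; false; if_then_else_; T)
  open import Data.List using ([])
  open import Data.Nat
  open import Data.Nat.Properties
  open import Data.Product using (_,_)
  open import Relation.Binary.PropositionalEquality as ≡ using (_≡_)

  sw-involutive : ∀ c a → sw c (sw c a) ≡ a
  sw-involutive zero    zero          = ≡.refl
  sw-involutive zero    (suc zero)    = ≡.refl
  sw-involutive zero    (suc (suc a)) = ≡.refl
  sw-involutive (suc c) zero          = ≡.refl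
  sw-involutive (suc c) (suc a)       = ≡.cong suc (sw-involutive c a)

  sw-≡ᵇ-move : ∀ c a b → (sw c a ≡ᵇ b) ≡ (a ≡ᵇ sw c b)
  sw-≡ᵇ-move c a b = ≡.trans (≡.cong (sw c a ≡ᵇ_) (≡.sym (sw-involutive c b))) (sw-≡ᵇ c a (sw c b))

  permuteExponent : ℕ → ℕ → Exponent → Exponent
  permuteExponent i₀ c (a , b , e) = a , b , permute i₀ c e

  -- Precomposing the exponent moves the variable by the inverse permutation, which for a
  -- transposition is the same one.
  permute-xv : ∀ i₀ c i a i' j' → permute i₀ c (xv i (suc a) 1) i' j' ≡ xv i (suc (swapIn i₀ c i a)) 1 i' j'
  permute-xv i₀ c i a i' j' with i' ≡ᵇ i in eq
  ... | false = ≡.refl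
  ... | true with ≡ᵇ⇒≡ i' i (≡.subst T (≡.sym eq) _)
  ...   | ≡.refl with i ≡ᵇ i₀
  ...     | true  = ≡.cong (λ b → if b then 1 else 0) (sw-≡ᵇ-move (suc c) j' (suc a))
  ...     | false = ≡.refl

  module Antisymmetry (C : Poly) (n k : ℕ) (2k≤n : 2 * k ≤ n) (i c : ℕ) (i< : i < n ∸ 1) (c< : suc c < vdim n k (suc i)) where
    open Dimensions n k 2k≤n
    open CommutativeRing (quotientRing C) hiding (_+_; _*_; 0#; 1#)
    private
      module A = CommutativeRing (quotientRing C)
      module F = MasterPolynomial (quotientRing []) n k
      module M = MasterPolynomial (quotientRing C) n k

      τ : Exponent → Exponent
      τ = permuteExponent (suc i) c

      τ-substitution : IsSubstitution [] C τ
      τ-substitution = record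
        { f-cong = λ e → ≐[ z≡ e , q≡ e , (λ i' j' → x≡ e i' _) ]
        ; f-⊕    = λ _ _ → ≐-refl
        ; f-𝟎    = ≐-refl
        -- The source imposes no relations; those of `C` enter only in the target, so nothing has to
        -- be killed.
        ; f-kill = λ _ _ → ≡.refl
        }
      open IsSubstitution τ-substitution
      open MasterHomomorphism (quotientRing []) (quotientRing C) (substitute τ) substitute-hom n k
      open M.Swap i c i< c< v-k v-n∸k

      x-swap : ∀ i' a → substitute τ (xVar i' (suc a)) ≈ xVar i' (suc (swapIn (suc i) c i' a))
      x-swap i' a = InQuotient.single-cong C ≡.refl ≐[ ≡.refl , ≡.refl , permute-xv (suc i) c i' a ]

    module _ (p r m s : ℕ) .{{_ : NonZero m}} where

      Δ-swap : substitute τ (Δ p r m n k s) ≈ negate (Δ p r m n k s)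
      Δ-swap = trans (substitute-cong (InQuotient.Δ≈discriminant [] p r m n k s))
        (trans (discriminant-homo xVar)
        (trans (discriminant-swap xVar (λ i a → substitute τ (xVar i a)) x-swap)
          (-‿cong (sym (InQuotient.Δ≈discriminant C p r m n k s)))))

      Φbar-swap : substitute τ (Φbar p r m n k s) ≈ Φbar p r m n k s
      Φbar-swap = trans (substitute-cong (InQuotient.Φbar≈master [] p r m n k s))
        (trans (master-homo (E1 p r m n k s) (Eω p r m n k s) (Eh p r m n k s) zVar qVar xVar)
        (trans (master-swap xVar (λ i a → substitute τ (xVar i a)) x-swap (E1 p r m n k s) (Eω p r m n k s) (Eh p r m n k s) zVar qVar)
          (sym (InQuotient.Φbar≈master C p r m n k s))))

      Φ-swap : substitute τ (Φ p r m n k s) ≈ negate (Φ p r m n k s)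
      Φ-swap = trans (*-homo (Δ p r m n k s) (Φbar p r m n k s))
        (trans (*-cong Δ-swap Φbar-swap) (sym (-‿distribˡ-* (Δ p r m n k s) (Φbar p r m n k s))))
        where
        open import Algebra.Properties.Ring ring using (-‿distribˡ-*)
        open import Algebra.Morphism.Structures using (module RingMorphisms)
        open RingMorphisms.IsRingHomomorphism substitute-hom using (*-homo)

-- Factorisation of Φ modulo a cyclotomic polynomial.

module Multiplicativity where
  open import Defs
  open QBinomial
  open Arithmetic
  open Master
  open Quotients
  open Evaluation
  open import Algebra.Bundles using (CommutativeRing)
  open import Data.Bool using (true; false; if_then_else_; _∧_)
  import Data.Integer as ℤ
  open import Data.List using ([]; _∷_; map; applyUpTo; upTo)
  open import Data.Nat as ℕ hiding (_^_)
  open import Data.Nat.Primality using (Prime; prime⇒nonZero)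
  import Data.Nat.Properties as ℕ
  open import Data.Product using (_,_; proj₁; proj₂)
  open import Function using (_∘_; id)
  open import Relation.Binary.PropositionalEquality as ≡ using (_≡_)

  -- The cyclotomic polynomial of a prime power p h, namely (1 - q^{p h}) / (1 - q^h).
  cyclotomic : ℕ → ℕ → Poly
  cyclotomic p h = map (λ i → term (ℤ.+ 1) 0 (i * h) noX) (upTo p)

  -- The substitution z to z^P, x to x^P and q to 1; forgetting the exponent of q is evaluation at q
  -- = 1.
  powers : ℕ → Exponent → Exponent
  powers P (a , b , e) = P * a , 0 , λ i j → P * e i j

  powers-substitution : ∀ C P → IsSubstitution [] C (powers P)
  powers-substitution C P = record
    { f-cong = λ e → ≐[ ≡.cong (P *_) (z≡ e) , ≡.refl , (λ i j → ≡.cong (P *_) (x≡ e i j)) ]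
    ; f-⊕    = λ { (a , b , e) (a' , b' , e') → ≐[ ℕ.*-distribˡ-+ P a a' , ≡.refl , (λ i j → ℕ.*-distribˡ-+ P (e i j) (e' i j)) ] }
    ; f-𝟎    = ≐[ ℕ.*-zeroʳ P , ≡.refl , (λ _ _ → ℕ.*-zeroʳ P) ]
    ; f-kill = λ _ _ → ≡.refl
    }

  zVar^ : ∀ C t → (let open RingProducts (quotientRing C)) → (zVar ^ t) ≋[ C ] (term (ℤ.+ 1) t 0 noX ∷ [])
  zVar^ C zero    = ≋-by λ _ → ≡.refl
  zVar^ C (suc t) = CommutativeRing.*-congˡ (quotientRing C) {x = zVar} (zVar^ C t)

  module CyclotomicQuotient {p : ℕ} (pr : Prime p) (p-odd : Odd p) (j' : ℕ) where

    h P : ℕ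
    h = p ℕ.^ j'
    P = p ℕ.^ suc j'

    C : Poly
    C = cyclotomic p h

    open CommutativeRing (quotientRing C) hiding (_+_; _*_)
    open RingProducts (quotientRing C)
    open InQuotient C using (qVar^; single-cong)
    open Gauss using (qprod; module Cyclotomic)

    ∑-singles : ∀ n (w : ℕ → ℕ) → ∑ n (λ i → (qVar ^ h) ^ w i) ≈ map (λ i → term (ℤ.+ 1) 0 (i * h) noX) (applyUpTo w n)
    ∑-singles zero    w = refl
    ∑-singles (suc n) w = +-cong {x = (qVar ^ h) ^ w 0} {y = term (ℤ.+ 1) 0 (w 0 * h) noX ∷ []}
      (trans (^-assocʳ qVar h (w 0)) (trans (qVar^ (h * w 0)) (reflexive (≡.cong (λ e → term (ℤ.+ 1) 0 e noX ∷ []) (ℕ.*-comm h (w 0))))))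
      (∑-singles n (w ∘ suc))

    C≈0 : C ≈ []
    C≈0 = ≋-by λ g → kill g 𝟎

    module Q = Cyclotomic qVar p h (trans (∑-singles p id) C≈0)
      (λ a → torsion-free C p {{prime⇒nonZero pr}} a)
      (PrimePower.gcd-proper pr j') (proj₁ (odd-^ p-odd (suc j'))) (proj₂ (odd-^ p-odd (suc j')))

    module _ (r m l : ℕ) .{{_ : NonZero m}} (n k : ℕ) (2r≤m : 2 * r ≤ m) (p≡ : p ≡ l * m + 1) where
      open Exponents p r m l n k 2r≤m p≡ p-odd
      open MasterPolynomial (quotientRing C) n k
      private
        module F = MasterPolynomial (quotientRing []) n k
        open Multiplicative qVar P Q.qprod-blocks

      substitute-powers : ∀ t → substitute (powers P) (Φbar p r m n k t) ≈
        master (E1 p r m n k t) (Eω p r m n k t) (Eh p r m n k t) (zVar ^ P) oneP (λ i a → xVar i a ^ P)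
      substitute-powers t = trans (substitute-cong (InQuotient.Φbar≈master [] p r m n k t))
        (trans (master-homo (E1 p r m n k t) (Eω p r m n k t) (Eh p r m n k t) zVar qVar xVar)
          (master-cong (E1 p r m n k t) (Eω p r m n k t) (Eh p r m n k t)
            (trans (single-cong ≡.refl ≐[ ℕ.*-identityʳ P , ≡.refl , (λ _ _ → ℕ.*-zeroʳ P) ]) (sym (zVar^ C P)))
            (single-cong ≡.refl ≐[ ℕ.*-zeroʳ P , ≡.refl , (λ _ _ → ℕ.*-zeroʳ P) ])
            (λ i a → trans (single-cong ≡.refl ≐[ ℕ.*-zeroʳ P , ≡.refl , (λ i' j' → scale ((i' ≡ᵇ i) ∧ (j' ≡ᵇ a))) ])
              (sym (InQuotient.xVar^ C i a P)))))
        where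
        open IsSubstitution (powers-substitution C P)
        open MasterHomomorphism (quotientRing []) (quotientRing C) (substitute (powers P)) substitute-hom n k
        scale : ∀ b → P * (if b then 1 else 0) ≡ (if b then P else 0)
        scale true  = ℕ.*-identityʳ P
        scale false = ℕ.*-zeroʳ P

      Φbar-split : ∀ t → Φbar p r m n k (suc j' + t) ≈ mulP (Φbar p r m n k (suc j')) (substitute (powers P) (Φbar p r m n k t))
      Φbar-split t = trans (InQuotient.Φbar≈master C p r m n k (suc j' + t))
        (trans (reflexive (exponents (E1-+ (suc j') t) (Eω-+ (suc j') t) (Eh-+ (suc j') t)))
        (trans (master-* (e1 (suc j')) (eω (suc j')) (eh (suc j')) (e1 t) (eω t) (eh t) zVar xVar)
          (*-cong (sym (InQuotient.Φbar≈master C p r m n k (suc j'))) (sym (substitute-powers t)))))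
        where
        e1 eω eh : ℕ → ℕ
        e1 s = E1 p r m n k s
        eω s = Eω p r m n k s
        eh s = Eh p r m n k s
        exponents : ∀ {a b c a' b' c'} → a ≡ a' → b ≡ b' → c ≡ c' → master a b c zVar qVar xVar ≡ master a' b' c' zVar qVar xVar
        exponents ≡.refl ≡.refl ≡.refl = ≡.refl

      -- Δ is kept with the level-j factor, so that the factor whose exponents are restricted to -1
      -- modulo P is antisymmetric.
      Φ-split : ∀ t → Φ p r m n k (suc j' + t) ≈ mulP (substitute (powers P) (Φbar p r m n k t)) (Φ p r m n k (suc j'))
      Φ-split t = trans (*-congˡ {x = D} (Φbar-split t))
        (trans (sym (*-assoc D (Φbar p r m n k (suc j')) (substitute (powers P) (Φbar p r m n k t))))
          (*-comm (mulP D (Φbar p r m n k (suc j'))) (substitute (powers P) (Φbar p r m n k t))))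
        where D = Δ p r m n k (suc j')

-- Coefficient extraction by test functions.

module CoefficientExtraction where
  open import Defs
  open QBinomial
  open Quotients
  open AlternatingFunctions
  open Degrees
  open LeadingTerm
  open Transpositions
  open Multiplicativity
  open import Data.Bool using (Bool; true; false; if_then_else_)
  open import Data.Integer as ℤ using (ℤ; 0ℤ; 1ℤ)
  import Data.Integer.Properties as ℤ
  open import Data.List using ([]; _∷_; map; upTo)
  open import Data.List.Relation.Unary.All as All using (All; []; _∷_)
  open import Data.Nat as ℕ hiding (_^_)
  import Data.Nat.Properties as ℕ
  open import Data.Product using (_,_; proj₂)
  open import Function using (_∘_)
  open import Relation.Nullary using (yes; no)
  open import Relation.Binary.PropositionalEquality

  ⟦⟧-cong-All : ∀ {P φ ψ} → All (λ t → φ (exponent t) ≡ ψ (exponent t)) P → ⟦ P ⟧ φ ≡ ⟦ P ⟧ ψ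
  ⟦⟧-cong-All []                = refl
  ⟦⟧-cong-All {t ∷ P} (e ∷ es) = cong₂ ℤ._+_ (cong (coef t ℤ.*_) e) (⟦⟧-cong-All es)

  ⟦⟧-vanish : ∀ {P φ} → All (λ t → φ (exponent t) ≡ 0ℤ) P → ⟦ P ⟧ φ ≡ 0ℤ
  ⟦⟧-vanish {P} a = trans (⟦⟧-cong-All {ψ = λ _ → 0ℤ} a) (⟦⟧-0 P)

  embed : P2 → Poly
  embed = map λ { (c , a , b) → term c a b noX }

  XFree : Poly → Set
  XFree = All (λ t → ∀ i j → ex t i j ≡ 0)

  cyclotomic-XFree : ∀ p h → XFree (cyclotomic p h)
  cyclotomic-XFree p h = go (upTo p)
    where
    go : ∀ is → XFree (map (λ i → term (ℤ.+ 1) 0 (i * h) noX) is)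
    go []       = []
    go (i ∷ is) = (λ _ _ → refl) ∷ go is

  Kills : Poly → (ℕ → ℕ → ℤ) → Set
  Kills C φ = ∀ a b → ⟦ C ⟧ (λ { (a' , b' , _) → φ (a + a') (b + b') }) ≡ 0ℤ

  restrict : Test → ℕ → ℕ → ℤ
  restrict g a b = g (a , b , noX)

  restrict-kills : ∀ {C g} → XFree C → Admissible C g → Kills C (restrict g)
  restrict-kills xf adm a b = trans (⟦⟧-cong-All (All.map (λ x0 → ext adm ≐[ refl , refl , (λ i j → sym (x0 i j)) ]) xf)) (kill adm (a , b , noX))

  module Coefficients (n k : ℕ) where
    open Variables n k

    -- Pairing a polynomial with this test applies φ to its coefficient of x^u, a polynomial in z
    -- and q.
    coefTest : (ℕ → ℕ → ℕ) → (ℕ → ℕ → ℤ) → Test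
    coefTest u φ (a , b , e) = indicator e u ℤ.* φ a b

    coefTest-indicator : ∀ {u u'} φ o → indicator (proj₂ (proj₂ o)) u ≡ indicator (proj₂ (proj₂ o)) u' → coefTest u φ o ≡ coefTest u' φ o
    coefTest-indicator φ (a , b , e) eq = cong (ℤ._* φ a b) eq

    coefTest-ext : ∀ u φ {m m'} → m ≐ m' → coefTest u φ m ≡ coefTest u φ m'
    coefTest-ext u φ {a , b , e} {a' , b' , e'} q = cong₂ ℤ._*_
      (indicator-cong {e} {u} {e'} {u} (λ ag i< a< → trans (sym (x≡ q _ _)) (ag i< a<)) (λ ag i< a< → trans (x≡ q _ _) (ag i< a<)))
      (cong₂ φ (z≡ q) (q≡ q))

    -- `C` contains no x, so multiplication by it commutes with taking x-coefficients, and
    -- extraction descends to the quotient.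
    coefTest-admissible : ∀ {C} u φ → XFree C → Kills C φ → Admissible C (coefTest u φ)
    coefTest-admissible u φ xf ks .ext = coefTest-ext u φ
    coefTest-admissible {C} u φ xf ks .kill (a , b , e) = begin
      ⟦ C ⟧ (λ o → coefTest u φ ((a , b , e) ⊕ o))
        ≡⟨ ⟦⟧-cong-All (All.map (λ x0 → coefTest-ext u φ ≐[ refl , refl , (λ i j → trans (cong (e i j +_) (x0 i j)) (ℕ.+-identityʳ (e i j))) ]) xf) ⟩
      ⟦ C ⟧ (λ { (a' , b' , _) → indicator e u ℤ.* φ (a + a') (b + b') })
        ≡⟨ ⟦⟧-* C (indicator e u) (λ { (a' , b' , _) → φ (a + a') (b + b') }) ⟩
      indicator e u ℤ.* ⟦ C ⟧ (λ { (a' , b' , _) → φ (a + a') (b + b') })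
        ≡⟨ cong (indicator e u ℤ.*_) (ks a b) ⟩
      indicator e u ℤ.* 0ℤ ≡⟨ ℤ.*-zeroʳ (indicator e u) ⟩
      0ℤ ∎
      where open ≡-Reasoning

    target : ℕ → ℕ → ℕ → ℕ → ℕ
    target p s _ j = j * p ℕ.^ s ∸ 1

    ⟦coeffX⟧ : ∀ p s A g → ⟦ embed (coeffX p n k s A) ⟧ g ≡ ⟦ A ⟧ (coefTest (target p s) (restrict g))
    ⟦coeffX⟧ p s []      g = refl
    ⟦coeffX⟧ p s (t ∷ A) g = trans value (cong summand {isTarget p n k s t} {agrees (ex t) (target p s)} refl)
      where
      rest : ℤ
      rest = ⟦ A ⟧ (coefTest (target p s) (restrict g))
      summand : Bool → ℤ
      summand b = coef t ℤ.* ((if b then 1ℤ else 0ℤ) ℤ.* g (ez t , eqq t , noX)) ℤ.+ rest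
      value : ⟦ embed (coeffX p n k s (t ∷ A)) ⟧ g ≡ summand (isTarget p n k s t)
      value with isTarget p n k s t
      ... | true  = cong₂ ℤ._+_ (cong (coef t ℤ.*_) (sym (ℤ.*-identityˡ _))) (⟦coeffX⟧ p s A g)
      ... | false = trans (⟦coeffX⟧ p s A g) (sym (trans (cong (ℤ._+ rest) (ℤ.*-zeroʳ (coef t))) (ℤ.+-identityˡ _)))

    coefficient-vanish : ∀ {A u B i a} φ → DegreeBound (suc i) (suc a) B A → i < n ∸ 1 → a < vdim n k (suc i) →
      B < u (suc i) (suc a) → ⟦ A ⟧ (coefTest u φ) ≡ 0ℤ
    coefficient-vanish {A} {u} φ bd i< a< B< = ⟦⟧-vanish {A} (All.map (λ {t} le →
      cong (ℤ._* φ (ez t) (eqq t)) (indicator-no {ex t} {u} λ ag → ℕ.<-irrefl (ag i< a<) (ℕ.≤-<-trans le B<))) bd)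

    module _ {i c} (i< : i < n ∸ 1) (c< : suc c < vdim n k (suc i)) where

      sw-< : ∀ {a v} c → suc c < v → a < v → sw c a < v
      sw-< {zero}          {suc zero}    zero    (s≤s ()) _
      sw-< {zero}          {suc (suc v)} zero    l (s≤s z≤n) = s≤s (s≤s z≤n)
      sw-< {suc zero}      {suc v}       zero    l l' = s≤s z≤n
      sw-< {suc (suc a)}   {suc v}       zero    l l' = l'
      sw-< {zero}          {suc v}       (suc c) l l' = s≤s z≤n
      sw-< {suc a}         {suc v}       (suc c) (s≤s l) (s≤s l') = s≤s (sw-< c l l')

      agree-permute : ∀ {e u} → Agree (permute (suc i) c e) u → Agree e (permute (suc i) c u)
      agree-permute {e} {u} ag {j} {a} j< a< with j ℕ.≟ i
      ... | yes refl = begin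
          e (suc i) (suc a) ≡⟨ cong (e (suc i) ∘ suc) (sym (sw-involutive c a)) ⟩
          e (suc i) (suc (sw c (sw c a))) ≡⟨ cong (e (suc i)) (sym (swapIn-self (suc i) (suc c) (suc (sw c a)))) ⟩
          permute (suc i) c e (suc i) (suc (sw c a)) ≡⟨ ag i< (sw-< c c< a<) ⟩
          u (suc i) (suc (sw c a)) ≡⟨ cong (u (suc i)) (sym (swapIn-self (suc i) (suc c) (suc a))) ⟩
          permute (suc i) c u (suc i) (suc a) ∎
        where open ≡-Reasoning
      ... | no j≢i = trans (cong (e (suc j)) (sym (swapIn-other (suc c) (suc a) (j≢i ∘ ℕ.suc-injective))))
          (trans (ag j< a<) (cong (u (suc j)) (sym (swapIn-other (suc c) (suc a) (j≢i ∘ ℕ.suc-injective)))))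

      agree-permute′ : ∀ {e u} → Agree e (permute (suc i) c u) → Agree (permute (suc i) c e) u
      agree-permute′ {e} {u} ag j< a< = sym (agree-permute {u} {e} (λ j< a< → sym (ag j< a<)) j< a<)

      -- Permuting the exponent to be extracted amounts to permuting the variables of `A`, where
      -- antisymmetry supplies the sign.
      coefficient-swap : ∀ {C A} u φ → Admissible C (coefTest u φ) → substitute (permuteExponent (suc i) c) A ≋[ C ] negate A →
        ⟦ A ⟧ (coefTest (permute (suc i) c u) φ) ≡ ℤ.- ⟦ A ⟧ (coefTest u φ)
      coefficient-swap {C} {A} u φ adm anti = begin
        ⟦ A ⟧ (coefTest (permute (suc i) c u) φ)
          ≡⟨ ⟦⟧-cong A (λ { (a , b , e) → cong (ℤ._* φ a b) (indicator-cong {e} {permute (suc i) c u} {permute (suc i) c e} {u} (agree-permute′ {e} {u}) (agree-permute {e} {u})) }) ⟩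
        ⟦ A ⟧ (coefTest u φ ∘ permuteExponent (suc i) c)
          ≡⟨ sym (⟦substitute⟧ (permuteExponent (suc i) c) A (coefTest u φ)) ⟩
        ⟦ substitute (permuteExponent (suc i) c) A ⟧ (coefTest u φ) ≡⟨ at anti adm ⟩
        ⟦ negate A ⟧ (coefTest u φ) ≡⟨ ⟦negate⟧ A (coefTest u φ) ⟩
        ℤ.- ⟦ A ⟧ (coefTest u φ) ∎
        where open ≡-Reasoning

-- The splitting of T_{j+t} modulo the cyclotomic factor of level j.

module CoefficientSplitting where
  open import Defs
  open Arithmetic
  open Quotients
  open AlternatingFunctions
  open Degrees
  open LeadingTerm
  open GroupSizes
  open Transpositions
  open Multiplicativity
  open CoefficientExtraction
  open import Data.Bool using (true; false; if_then_else_)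
  open import Data.Integer as ℤ using (ℤ; 0ℤ; 1ℤ)
  import Data.Integer.Properties as ℤ
  open import Data.Integer.Tactic.RingSolver using (solve-∀)
  open import Data.List using (List; []; _∷_; map)
  open import Data.List.Relation.Unary.All as All using (All; []; _∷_)
  open import Data.List.Relation.Unary.All.Properties using (++⁺; map⁺)
  open import Data.Nat as ℕ
  open import Data.Nat.Properties
  open import Data.Nat.Solver using (module +-*-Solver)
  open import Data.Nat.Primality using (Prime)
  open import Data.Product using (_×_; _,_; proj₁; proj₂)
  open import Relation.Nullary using (¬_; yes; no)
  open import Relation.Binary.PropositionalEquality

  ZFree : Poly → Set
  ZFree = All (λ t → ez t ≡ 0)

  ZFree-mulP : ∀ {P Q} → ZFree P → ZFree Q → ZFree (mulP P Q)
  ZFree-mulP []       Qs = []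
  ZFree-mulP (e ∷ Ps) Qs = ++⁺ (map⁺ (All.map (cong₂ _+_ e) Qs)) (ZFree-mulP Ps Qs)

  ZFree-prodOver : ∀ {A : Set} (xs : List A) f → (∀ x → ZFree (f x)) → ZFree (prodOver xs f)
  ZFree-prodOver []       f e = refl ∷ []
  ZFree-prodOver (x ∷ xs) f e = ZFree-mulP (e x) (ZFree-prodOver xs f e)

  -- When Φ_t is expanded as Δ Φbar_t, the factor depending on the z-exponent must be unaffected by
  -- Δ; this allows it to be pulled out of the sum over the terms of Δ.
  ZFree-Δ : ∀ p r m n k s .{{_ : NonZero m}} → ZFree (Δ p r m n k s)
  ZFree-Δ p r m n k s = ZFree-prodOver (range1 (n ∸ 1)) _ λ i → ZFree-prodOver (range1 (vdim n k i)) _ λ a → ZFree-prodOver (range1 (vdim n k i)) _ λ b →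
    pair (a <ᵇ b) i a b
    where
    pair : ∀ t i a b → ZFree (if t then binX i b 0 i a else oneP)
    pair true  i a b = refl ∷ refl ∷ []
    pair false i a b = refl ∷ []

  powerZ : ℕ → Exponent → Exponent
  powerZ P (a , b , e) = P * a , 0 , e

  -- Evaluation at z = q = 1, used to read the coefficients of Δ as integers.
  one : ℕ → ℕ → ℤ
  one _ _ = 1ℤ

  module Factorization {p : ℕ} (pr : Prime p) (p-odd : Odd p) (j' : ℕ) (r m l n k : ℕ) .{{_ : NonZero m}}
    (2r≤m : 2 * r ≤ m) (p≡ : p ≡ l * m + 1) (2k≤n : 2 * k ≤ n) where

    open CyclotomicQuotient pr p-odd j' using (P; C; Φ-split)
    open Exponents p r m l n k 2r≤m p≡ p-odd
    open Dimensions n k 2k≤n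
    open Variables n k
    open Coefficients n k
    open Alternating (n ∸ 1) (vdim n k) using (alternating-vanishes)

    private
      j = suc j'
      v = vdim n k
      ΦJ D : Poly
      ΦJ = Φ p r m n k j
      D  = Δ p r m n k j

      xf : XFree C
      xf = cyclotomic-XFree p (p ^ j')

    -- The exponents congruent to -1 modulo P, parametrised by their quotients `u`.
    stretch : (ℕ → ℕ → ℕ) → ℕ → ℕ → ℕ
    stretch u i a = P * u i a + (P ∸ 1)

    P≡suc : P ≡ suc (P ∸ 1)
    P≡suc = trans (p^s≡ j) (cong suc (sym (p^s∸1≡ j)))

    -- The group-size inequality turns w(A + B) into 2w(V + 1), and the two balances of exponents
    -- then reduce the degree to V + (P-1) + V(P-1) + w. Since w is at most P - 1, this is at most
    -- P(V+1) + (P-1) - 1: the margin is exactly one.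
    degree-< : ∀ V u e w h A B → e + w ≡ P ∸ 1 → 2 * h + 2 * w ≡ P ∸ 1 → A + B ≤ 2 * suc V → suc V ≤ u →
      V + (e + (h * (2 * V) + (w * A + (w * B + 0)))) < P * u + (P ∸ 1)
    degree-< V u e w h A B ew hw AB≤ V<u = begin-strict
      V + (e + (h * (2 * V) + (w * A + (w * B + 0))))
        ≡⟨ solve 6 (λ V e h w A B → V :+ (e :+ (h :* (con 2 :* V) :+ (w :* A :+ (w :* B :+ con 0)))) := V :+ e :+ h :* (con 2 :* V) :+ w :* (A :+ B)) refl V e h w A B ⟩
      V + e + h * (2 * V) + w * (A + B)
        ≤⟨ +-monoʳ-≤ (V + e + h * (2 * V)) (*-monoʳ-≤ w AB≤) ⟩
      V + e + h * (2 * V) + w * (2 * suc V)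
        ≡⟨ solve 4 (λ V e h w → V :+ e :+ h :* (con 2 :* V) :+ w :* (con 2 :* (con 1 :+ V)) := V :+ (e :+ w) :+ V :* (con 2 :* h :+ con 2 :* w) :+ w) refl V e h w ⟩
      V + (e + w) + V * (2 * h + 2 * w) + w
        ≡⟨ cong₂ (λ x y → V + x + V * y + w) ew hw ⟩
      V + P₁ + V * P₁ + w
        ≤⟨ +-monoʳ-≤ (V + P₁ + V * P₁) (≤-trans (m≤n+m w e) (≤-reflexive ew)) ⟩
      V + P₁ + V * P₁ + P₁
        <⟨ n<1+n _ ⟩
      suc (V + P₁ + V * P₁ + P₁)
        ≡⟨ solve 2 (λ V P₁ → con 1 :+ (V :+ P₁ :+ V :* P₁ :+ P₁) := (con 1 :+ P₁) :* (con 1 :+ V) :+ P₁) refl V P₁ ⟩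
      suc P₁ * suc V + P₁
        ≡⟨ cong (λ x → x * suc V + P₁) (sym P≡suc) ⟩
      P * suc V + P₁
        ≤⟨ +-monoˡ-≤ P₁ (*-monoʳ-≤ P V<u) ⟩
      P * u + P₁ ∎
      where
      open ≤-Reasoning
      open +-*-Solver using (solve; con; _:+_; _:*_; _:=_)
      P₁ = P ∸ 1

    support : ∀ φ u {i a} → i < n ∸ 1 → a < v (suc i) → v (suc i) ≤ u (suc i) (suc a) →
      ⟦ ΦJ ⟧ (coefTest (stretch u) φ) ≡ 0ℤ × ⟦ D ⟧ (coefTest u one) ≡ 0ℤ
    support φ u {i} {a} i< a< big =
      coefficient-vanish {ΦJ} {stretch u} φ (Degree.degree-Φ p r m n k j i a V v≡ a≤V) i< a<
        (degree-< V (u (suc i) (suc a)) (E1 p r m n k j) (Eω p r m n k j) (Eh p r m n k j) (v (2 + i) + v i) _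
          (E1+Eω j) (2Eh+2Eω j) (≤-trans (v-concave i i<) (≤-reflexive (cong (2 *_) v≡))) (subst (_≤ u (suc i) (suc a)) v≡ big))
      , coefficient-vanish {D} {u} one (Degree.degree-Δ p r m n k j i a V v≡ a≤V) i< a< (subst (_≤ u (suc i) (suc a)) v≡ big)
      where
      V : ℕ
      V = v (suc i) ∸ 1
      v≡ : v (suc i) ≡ suc V
      v≡ = sym (m+[n∸m]≡n (≤-trans (s≤s z≤n) a<))
      a≤V : a ≤ V
      a≤V = s≤s⁻¹ (subst (a <_) v≡ a<)

    target-stretch : ∀ a → suc a * P ∸ 1 ≡ P * a + (P ∸ 1)
    target-stretch a = begin
      suc a * P ∸ 1 ≡⟨ cong (λ x → (x + a * P) ∸ 1) P≡suc ⟩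
      (P ∸ 1) + a * P ≡⟨ trans (+-comm (P ∸ 1) (a * P)) (cong (_+ (P ∸ 1)) (*-comm a P)) ⟩
      P * a + (P ∸ 1) ∎
      where open ≡-Reasoning

    -- Both sides are alternating in u and vanish outside the boxes [0, v_i), so only the staircase matters.
    coefficient-stretch : ∀ φ → Kills C φ → ∀ u →
      ⟦ ΦJ ⟧ (coefTest (stretch u) φ) ≡ ⟦ D ⟧ (coefTest u one) ℤ.* ⟦ ΦJ ⟧ (coefTest (target p j) φ)
    coefficient-stretch φ ks u = ℤ.i-j≡0⇒i≡j _ _ (alternating-vanishes K K-cong K-swap K-support K-base u)
      where
      κ : ℤ
      κ = ⟦ ΦJ ⟧ (coefTest (target p j) φ)
      K : (ℕ → ℕ → ℕ) → ℤ
      K u = ⟦ ΦJ ⟧ (coefTest (stretch u) φ) ℤ.- ⟦ D ⟧ (coefTest u one) ℤ.* κ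
      agree-indicator : ∀ {u w} → Agree u w → ∀ e → indicator e u ≡ indicator e w
      agree-indicator {u} {w} ag e = indicator-cong {e} {u} {e} {w} (λ ag' i< a< → trans (ag' i< a<) (ag i< a<)) (λ ag' i< a< → trans (ag' i< a<) (sym (ag i< a<)))
      ⟦⟧-agree : ∀ A φ {u w} → Agree u w → ⟦ A ⟧ (coefTest u φ) ≡ ⟦ A ⟧ (coefTest w φ)
      ⟦⟧-agree A φ {u} {w} ag = ⟦⟧-cong A λ o → coefTest-indicator {u} {w} φ o (agree-indicator ag (proj₂ (proj₂ o)))
      K-cong : ∀ {u w} → Agree u w → K u ≡ K w
      K-cong {u} {w} ag = cong₂ (λ x y → x ℤ.- y ℤ.* κ)
        (⟦⟧-agree ΦJ φ {stretch u} {stretch w} (λ i< a< → cong (λ x → P * x + (P ∸ 1)) (ag i< a<))) (⟦⟧-agree D one {u} {w} ag)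
      K-swap : ∀ u {i c} → i < n ∸ 1 → suc c < v (suc i) → K (permute (suc i) c u) ≡ ℤ.- K u
      K-swap u {i} {c} i< c< = trans (cong₂ (λ x y → x ℤ.- y ℤ.* κ)
        (coefficient-swap i< c< {C} {ΦJ} (stretch u) φ (coefTest-admissible (stretch u) φ xf ks) (Antisymmetry.Φ-swap C n k 2k≤n i c i< c< p r m j))
        (coefficient-swap i< c< {[]} {D} u one (coefTest-admissible u one [] (λ _ _ → refl)) (Antisymmetry.Δ-swap [] n k 2k≤n i c i< c< p r m j)))
        (lemma (⟦ ΦJ ⟧ (coefTest (stretch u) φ)) (⟦ D ⟧ (coefTest u one)) κ)
        where
        lemma : ∀ x y c → ℤ.- x ℤ.- (ℤ.- y) ℤ.* c ≡ ℤ.- (x ℤ.- y ℤ.* c)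
        lemma = solve-∀
      K-support : ∀ u {i a} → i < n ∸ 1 → a < v (suc i) → v (suc i) ≤ u (suc i) (suc a) → K u ≡ 0ℤ
      K-support u i< a< big = cong₂ (λ x y → x ℤ.- y ℤ.* κ) (proj₁ (support φ u i< a< big)) (proj₂ (support φ u i< a< big))
      -- Stretching the staircase gives P(a-1) + P - 1 = aP - 1, the target exponent itself, and the
      -- staircase coefficient of Δ is 1.
      K-base : K (λ _ a → a ∸ 1) ≡ 0ℤ
      K-base = trans (cong₂ (λ x y → x ℤ.- y ℤ.* κ)
        (⟦⟧-agree ΦJ φ {stretch (λ _ a → a ∸ 1)} {target p j} (λ {i} {a} _ _ → sym (target-stretch a)))
        (trans (⟦⟧-cong D λ { (_ , _ , e) → ℤ.*-identityʳ (indicator e (λ _ a → a ∸ 1)) }) (coefficient-Δ p r m j)))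
        (trans (cong (λ x → κ ℤ.- x) (ℤ.*-identityˡ κ)) (ℤ.+-inverseʳ κ))

    -- This self-similarity of the exponents is why P-th powers from Φbar_t force the exponents of
    -- Φ_j to be -1 modulo P.
    target-split : ∀ t i a → target p (j + t) i (suc a) ≡ P * target p t i (suc a) + (P ∸ 1)
    target-split t i a = begin
      suc a * p ^ (j + t) ∸ 1 ≡⟨ cong (λ x → suc a * x ∸ 1) (^-distribˡ-+-* p j t) ⟩
      suc a * (P * p ^ t) ∸ 1 ≡⟨ cong (_∸ 1) (solve 3 (λ a P x → a :* (P :* x) := a :* x :* P) refl (suc a) P (p ^ t)) ⟩
      suc a * p ^ t * P ∸ 1 ≡⟨ cong (λ x → x * P ∸ 1) (sym (m+[n∸m]≡n pos)) ⟩
      suc (suc a * p ^ t ∸ 1) * P ∸ 1 ≡⟨ target-stretch (suc a * p ^ t ∸ 1) ⟩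
      P * (suc a * p ^ t ∸ 1) + (P ∸ 1) ∎
      where
      open ≡-Reasoning
      open +-*-Solver using (solve; con; _:+_; _:*_; _:=_)
      pos : 1 ≤ suc a * p ^ t
      pos = subst (λ x → 1 ≤ suc a * x) (sym (p^s≡ t)) (s≤s z≤n)

    -- A term x^e of Φbar_t contributes x^{P e}, so Φ_j must supply the stretch of the difference
    -- between the target at level t and e. Its coefficient there is that of Δ at this difference
    -- times the base coefficient.
    coefficient-at : ∀ t φ → Kills C φ → ∀ (e : ℕ → ℕ → ℕ) →
      ⟦ ΦJ ⟧ (λ { (a , b , e') → indicator (λ i j → P * e i j + e' i j) (target p (j + t)) ℤ.* φ a b })
      ≡ ⟦ D ⟧ (λ { (_ , _ , e') → indicator (λ i j → e' i j + e i j) (target p t) }) ℤ.* ⟦ ΦJ ⟧ (coefTest (target p j) φ)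
    -- Subtraction of exponents is truncated. If e exceeds the target anywhere, neither side
    -- contains a matching monomial.
    coefficient-at t φ ks e with anyUpTo? (λ i → anyUpTo? (λ a → target p t (suc i) (suc a) <? e (suc i) (suc a)) (v (suc i))) (n ∸ 1)
    ... | yes (i , i< , a , a< , big) = trans
        (trans (⟦⟧-cong ΦJ λ { (z , q , e') → cong (ℤ._* φ z q) (indicator-no {λ i j → P * e i j + e' i j} {target p (j + t)} (tooBig e')) }) (⟦⟧-0 ΦJ))
        (sym (cong (ℤ._* ⟦ ΦJ ⟧ (coefTest (target p j) φ)) (trans (⟦⟧-cong D λ { (_ , _ , e') → indicator-no {λ i j → e' i j + e i j} {target p t} (tooBig′ e') }) (⟦⟧-0 D))))
      where
      tooBig : ∀ e' → ¬ Agree (λ i j → P * e i j + e' i j) (target p (j + t))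
      tooBig e' ag = <-irrefl (sym (trans (ag i< a<) (target-split t (suc i) a))) (begin-strict
        P * target p t (suc i) (suc a) + (P ∸ 1) <⟨ n<1+n _ ⟩
        suc (P * target p t (suc i) (suc a) + (P ∸ 1)) ≡⟨ sym (+-suc _ (P ∸ 1)) ⟩
        P * target p t (suc i) (suc a) + suc (P ∸ 1) ≡⟨ cong (P * target p t (suc i) (suc a) +_) (sym P≡suc) ⟩
        P * target p t (suc i) (suc a) + P ≡⟨ trans (+-comm _ P) (sym (*-suc P _)) ⟩
        P * suc (target p t (suc i) (suc a)) ≤⟨ *-monoʳ-≤ P big ⟩
        P * e (suc i) (suc a) ≤⟨ m≤m+n _ _ ⟩
        P * e (suc i) (suc a) + e' (suc i) (suc a) ∎)
        where open ≤-Reasoning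
      tooBig′ : ∀ e' → ¬ Agree (λ i j → e' i j + e i j) (target p t)
      tooBig′ e' ag = <-irrefl (sym (ag i< a<)) (<-≤-trans big (m≤n+m _ _))
    ... | no small = begin
        _ ≡⟨ ⟦⟧-cong ΦJ (λ { (a , b , e') → cong (ℤ._* φ a b)
               (indicator-cong {λ i j → P * e i j + e' i j} {target p (j + t)} {e'} {stretch u}
                 (λ ag {i} i< a< → +-cancelˡ-≡ _ _ _ (trans (ag i< a<) (split i< a<)))
                 (λ ag {i} {a} i< a< → trans (cong (P * e (suc i) (suc a) +_) (ag i< a<)) (sym (split i< a<)))) }) ⟩
        ⟦ ΦJ ⟧ (coefTest (stretch u) φ) ≡⟨ coefficient-stretch φ ks u ⟩
        ⟦ D ⟧ (coefTest u one) ℤ.* κ ≡⟨ cong (ℤ._* κ) (⟦⟧-cong D (λ { (_ , _ , e') → trans (ℤ.*-identityʳ (indicator e' u))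
               (indicator-cong {e'} {u} {λ i j → e' i j + e i j} {target p t}
                 (λ ag {i} {a} i< a< → trans (cong (_+ e (suc i) (suc a)) (ag i< a<)) (m∸n+n≡m (e≤ i< a<)))
                 (λ ag {i} {a} i< a< → +-cancelʳ-≡ (e (suc i) (suc a)) _ _ (trans (ag i< a<) (sym (m∸n+n≡m (e≤ i< a<)))))) })) ⟩
        _ ∎
      where
      open ≡-Reasoning
      κ = ⟦ ΦJ ⟧ (coefTest (target p j) φ)
      u : ℕ → ℕ → ℕ
      u i a = target p t i a ∸ e i a
      e≤ : ∀ {i a} → i < n ∸ 1 → a < v (suc i) → e (suc i) (suc a) ≤ target p t (suc i) (suc a)
      e≤ {i} {a} i< a< = ≮⇒≥ λ big → small (i , i< , a , a< , big)
      split : ∀ {i a} → i < n ∸ 1 → a < v (suc i) → target p (j + t) (suc i) (suc a) ≡ P * e (suc i) (suc a) + stretch u (suc i) (suc a)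
      split {i} {a} i< a< = begin
        target p (j + t) (suc i) (suc a) ≡⟨ target-split t (suc i) a ⟩
        P * target p t (suc i) (suc a) + (P ∸ 1) ≡⟨ cong (λ x → P * x + (P ∸ 1)) (sym (m+[n∸m]≡n (e≤ i< a<))) ⟩
        P * (e (suc i) (suc a) + u (suc i) (suc a)) + (P ∸ 1) ≡⟨ cong (_+ (P ∸ 1)) (*-distribˡ-+ P (e (suc i) (suc a)) _) ⟩
        P * e (suc i) (suc a) + P * u (suc i) (suc a) + (P ∸ 1) ≡⟨ +-assoc (P * e (suc i) (suc a)) _ _ ⟩
        P * e (suc i) (suc a) + stretch u (suc i) (suc a) ∎

    coefficients : ℕ → Poly
    coefficients s = embed (coeffX p n k s (Φ p r m n k s))

    -- Both sides become the same sum over the terms z^a q^b x^e of Φbar_t: the left through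
    -- `Φ-split` and `coefficient-at`, the right by expanding Φ_t = Δ Φbar_t. The exponent b drops
    -- out since q is set to 1 in that factor.
    coefficients-split : ∀ t → coefficients (j + t) ≋[ C ] mulP (substitute (powerZ P) (coefficients t)) (coefficients j)
    coefficients-split t = ≋-by go
      where
      go : ∀ {g} → Admissible C g → ⟦ coefficients (j + t) ⟧ g ≡ ⟦ mulP (substitute (powerZ P) (coefficients t)) (coefficients j) ⟧ g
      go {g} adm = trans left (sym right)
        where
        open ≡-Reasoning
        φ : ℕ → ℕ → ℤ
        φ = restrict g
        ks : Kills C φ
        ks = restrict-kills xf adm
        κ : ℕ → ℤ
        κ a = ⟦ ΦJ ⟧ (coefTest (target p j) (λ a' b' → φ (P * a + a') b'))
        common : ℤ
        common = ⟦ Φbar p r m n k t ⟧ (λ { (a , b , e) → ⟦ D ⟧ (λ { (_ , _ , e') → indicator (λ i j → e' i j + e i j) (target p t) }) ℤ.* κ a })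
        shift-kills : ∀ a → Kills C (λ a' b' → φ (P * a + a') b')
        shift-kills a a' b' = trans (⟦⟧-cong C λ { (z , q , _) → cong (λ x → φ x (b' + q)) (sym (+-assoc (P * a) a' z)) }) (ks (P * a + a') b')
        left : ⟦ coefficients (j + t) ⟧ g ≡ common
        left = begin
          ⟦ coefficients (j + t) ⟧ g
            ≡⟨ ⟦coeffX⟧ p (j + t) (Φ p r m n k (j + t)) g ⟩
          ⟦ Φ p r m n k (j + t) ⟧ (coefTest (target p (j + t)) φ)
            ≡⟨ at (Φ-split r m l n k 2r≤m p≡ t) (coefTest-admissible (target p (j + t)) φ xf ks) ⟩
          ⟦ mulP (substitute (powers P) (Φbar p r m n k t)) ΦJ ⟧ (coefTest (target p (j + t)) φ)
            ≡⟨ trans (⟦mulP⟧ (substitute (powers P) (Φbar p r m n k t)) ΦJ _) (⟦substitute⟧ (powers P) (Φbar p r m n k t) _) ⟩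
          ⟦ Φbar p r m n k t ⟧ (λ o → ⟦ ΦJ ⟧ (λ o' → coefTest (target p (j + t)) φ (powers P o ⊕ o')))
            ≡⟨ (⟦⟧-cong (Φbar p r m n k t) λ { (a , b , e) → coefficient-at t (λ a' b' → φ (P * a + a') b') (shift-kills a) e }) ⟩
          common ∎
        right : ⟦ mulP (substitute (powerZ P) (coefficients t)) (coefficients j) ⟧ g ≡ common
        right = begin
          ⟦ mulP (substitute (powerZ P) (coefficients t)) (coefficients j) ⟧ g
            ≡⟨ trans (⟦mulP⟧ (substitute (powerZ P) (coefficients t)) (coefficients j) g) (⟦substitute⟧ (powerZ P) (coefficients t) _) ⟩
          ⟦ coefficients t ⟧ (λ o → ⟦ coefficients j ⟧ (λ o' → g (powerZ P o ⊕ o')))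
            ≡⟨ ⟦coeffX⟧ p t (Φ p r m n k t) _ ⟩
          ⟦ Φ p r m n k t ⟧ (coefTest (target p t) (λ a b → ⟦ coefficients j ⟧ (λ o' → g (powerZ P (a , b , noX) ⊕ o'))))
            ≡⟨ (⟦⟧-cong (Φ p r m n k t) λ { (a , b , e) → cong (indicator e (target p t) ℤ.*_) (⟦coeffX⟧ p j ΦJ (λ o' → g (powerZ P (a , b , noX) ⊕ o'))) }) ⟩
          ⟦ mulP D (Φbar p r m n k t) ⟧ (coefTest (target p t) (λ a _ → κ a))
            ≡⟨ trans (⟦mulP⟧ D (Φbar p r m n k t) _) (⟦⟧-swap D (Φbar p r m n k t) (λ d o → coefTest (target p t) (λ a _ → κ a) (d ⊕ o))) ⟩
          ⟦ Φbar p r m n k t ⟧ (λ o → ⟦ D ⟧ (λ d → coefTest (target p t) (λ a _ → κ a) (d ⊕ o)))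
            ≡⟨ (⟦⟧-cong (Φbar p r m n k t) λ { (a , b , e) → begin
                 ⟦ D ⟧ (λ d → coefTest (target p t) (λ a _ → κ a) (d ⊕ (a , b , e)))
                   ≡⟨ ⟦⟧-cong-All (All.map (λ {d} z0 → trans (cong (λ x → indicator (λ i j → ex d i j + e i j) (target p t) ℤ.* κ (x + a)) z0) (ℤ.*-comm _ (κ a))) (ZFree-Δ p r m n k j)) ⟩
                 ⟦ D ⟧ (λ { (_ , _ , e') → κ a ℤ.* indicator (λ i j → e' i j + e i j) (target p t) })
                   ≡⟨ ⟦⟧-* D (κ a) (λ { (_ , _ , e') → indicator (λ i j → e' i j + e i j) (target p t) }) ⟩
                 κ a ℤ.* ⟦ D ⟧ (λ { (_ , _ , e') → indicator (λ i j → e' i j + e i j) (target p t) })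
                   ≡⟨ ℤ.*-comm (κ a) _ ⟩
                 ⟦ D ⟧ (λ { (_ , _ , e') → indicator (λ i j → e' i j + e i j) (target p t) }) ℤ.* κ a ∎ }) ⟩
          common ∎

-- From the cyclotomic factors to divisibility by their product.

module Divisibility where
  open import Defs
  open QBinomial
  open Quotients
  open Multiplicativity using (cyclotomic)
  open CoefficientExtraction using (embed; Kills; ⟦⟧-cong-All; ⟦⟧-vanish)
  open import Data.Bool using (Bool; true; false; if_then_else_; _∧_; T)
  open import Data.Bool.Properties using (∧-zeroʳ)
  open import Data.Empty using (⊥-elim)
  open import Data.Integer as ℤ using (ℤ; 0ℤ; 1ℤ; +_; _+_; _*_; -_; _-_)
  import Data.Integer.Properties as ℤ
  open import Data.Integer.Tactic.RingSolver using (solve-∀)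
  open import Data.List using ([]; _∷_; _++_; map; applyUpTo; upTo)
  open import Data.List.Properties using (map-++)
  open import Data.List.Relation.Unary.All as All using (All; []; _∷_)
  open import Data.List.Relation.Unary.All.Properties using (++⁺; map⁺)
  import Data.List.Relation.Unary.All.Properties as AllP
  open import Data.Nat as ℕ using (ℕ; zero; suc; NonZero; _<_; _≤_; _≡ᵇ_; s≤s; z≤n)
  open import Data.Nat.DivMod using (_%_; m<n⇒m%n≡m; [m+n]%n≡m%n)
  import Data.Nat.Properties as ℕ
  open import Data.Product using (_×_; _,_; proj₁; proj₂; ∃)
  open import Data.Sum using (inj₁; inj₂)
  open import Function using (_∘_; id)
  open import Relation.Nullary using (yes; no)
  open import Relation.Binary.PropositionalEquality

  open import Algebra.Properties.AbelianGroup ℤ.+-0-abelianGroup using (∙-cancelˡ)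
  open RingProducts ℤ.+-*-commutativeRing using (∑)

  ∑-cong< : ∀ n {f g} → (∀ {i} → i < n → f i ≡ g i) → ∑ n f ≡ ∑ n g
  ∑-cong< zero    e = refl
  ∑-cong< (suc n) e = cong₂ _+_ (e (s≤s z≤n)) (∑-cong< n (λ l → e (s≤s l)))

  ∑-cong : ∀ n {f g : ℕ → ℤ} → (∀ i → f i ≡ g i) → ∑ n f ≡ ∑ n g
  ∑-cong n e = ∑-cong< n (λ {i} _ → e i)

  ∑-+ : ∀ n f g → ∑ n (λ i → f i + g i) ≡ ∑ n f + ∑ n g
  ∑-+ zero    f g = refl
  ∑-+ (suc n) f g = trans (cong (_+_ ((f 0 + g 0))) (∑-+ n (f ∘ suc) (g ∘ suc))) (lemma (f 0) (g 0) _ _)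
    where
    lemma : ∀ a b c d → (a + b) + (c + d) ≡ (a + c) + (b + d)
    lemma = solve-∀

  ∑-* : ∀ n c f → ∑ n (λ i → c * f i) ≡ c * ∑ n f
  ∑-* zero    c f = sym (ℤ.*-zeroʳ c)
  ∑-* (suc n) c f = trans (cong (_+_ (c * f 0)) (∑-* n c (f ∘ suc))) (sym (ℤ.*-distribˡ-+ c (f 0) _))

  ∑-0 : ∀ n → ∑ n (λ _ → 0ℤ) ≡ 0ℤ
  ∑-0 zero    = refl
  ∑-0 (suc n) = trans (ℤ.+-identityˡ _) (∑-0 n)

  ∑-const : ∀ n c → ∑ n (λ _ → c) ≡ + n * c
  ∑-const zero    c = refl
  ∑-const (suc n) c = trans (cong (_+_ c) (∑-const n c)) (sym (ℤ.suc-* (+ n) c))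

  ∑-swap : ∀ n m (f : ℕ → ℕ → ℤ) → ∑ n (λ i → ∑ m (f i)) ≡ ∑ m (λ j → ∑ n (λ i → f i j))
  ∑-swap zero    m f = sym (∑-0 m)
  ∑-swap (suc n) m f = trans (cong (_+_ (∑ m (f 0))) (∑-swap n m (f ∘ suc))) (sym (∑-+ m (f 0) _))

  ∑-snoc : ∀ n f → ∑ (suc n) f ≡ ∑ n f + f n
  ∑-snoc zero    f = ℤ.+-comm (f 0) 0ℤ
  ∑-snoc (suc n) f = trans (cong (_+_ (f 0)) (∑-snoc n (f ∘ suc))) (sym (ℤ.+-assoc (f 0) _ _))

  ∑-append : ∀ m n f → ∑ (m ℕ.+ n) f ≡ ∑ m f + ∑ n (λ i → f (m ℕ.+ i))
  ∑-append zero    n f = sym (ℤ.+-identityˡ _)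
  ∑-append (suc m) n f = trans (cong (_+_ (f 0)) (∑-append m n (f ∘ suc))) (sym (ℤ.+-assoc (f 0) _ _))

  ∑-blocks : ∀ p h f → ∑ (p ℕ.* h) f ≡ ∑ p (λ i → ∑ h (λ x → f (i ℕ.* h ℕ.+ x)))
  ∑-blocks zero    h f = refl
  ∑-blocks (suc p) h f = trans (∑-append h (p ℕ.* h) f) (cong (_+_ (∑ h f))
    (trans (∑-blocks p h (λ i → f (h ℕ.+ i))) (∑-cong p λ i → ∑-cong h λ x → cong f (sym (ℕ.+-assoc h (i ℕ.* h) x)))))

  lift : (ℕ → ℕ → ℤ) → Test
  lift ψ (a , b , _) = ψ a b

  infix 9 ⟦_⟧₂
  ⟦_⟧₂ : P2 → (ℕ → ℕ → ℤ) → ℤ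
  ⟦ A ⟧₂ ψ = ⟦ embed A ⟧ (lift ψ)

  ⟦++⟧₂ : ∀ A B ψ → ⟦ A ++ B ⟧₂ ψ ≡ ⟦ A ⟧₂ ψ + ⟦ B ⟧₂ ψ
  ⟦++⟧₂ A B ψ = trans (cong (λ P → ⟦ P ⟧ (lift ψ)) (map-++ _ A B)) (⟦++⟧ (embed A) (embed B) (lift ψ))

  ⟦map-upTo⟧ : ∀ n (w : ℕ → ℕ) (t : ℕ → Term) φ → ⟦ map t (applyUpTo w n) ⟧ φ ≡ ∑ n (λ i → coef (t (w i)) * φ (exponent (t (w i))))
  ⟦map-upTo⟧ zero    w t φ = refl
  ⟦map-upTo⟧ (suc n) w t φ = cong (_+_ (coef (t (w 0)) * φ (exponent (t (w 0))))) (⟦map-upTo⟧ n (w ∘ suc) t φ)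

  ⟦embed-map-upTo⟧ : ∀ n (w : ℕ → ℕ) (t : ℕ → ℤ × ℕ × ℕ) φ →
    ⟦ embed (map t (applyUpTo w n)) ⟧ φ ≡ ∑ n (λ i → proj₁ (t (w i)) * φ (proj₁ (proj₂ (t (w i))) , proj₂ (proj₂ (t (w i))) , noX))
  ⟦embed-map-upTo⟧ zero    w t φ = refl
  ⟦embed-map-upTo⟧ (suc n) w t φ = cong (_+_ (proj₁ (t (w 0)) * φ (proj₁ (proj₂ (t (w 0))) , proj₂ (proj₂ (t (w 0))) , noX))) (⟦embed-map-upTo⟧ n (w ∘ suc) t φ)

  -- ψ is annihilated by 1 + q^h + ... + q^{(M-1)h}.
  Annihilated : (M h : ℕ) → (ℕ → ℕ → ℤ) → Set
  Annihilated M h ψ = ∀ a b → ∑ M (λ i → ψ a (b ℕ.+ i ℕ.* h)) ≡ 0ℤ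

  annihilated⇒kills : ∀ M h ψ → Annihilated M h ψ → Kills (cyclotomic M h) ψ
  annihilated⇒kills M h ψ an a b = trans (⟦map-upTo⟧ M id (λ i → term (+ 1) 0 (i ℕ.* h) noX) _)
    (trans (∑-cong M λ i → trans (ℤ.*-identityˡ _) (cong (λ x → ψ x (b ℕ.+ i ℕ.* h)) (ℕ.+-identityʳ a))) (an a b))

  -- A test function annihilated by [p^{j+1}] is, up to the factor p, the sum of one annihilated by [p^j]
  -- and one annihilated by the cyclotomic factor [p^{j+1}] / [p^j].
  combine : ∀ (p : ℕ) .{{_ : NonZero p}} (s : ℕ) A →
    (∀ j → j < s → ∀ ψ → Annihilated p (p ℕ.^ j) ψ → ⟦ A ⟧₂ ψ ≡ 0ℤ) →
    ∀ j → j ≤ s → ∀ ψ → Annihilated (p ℕ.^ j) 1 ψ → ⟦ A ⟧₂ ψ ≡ 0ℤ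
  combine p s A H zero    _   ψ an = trans (⟦⟧-cong (embed A) λ { (a , b , _) →
    trans (cong (ψ a) (sym (ℕ.+-identityʳ b))) (trans (sym (ℤ.+-identityʳ (ψ a (b ℕ.+ 0)))) (an a b)) }) (⟦⟧-0 (embed A))
  combine p s A H (suc j) j<s ψ an = ℤ.*-cancelˡ-≡ (+ p) _ _ (trans scaled (sym (ℤ.*-zeroʳ (+ p))))
    where
    open ≡-Reasoning
    h = p ℕ.^ j
    -- `σ` is the transpose of multiplication by the cyclotomic factor applied to ψ. On functions of
    -- period h this operation is multiplication by p, and `σ` itself is such a function, so it
    -- annihilates p ψ - σ.
    σ χ : ℕ → ℕ → ℤ
    σ a b = ∑ p (λ i → ψ a (b ℕ.+ i ℕ.* h))
    χ a b = + p * ψ a b - σ a b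
    σ-annihilated : Annihilated h 1 σ
    σ-annihilated a b = begin
      ∑ h (λ x → ∑ p (λ i → ψ a (b ℕ.+ x ℕ.* 1 ℕ.+ i ℕ.* h)))
        ≡⟨ ∑-swap h p _ ⟩
      ∑ p (λ i → ∑ h (λ x → ψ a (b ℕ.+ x ℕ.* 1 ℕ.+ i ℕ.* h)))
        ≡⟨ (∑-cong p λ i → ∑-cong h λ x → cong (ψ a) (regroup i x)) ⟩
      ∑ p (λ i → ∑ h (λ x → ψ a (b ℕ.+ (i ℕ.* h ℕ.+ x) ℕ.* 1)))
        ≡⟨ sym (∑-blocks p h (λ y → ψ a (b ℕ.+ y ℕ.* 1))) ⟩
      ∑ (p ℕ.* h) (λ y → ψ a (b ℕ.+ y ℕ.* 1))
        ≡⟨ an a b ⟩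
      0ℤ ∎
      where
      regroup : ∀ i x → b ℕ.+ x ℕ.* 1 ℕ.+ i ℕ.* h ≡ b ℕ.+ (i ℕ.* h ℕ.+ x) ℕ.* 1
      regroup i x = trans (cong (λ y → b ℕ.+ y ℕ.+ i ℕ.* h) (ℕ.*-identityʳ x))
        (trans (ℕ.+-assoc b x (i ℕ.* h)) (cong (b ℕ.+_) (trans (ℕ.+-comm x (i ℕ.* h)) (sym (ℕ.*-identityʳ (i ℕ.* h ℕ.+ x))))))
    -- The windows of length h starting at b and b + 1 both sum to zero and differ only in their end
    -- values.
    σ-periodic : ∀ a b → σ a (b ℕ.+ h) ≡ σ a b
    σ-periodic a b = begin
      σ a (b ℕ.+ h) ≡⟨ sym (ℤ.+-identityˡ _) ⟩
      0ℤ + σ a (b ℕ.+ h) ≡⟨ cong (_+ σ a (b ℕ.+ h)) (sym (trans (∑-cong h λ i → cong (λ x → σ a (b ℕ.+ x)) (sym (ℕ.*-identityʳ i))) (σ-annihilated a b))) ⟩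
      ∑ h (λ i → σ a (b ℕ.+ i)) + σ a (b ℕ.+ h) ≡⟨ sym (∑-snoc h (λ i → σ a (b ℕ.+ i))) ⟩
      σ a (b ℕ.+ 0) + ∑ h (λ i → σ a (b ℕ.+ suc i))
        ≡⟨ cong₂ _+_ (cong (σ a) (ℕ.+-identityʳ b)) (trans (∑-cong h λ i → cong (σ a) (trans (ℕ.+-suc b i) (cong (λ x → suc b ℕ.+ x) (sym (ℕ.*-identityʳ i))))) (σ-annihilated a (suc b))) ⟩
      σ a b + 0ℤ ≡⟨ ℤ.+-identityʳ _ ⟩
      σ a b ∎
    σ-multiple : ∀ a b i → σ a (b ℕ.+ i ℕ.* h) ≡ σ a b
    σ-multiple a b zero    = cong (σ a) (ℕ.+-identityʳ b)
    σ-multiple a b (suc i) = trans (cong (σ a) (sym (ℕ.+-assoc b h (i ℕ.* h)))) (trans (σ-multiple a (b ℕ.+ h) i) (σ-periodic a b))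
    χ-annihilated : Annihilated p h χ
    χ-annihilated a b = begin
      ∑ p (λ i → + p * ψ a (b ℕ.+ i ℕ.* h) + - σ a (b ℕ.+ i ℕ.* h))
        ≡⟨ ∑-+ p _ _ ⟩
      ∑ p (λ i → + p * ψ a (b ℕ.+ i ℕ.* h)) + ∑ p (λ i → - σ a (b ℕ.+ i ℕ.* h))
        ≡⟨ cong₂ _+_ (∑-* p (+ p) _) (trans (∑-cong p λ i → cong -_ (σ-multiple a b i)) (∑-const p (- σ a b))) ⟩
      + p * σ a b + + p * - σ a b
        ≡⟨ lemma (+ p) (σ a b) ⟩
      0ℤ ∎
      where
      lemma : ∀ x y → x * y + x * - y ≡ 0ℤ
      lemma = solve-∀
    scaled : + p * ⟦ A ⟧₂ ψ ≡ 0ℤ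
    scaled = begin
      + p * ⟦ A ⟧₂ ψ
        ≡⟨ sym (⟦⟧-* (embed A) (+ p) (lift ψ)) ⟩
      ⟦ embed A ⟧ (λ o → + p * lift ψ o)
        ≡⟨ ⟦⟧-cong (embed A) (λ { (a , b , _) → lemma (+ p * ψ a b) (σ a b) }) ⟩
      ⟦ embed A ⟧ (λ o → lift χ o + lift σ o)
        ≡⟨ ⟦⟧-+ (embed A) (lift χ) (lift σ) ⟩
      ⟦ A ⟧₂ χ + ⟦ A ⟧₂ σ
        ≡⟨ cong₂ _+_ (H j j<s χ χ-annihilated) (combine p s A H j (ℕ.<⇒≤ j<s) σ σ-annihilated) ⟩
      0ℤ ∎
      where
      lemma : ∀ x y → x ≡ (x - y) + y
      lemma = solve-∀

  embed-mul2 : ∀ A B → embed (mul2 A B) ≡ mulP (embed A) (embed B)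
  embed-mul2 []              B = refl
  embed-mul2 ((c , a , b) ∷ A) B = trans (map-++ _ _ (mul2 A B)) (cong₂ _++_ (row B) (embed-mul2 A B))
    where
    row : ∀ B → embed (map (λ { (c' , a' , b') → (c * c' , a ℕ.+ a' , b ℕ.+ b') }) B) ≡ map (mulT (term c a b noX)) (embed B)
    row []      = refl
    row (t ∷ B) = cong (_ ∷_) (row B)

  coeff2-δ : ∀ A a b → coeff2 A a b ≡ ⟦ A ⟧₂ (λ a' b' → if (a' ≡ᵇ a) ∧ (b' ≡ᵇ b) then 1ℤ else 0ℤ)
  coeff2-δ []                  a b = refl
  coeff2-δ ((c , a' , b') ∷ A) a b with (a' ≡ᵇ a) ∧ (b' ≡ᵇ b)
  ... | true  = cong₂ _+_ (sym (ℤ.*-identityʳ c)) (coeff2-δ A a b)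
  ... | false = trans (coeff2-δ A a b) (sym (trans (cong (_+ ⟦ A ⟧₂ _) (ℤ.*-zeroʳ c)) (ℤ.+-identityˡ _)))

  module Division (M' : ℕ) where
    private
      M = suc M'

    D : P2
    D = map (λ i → (+ 1 , 0 , i)) (upTo M)

    -- The transpose of multiplication by `D`: a polynomial multiple of `D` pairs with ψ as its
    -- quotient pairs with `D★ ψ`.
    D★ : (ℕ → ℕ → ℤ) → ℕ → ℕ → ℤ
    D★ ψ a b = ∑ M (λ i → ψ a (b ℕ.+ i))

    ⟦mul2-D⟧ : ∀ Q ψ → ⟦ mul2 Q D ⟧₂ ψ ≡ ⟦ Q ⟧₂ (D★ ψ)
    ⟦mul2-D⟧ Q ψ = trans (cong (λ P → ⟦ P ⟧ (lift ψ)) (embed-mul2 Q D)) (trans (⟦mulP⟧ (embed Q) (embed D) (lift ψ))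
      (⟦⟧-cong (embed Q) λ { (a , b , e) → trans (⟦embed-map-upTo⟧ M id (λ i → (+ 1 , 0 , i)) (λ o → lift ψ ((a , b , e) ⊕ o)))
        (∑-cong M λ i → trans (ℤ.*-identityˡ (ψ (a ℕ.+ 0) (b ℕ.+ i))) (cong (λ x → ψ x (b ℕ.+ i)) (ℕ.+-identityʳ a))) }))

    Below : ℕ → P2 → Set
    Below B = All (λ { (_ , _ , b) → b < B })

    -- Division with remainder by the monic polynomial `D` of degree M' in q, stated through
    -- functionals so that no terms need collecting.
    Divides : P2 → Set
    Divides A = ∃ λ Q → ∃ λ R → Below M' R × (∀ ψ → ⟦ A ⟧₂ ψ ≡ ⟦ Q ⟧₂ (D★ ψ) + ⟦ R ⟧₂ ψ)

    divides-++ : ∀ A B → Divides A → Divides B → Divides (A ++ B)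
    divides-++ A B (Q , R , bd , eq) (Q' , R' , bd' , eq') = Q ++ Q' , R ++ R' , ++⁺ bd bd' , λ ψ → begin
      ⟦ A ++ B ⟧₂ ψ ≡⟨ trans (⟦++⟧₂ A B ψ) (cong₂ _+_ (eq ψ) (eq' ψ)) ⟩
      (⟦ Q ⟧₂ (D★ ψ) + ⟦ R ⟧₂ ψ) + (⟦ Q' ⟧₂ (D★ ψ) + ⟦ R' ⟧₂ ψ) ≡⟨ lemma (⟦ Q ⟧₂ (D★ ψ)) (⟦ R ⟧₂ ψ) (⟦ Q' ⟧₂ (D★ ψ)) (⟦ R' ⟧₂ ψ) ⟩
      (⟦ Q ⟧₂ (D★ ψ) + ⟦ Q' ⟧₂ (D★ ψ)) + (⟦ R ⟧₂ ψ + ⟦ R' ⟧₂ ψ) ≡⟨ sym (cong₂ _+_ (⟦++⟧₂ Q Q' (D★ ψ)) (⟦++⟧₂ R R' ψ)) ⟩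
      ⟦ Q ++ Q' ⟧₂ (D★ ψ) + ⟦ R ++ R' ⟧₂ ψ ∎
      where
      open ≡-Reasoning
      lemma : ∀ a b c d → (a + b) + (c + d) ≡ (a + c) + (b + d)
      lemma = solve-∀

    reduce : ∀ c a b → b ≤ M' → Divides ((c , a , b) ∷ [])
    reduce c a b b≤ with ℕ.m≤n⇒m<n∨m≡n b≤
    ... | inj₁ b< = [] , (c , a , b) ∷ [] , b< ∷ [] , λ ψ → sym (ℤ.+-identityˡ _)
    -- The leading power is rewritten as q^{M'} = D - (1 + q + ... + q^{M'-1}).
    ... | inj₂ refl = (c , a , 0) ∷ [] , map (λ i → (- c , a , i)) (upTo M') , map⁺ (AllP.applyUpTo⁺₁ id M' id) , λ ψ → begin
      c * ψ a M' + 0ℤ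
        ≡⟨ lemma c (ψ a M') (∑ M' (ψ a)) ⟩
      (c * (∑ M' (ψ a) + ψ a M') + 0ℤ) + - c * ∑ M' (ψ a)
        ≡⟨ sym (cong₂ (λ x y → (c * x + 0ℤ) + y) (∑-snoc M' (ψ a))
             (trans (⟦embed-map-upTo⟧ M' id (λ i → (- c , a , i)) (lift ψ)) (∑-* M' (- c) (ψ a)))) ⟩
      (c * ∑ M (λ i → ψ a (0 ℕ.+ i)) + 0ℤ) + ⟦ map (λ i → (- c , a , i)) (upTo M') ⟧₂ ψ ∎
      where
      open ≡-Reasoning
      lemma : ∀ c x y → c * x + 0ℤ ≡ (c * (y + x) + 0ℤ) + - c * y
      lemma = solve-∀

    raise : P2 → P2
    raise = map λ { (c , a , b) → (c , a , suc b) }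

    ⟦raise⟧ : ∀ A ψ → ⟦ raise A ⟧₂ ψ ≡ ⟦ A ⟧₂ (λ a b → ψ a (suc b))
    ⟦raise⟧ []      ψ = refl
    ⟦raise⟧ ((c , a , b) ∷ A) ψ = cong (_+_ (c * ψ a (suc b))) (⟦raise⟧ A ψ)

    divides-raise : ∀ R → Below M' R → Divides (raise R)
    divides-raise []                []        = [] , [] , [] , λ _ → refl
    divides-raise ((c , a , b) ∷ R) (b< ∷ bs) = divides-++ ((c , a , suc b) ∷ []) (raise R) (reduce c a (suc b) b<) (divides-raise R bs)

    -- Induction on the exponent of q: multiplying by q raises the remainder to degree at most M',
    -- and one further reduction suffices.
    divides-term : ∀ c a b → Divides ((c , a , b) ∷ [])
    divides-term c a zero    = reduce c a 0 z≤n
    divides-term c a (suc b) with divides-term c a b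
    ... | Q , R , bd , eq with divides-raise R bd
    ...   | Q' , R' , bd' , eq' = raise Q ++ Q' , R' , bd' , λ ψ → begin
      c * ψ a (suc b) + 0ℤ ≡⟨ eq (λ a b → ψ a (suc b)) ⟩
      ⟦ Q ⟧₂ (D★ (λ a b → ψ a (suc b))) + ⟦ R ⟧₂ (λ a b → ψ a (suc b)) ≡⟨ cong₂ _+_ (sym (⟦raise⟧ Q (D★ ψ))) (trans (sym (⟦raise⟧ R ψ)) (eq' ψ)) ⟩
      ⟦ raise Q ⟧₂ (D★ ψ) + (⟦ Q' ⟧₂ (D★ ψ) + ⟦ R' ⟧₂ ψ) ≡⟨ sym (ℤ.+-assoc (⟦ raise Q ⟧₂ (D★ ψ)) _ _) ⟩
      (⟦ raise Q ⟧₂ (D★ ψ) + ⟦ Q' ⟧₂ (D★ ψ)) + ⟦ R' ⟧₂ ψ ≡⟨ cong (_+ ⟦ R' ⟧₂ ψ) (sym (⟦++⟧₂ (raise Q) Q' (D★ ψ))) ⟩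
      ⟦ raise Q ++ Q' ⟧₂ (D★ ψ) + ⟦ R' ⟧₂ ψ ∎
      where open ≡-Reasoning

    divide : ∀ A → Divides A
    divide []                = [] , [] , [] , λ _ → refl
    divide ((c , a , b) ∷ A) = divides-++ ((c , a , b) ∷ []) A (divides-term c a b) (divide A)

    bit : Bool → ℤ
    bit t = if t then 1ℤ else 0ℤ

    ∑-bit : ∀ n b → b < n → ∑ n (λ i → bit (i ≡ᵇ b)) ≡ 1ℤ
    ∑-bit (suc n) zero    _       = cong (_+_ (1ℤ)) (∑-0 n)
    ∑-bit (suc n) (suc b) (s≤s l) = trans (ℤ.+-identityˡ _) (∑-bit n b l)

    -- Agrees with the coefficient functional at (a₀ , b₀) on remainders and is annihilated by D.
    dual : ℕ → ℕ → ℕ → ℕ → ℤ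
    dual a₀ b₀ a b = bit (a ≡ᵇ a₀) * (bit (b % M ≡ᵇ b₀) - bit (b % M ≡ᵇ M'))

    -- Among M consecutive integers each residue modulo M occurs once, so the contributions of `b₀`
    -- and `M'` cancel.
    dual-annihilated : ∀ a₀ b₀ → b₀ < M' → ∀ a b → D★ (dual a₀ b₀) a b ≡ 0ℤ
    dual-annihilated a₀ b₀ b₀< a b = trans (∑-* M (bit (a ≡ᵇ a₀)) (λ i → g (b ℕ.+ i))) (trans (cong (bit (a ≡ᵇ a₀) *_) (trans (shift b) base)) (ℤ.*-zeroʳ (bit (a ≡ᵇ a₀))))
      where
      open ≡-Reasoning
      g : ℕ → ℤ
      g x = bit (x % M ≡ᵇ b₀) - bit (x % M ≡ᵇ M')
      shift : ∀ b → ∑ M (λ i → g (b ℕ.+ i)) ≡ ∑ M g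
      shift zero    = refl
      shift (suc b) = trans (∙-cancelˡ (g (b ℕ.+ 0)) _ _ (begin
        g (b ℕ.+ 0) + ∑ M (λ i → g (suc b ℕ.+ i)) ≡⟨ cong (_+_ (g (b ℕ.+ 0))) (∑-cong M λ i → cong g (sym (ℕ.+-suc b i))) ⟩
        ∑ (suc M) (λ i → g (b ℕ.+ i)) ≡⟨ ∑-snoc M (λ i → g (b ℕ.+ i)) ⟩
        ∑ M (λ i → g (b ℕ.+ i)) + g (b ℕ.+ M) ≡⟨ cong (_+_ (∑ M (λ i → g (b ℕ.+ i)))) (trans (cong (λ x → bit (x ≡ᵇ b₀) - bit (x ≡ᵇ M')) ([m+n]%n≡m%n b M)) (cong g (sym (ℕ.+-identityʳ b)))) ⟩
        ∑ M (λ i → g (b ℕ.+ i)) + g (b ℕ.+ 0) ≡⟨ ℤ.+-comm _ (g (b ℕ.+ 0)) ⟩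
        g (b ℕ.+ 0) + ∑ M (λ i → g (b ℕ.+ i)) ∎)) (shift b)
      base : ∑ M g ≡ 0ℤ
      base = begin
        ∑ M g ≡⟨ ∑-cong< M (λ {i} i< → cong (λ x → bit (x ≡ᵇ b₀) - bit (x ≡ᵇ M')) (m<n⇒m%n≡m i<)) ⟩
        ∑ M (λ i → bit (i ≡ᵇ b₀) + - bit (i ≡ᵇ M')) ≡⟨ ∑-+ M (λ i → bit (i ≡ᵇ b₀)) (λ i → - bit (i ≡ᵇ M')) ⟩
        ∑ M (λ i → bit (i ≡ᵇ b₀)) + ∑ M (λ i → - bit (i ≡ᵇ M'))
          ≡⟨ cong₂ _+_ (∑-bit M b₀ (ℕ.m<n⇒m<1+n b₀<)) (trans (∑-cong M λ i → sym (ℤ.-1*i≡-i (bit (i ≡ᵇ M')))) (trans (∑-* M (- 1ℤ) (λ i → bit (i ≡ᵇ M'))) (cong (- 1ℤ *_) (∑-bit M M' (ℕ.n<1+n M'))))) ⟩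
        0ℤ ∎

    dual-remainder : ∀ a₀ b₀ a b → b < M' → dual a₀ b₀ a b ≡ (if (a ≡ᵇ a₀) ∧ (b ≡ᵇ b₀) then 1ℤ else 0ℤ)
    dual-remainder a₀ b₀ a b b< = trans
      (cong₂ (λ x t → bit (a ≡ᵇ a₀) * (bit (x ≡ᵇ b₀) - bit t)) mod (trans (cong (_≡ᵇ M') mod) b≢M'))
      (and (a ≡ᵇ a₀) (b ≡ᵇ b₀))
      where
      mod : b % M ≡ b
      mod = m<n⇒m%n≡m (ℕ.m<n⇒m<1+n b<)
      b≢M' : (b ≡ᵇ M') ≡ false
      b≢M' with b ≡ᵇ M' in eq
      ... | false = refl
      ... | true  = ⊥-elim (ℕ.<⇒≢ b< (ℕ.≡ᵇ⇒≡ b M' (subst T (sym eq) _)))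
      and : ∀ s t → bit s * (bit t - 0ℤ) ≡ bit (s ∧ t)
      and true  true  = refl
      and true  false = refl
      and false true  = refl
      and false false = refl

    -- The remainder must vanish. Its coefficients with b < M' are values of `dual`, which vanishes
    -- on `A` by hypothesis and on multiples of `D`; there are no coefficients with b at least M'.
    annihilated⇒divisible : ∀ A → (∀ ψ → Annihilated M 1 ψ → ⟦ A ⟧₂ ψ ≡ 0ℤ) → D ∣₂ A
    annihilated⇒divisible A H with divide A
    ... | Q , R , bd , eq = Q , λ a b → begin
      coeff2 A a b ≡⟨ trans (coeff2-δ A a b) (eq (δ a b)) ⟩
      ⟦ Q ⟧₂ (D★ (δ a b)) + ⟦ R ⟧₂ (δ a b) ≡⟨ cong (_+_ (⟦ Q ⟧₂ (D★ (δ a b)))) (remainder a b) ⟩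
      ⟦ Q ⟧₂ (D★ (δ a b)) + 0ℤ ≡⟨ ℤ.+-identityʳ _ ⟩
      ⟦ Q ⟧₂ (D★ (δ a b)) ≡⟨ sym (trans (coeff2-δ (mul2 Q D) a b) (⟦mul2-D⟧ Q (δ a b))) ⟩
      coeff2 (mul2 Q D) a b ∎
      where
      open ≡-Reasoning
      δ : ℕ → ℕ → ℕ → ℕ → ℤ
      δ a b a' b' = if (a' ≡ᵇ a) ∧ (b' ≡ᵇ b) then 1ℤ else 0ℤ
      remainder : ∀ a b → ⟦ R ⟧₂ (δ a b) ≡ 0ℤ
      remainder a b with b ℕ.<? M'
      ... | no b≮ = ⟦⟧-vanish {embed R} (map⁺ (All.map (λ { {c , a' , b'} b'< → off a' b' b'< }) bd))
        where
        off : ∀ a' b' → b' < M' → δ a b a' b' ≡ 0ℤ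
        off a' b' b'< with b' ≡ᵇ b in e
        ... | false = cong bit (∧-zeroʳ (a' ≡ᵇ a))
        ... | true  = ⊥-elim (b≮ (subst (_< M') (ℕ.≡ᵇ⇒≡ b' b (subst T (sym e) _)) b'<))
      ... | yes b< = begin
        ⟦ R ⟧₂ (δ a b) ≡⟨ ⟦⟧-cong-All {embed R} (map⁺ (All.map (λ { {c , a' , b'} b'< → sym (dual-remainder a b a' b' b'<) }) bd)) ⟩
        ⟦ R ⟧₂ ψ ≡⟨ sym (ℤ.+-identityˡ _) ⟩
        0ℤ + ⟦ R ⟧₂ ψ ≡⟨ cong (_+ ⟦ R ⟧₂ ψ) (sym (trans (⟦⟧-cong (embed Q) (λ { (a' , b' , _) → dual-annihilated a b b< a' b' })) (⟦⟧-0 (embed Q)))) ⟩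
        ⟦ Q ⟧₂ (D★ ψ) + ⟦ R ⟧₂ ψ ≡⟨ sym (eq ψ) ⟩
        ⟦ A ⟧₂ ψ ≡⟨ H ψ (λ a' b' → trans (∑-cong M λ i → cong (λ x → ψ a' (b' ℕ.+ x)) (ℕ.*-identityʳ i)) (dual-annihilated a b b< a' b')) ⟩
        0ℤ ∎
        where
        ψ : ℕ → ℕ → ℤ
        ψ = dual a b

-- The Frobenius twist and the congruence.

module Congruences where
  open import Defs
  open QBinomial
  open Arithmetic
  open Quotients
  open Evaluation
  open Multiplicativity
  open CoefficientExtraction
  open CoefficientSplitting
  open Divisibility
  open import Algebra.Bundles using (CommutativeRing)
  open import Algebra.Morphism.Structures using (module RingMorphisms)
  open import Data.Bool using (Bool; true; false; if_then_else_)
  open import Data.Nat as ℕ using (ℕ; zero; suc; _+_; _*_; _≤_; _<_; _∸_; NonZero; _≡ᵇ_)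
  import Data.Nat.Properties as ℕ
  open import Data.Nat.DivMod using (_%_)
  open import Data.Nat.Divisibility using (_∣_)
  open import Data.Nat.Primality using (Prime; prime⇒nonZero)
  open import Data.Integer as ℤ using (ℤ)
  import Data.Integer.Properties as ℤ
  open import Data.List using ([]; _∷_; _++_; map; upTo)
  open import Data.Product using (_,_; ∃)
  open import Function using (id)
  open import Relation.Nullary using (¬_)
  open import Relation.Binary.PropositionalEquality hiding (setoid)

  frobenius : ℕ → Exponent → Exponent
  frobenius p (a , b , e) = p * a , p * b , e

  -- Replacing q by q^p turns the cyclotomic polynomial for p h into the one for p^2 h, so
  -- congruences move up one level.
  frobenius-substitution : ∀ p h → IsSubstitution (cyclotomic p h) (cyclotomic p (p * h)) (frobenius p)
  frobenius-substitution p h = record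
    { f-cong = λ e → ≐[ cong (p *_) (z≡ e) , cong (p *_) (q≡ e) , x≡ e ]
    ; f-⊕    = λ { (a , b , _) (a' , b' , _) → ≐[ ℕ.*-distribˡ-+ p a a' , ℕ.*-distribˡ-+ p b b' , (λ _ _ → refl) ] }
    ; f-𝟎    = ≐[ ℕ.*-zeroʳ p , ℕ.*-zeroʳ p , (λ _ _ → refl) ]
    ; f-kill = λ { {φ} adm (a , b , e) → trans
        (trans (⟦map-upTo⟧ p id (λ i → term (ℤ.+ 1) 0 (i * h) noX) _)
        (trans (∑-cong p λ i → cong (ℤ.1ℤ ℤ.*_) (ext adm (dilate a b e i)))
          (sym (⟦map-upTo⟧ p id (λ i → term (ℤ.+ 1) 0 (i * (p * h)) noX) (λ o → φ (frobenius p (a , b , e) ⊕ o))))))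
        (kill adm (frobenius p (a , b , e))) }
    }
    where
    dilate : ∀ a b e i → frobenius p ((a , b , e) ⊕ (0 , i * h , noX)) ≐ frobenius p (a , b , e) ⊕ (0 , i * (p * h) , noX)
    dilate a b e i = ≐[ trans (cong (p *_) (ℕ.+-identityʳ a)) (sym (ℕ.+-identityʳ (p * a)))
      , trans (ℕ.*-distribˡ-+ p b (i * h)) (cong (p * b +_) (trans (sym (ℕ.*-assoc p i h)) (trans (cong (_* h) (ℕ.*-comm p i)) (ℕ.*-assoc i p h))))
      , (λ _ _ → refl) ]

  signed : Bool → Poly → Poly
  signed b A = if b then A else negate A

  embed-signed : ∀ b A → embed (if b then A else neg2 A) ≡ signed b (embed A)
  embed-signed true  A       = refl
  embed-signed false []      = refl
  embed-signed false (t ∷ A) = cong (_ ∷_) (embed-signed false A)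

  substitute-signed : ∀ b f A → substitute f (signed b A) ≡ signed b (substitute f A)
  substitute-signed true  f A       = refl
  substitute-signed false f []      = refl
  substitute-signed false f (t ∷ A) = cong (_ ∷_) (substitute-signed false f A)

  embed-frob : ∀ p A → embed (frob p A) ≡ substitute (frobenius p) (embed A)
  embed-frob p []      = refl
  embed-frob p (t ∷ A) = cong (_ ∷_) (embed-frob p A)

  embed-sub2 : ∀ A B → embed (sub2 A B) ≡ embed A ++ negate (embed B)
  embed-sub2 []      B = embed-signed false B
  embed-sub2 (t ∷ A) B = cong (_ ∷_) (embed-sub2 A B)

  signed-* : ∀ C b A B → mulP (signed b A) (signed b B) ≋[ C ] mulP A B
  signed-* C true  A B = CommutativeRing.refl (quotientRing C) {mulP A B}
  signed-* C false A B = ≋-by λ {φ} adm → begin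
    ⟦ mulP (negate A) (negate B) ⟧ φ ≡⟨ ⟦mulP⟧ (negate A) (negate B) φ ⟩
    ⟦ negate A ⟧ (λ m → ⟦ negate B ⟧ (λ o → φ (m ⊕ o))) ≡⟨ ⟦negate⟧ A _ ⟩
    ℤ.- ⟦ A ⟧ (λ m → ⟦ negate B ⟧ (λ o → φ (m ⊕ o))) ≡⟨ cong ℤ.-_ (⟦⟧-cong A λ m → trans (⟦negate⟧ B _) (sym (ℤ.-1*i≡-i _))) ⟩
    ℤ.- ⟦ A ⟧ (λ m → ℤ.-1ℤ ℤ.* ⟦ B ⟧ (λ o → φ (m ⊕ o))) ≡⟨ cong ℤ.-_ (trans (⟦⟧-* A ℤ.-1ℤ _) (ℤ.-1*i≡-i _)) ⟩
    ℤ.- (ℤ.- ⟦ A ⟧ (λ m → ⟦ B ⟧ (λ o → φ (m ⊕ o)))) ≡⟨ ℤ.neg-involutive _ ⟩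
    ⟦ A ⟧ (λ m → ⟦ B ⟧ (λ o → φ (m ⊕ o))) ≡⟨ sym (⟦mulP⟧ A B φ) ⟩
    ⟦ mulP A B ⟧ φ ∎
    where open ≡-Reasoning

  module Congruence {p : ℕ} (pr : Prime p) (p-odd : Odd p) (r m l n k : ℕ) .{{_ : NonZero m}} (N : ℤ)
    (2r≤m : 2 * r ≤ m) (p≡ : p ≡ l * m + 1) (2k≤n : 2 * k ≤ n) where

    private
      c X : ℕ → Poly
      c s = embed (coeffX p n k s (Φ p r m n k s))
      X s = embed (Tpoly p r m n k N s)

      Fr : Poly → Poly
      Fr = substitute (frobenius p)

      positive : ℕ → Bool
      positive s = ((Eω p r m n k s * ℤ.∣ N ∣) % 2) ≡ᵇ 0

      zPower : ℕ → Poly → Poly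
      zPower j' = substitute (powerZ (p ℕ.^ suc j'))

      C : ℕ → Poly
      C j' = cyclotomic p (p ℕ.^ j')

      c-split : ∀ j' t → c (suc j' + t) ≋[ C j' ] mulP (zPower j' (c t)) (c (suc j'))
      c-split j' t = Factorization.coefficients-split pr p-odd j' r m l n k 2r≤m p≡ 2k≤n t

    -- Modulo the cyclotomic factor p^{j'+1}, raising q to the p-th power leaves a factor for p^{j'};
    -- for j' = 0 it specialises q to 1.
    frobenius-split : ∀ j' → ∃ λ U → ∀ t → Fr (c (j' + t)) ≋[ C j' ] mulP (zPower j' (c t)) U
    frobenius-split zero = oneP , λ t → trans′ (specialise (c t)) (sym′ (*-identityʳ (zPower 0 (c t))))
      where
      open CommutativeRing (quotientRing (C 0)) using (*-identityʳ) renaming (trans to trans′; sym to sym′; refl to refl′)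
      open CyclotomicQuotient pr p-odd 0 using (module Q; P)
      open RingProducts (quotientRing (C 0))
      qPb : ∀ b → (term (ℤ.+ 1) 0 (P * b) noX ∷ []) ≋[ C 0 ] oneP
      qPb b = trans′ (sym′ (InQuotient.qVar^ (C 0) (P * b))) (trans′ (sym′ (^-assocʳ qVar P b)) (trans′ (^-congˡ b Q.q^P) (1^n≈1 b)))
      specialise : ∀ A → Fr A ≋[ C 0 ] zPower 0 A
      specialise A = ≋-by λ {φ} adm → trans (⟦substitute⟧ (frobenius p) A φ) (trans
        (⟦⟧-cong A λ { (a , b , e) → begin
          φ (p * a , p * b , e)
            ≡⟨ ext adm ≐[ trans (cong (_* a) (sym (ℕ.*-identityʳ p))) (sym (ℕ.+-identityʳ (P * a))) , cong (_* b) (sym (ℕ.*-identityʳ p)) , (λ i j → sym (ℕ.+-identityʳ (e i j))) ] ⟩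
          φ ((P * a , 0 , e) ⊕ (0 , P * b , noX))
            ≡⟨ sym (trans (ℤ.+-identityʳ _) (ℤ.*-identityˡ (φ ((P * a , 0 , e) ⊕ (0 , P * b , noX))))) ⟩
          ⟦ term (ℤ.+ 1) 0 (P * b) noX ∷ [] ⟧ (λ o → φ ((P * a , 0 , e) ⊕ o))
            ≡⟨ at (qPb b) (shift-admissible (P * a , 0 , e) adm) ⟩
          ⟦ oneP ⟧ (λ o → φ ((P * a , 0 , e) ⊕ o))
            ≡⟨ trans (ℤ.+-identityʳ _) (ℤ.*-identityˡ (φ ((P * a , 0 , e) ⊕ 𝟎))) ⟩
          φ ((P * a , 0 , e) ⊕ 𝟎)
            ≡⟨ ext adm ≐[ ℕ.+-identityʳ (P * a) , refl , (λ i j → ℕ.+-identityʳ (e i j)) ] ⟩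
          φ (P * a , 0 , e) ∎ })
        (sym (⟦substitute⟧ (powerZ P) A φ)))
        where open ≡-Reasoning
    -- The splitting at the previous level is carried along Frobenius. Its factor with q already set
    -- to 1 only gets its z-power raised once more, and the other factor becomes `U`.
    frobenius-split (suc j'') = Fr (c (suc j'')) , λ t → trans′ (substitute-cong (c-split j'' t))
      (trans′ (*-homo (zPower j'' (c t)) (c (suc j''))) (*-cong (compose (c t)) refl′))
      where
      open CommutativeRing (quotientRing (C (suc j''))) using (*-cong) renaming (trans to trans′; refl to refl′)
      open IsSubstitution (frobenius-substitution p (p ℕ.^ j''))
      open RingMorphisms.IsRingHomomorphism substitute-hom using (*-homo)
      compose : ∀ A → Fr (zPower j'' A) ≋[ C (suc j'') ] zPower (suc j'') A
      compose A = ≋-by λ {φ} adm → trans (trans (⟦substitute⟧ (frobenius p) (zPower j'' A) φ) (⟦substitute⟧ (powerZ (p ℕ.^ suc j'')) A _))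
        (trans (⟦⟧-cong A λ { (a , b , e) → ext adm ≐[ sym (ℕ.*-assoc p (p ℕ.^ suc j'') a) , ℕ.*-zeroʳ p , (λ _ _ → refl) ] })
          (sym (⟦substitute⟧ (powerZ (p ℕ.^ suc (suc j''))) A φ)))

    -- With j = j' + 1 and s = j + t, each product splits into T_j(z,q), `U`, and the values of T_t
    -- and T_{t+1} at z^P with q = 1. The two products differ only in which splitting received t and
    -- which t + 1.
    congruence-cyclotomic : ∀ j' t → let s = suc (j' + t) in
      mulP (c (suc s)) (Fr (c (j' + t))) ≋[ C j' ] mulP (c s) (Fr (c s))
    congruence-cyclotomic j' t with frobenius-split j'
    ... | U , U-split = begin
      mulP (c (suc (suc (j' + t)))) (Fr (c (j' + t)))
        ≡⟨ cong (λ x → mulP (c x) (Fr (c (j' + t)))) (cong suc (sym (ℕ.+-suc j' t))) ⟩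
      mulP (c (suc j' + suc t)) (Fr (c (j' + t)))
        ≈⟨ *-cong (c-split j' (suc t)) (U-split t) ⟩
      mulP (mulP a₁ b) (mulP a₀ U)
        ≈⟨ RingProducts.*-exchange (quotientRing (C j')) a₁ b a₀ U ⟩
      mulP (mulP a₀ b) (mulP a₁ U)
        ≈⟨ *-cong (sym′ (c-split j' t)) (sym′ (U-split (suc t))) ⟩
      mulP (c (suc (j' + t))) (Fr (c (j' + suc t)))
        ≡⟨ cong (λ x → mulP (c (suc (j' + t))) (Fr (c x))) (ℕ.+-suc j' t) ⟩
      mulP (c (suc (j' + t))) (Fr (c (suc (j' + t)))) ∎
      where
      open CommutativeRing (quotientRing (C j')) using (*-cong; setoid) renaming (sym to sym′)
      open import Relation.Binary.Reasoning.Setoid setoid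
      a₀ = zPower j' (c t)
      a₁ = zPower j' (c (suc t))
      b = c (suc j')

    difference : ℕ → P2
    difference s = sub2 (mul2 (Tpoly p r m n k N (suc s)) (frob p (Tpoly p r m n k N (s ∸ 1))))
                        (mul2 (Tpoly p r m n k N s) (frob p (Tpoly p r m n k N s)))

    -- When the normalising signs of both factors agree, their product is 1, and the congruence for
    -- bare coefficients carries over to T.
    signed-product : ∀ C s s' → positive s ≡ positive s' → mulP (X s) (embed (frob p (Tpoly p r m n k N s'))) ≋[ C ] mulP (c s) (Fr (c s'))
    signed-product C s s' eq = subst (λ P → P ≋[ C ] mulP (c s) (Fr (c s')))
      (sym (cong₂ mulP (embed-signed (positive s) (coeffX p n k s (Φ p r m n k s))) frob-X))
      (signed-* C (positive s) (c s) (Fr (c s')))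
      where
      frob-X : embed (frob p (Tpoly p r m n k N s')) ≡ signed (positive s) (Fr (c s'))
      frob-X = trans (embed-frob p (Tpoly p r m n k N s')) (trans (cong Fr (embed-signed (positive s') (coeffX p n k s' (Φ p r m n k s'))))
        (trans (substitute-signed (positive s') (frobenius p) (c s')) (cong (λ b → signed b (Fr (c s'))) (sym eq))))

    difference-cyclotomic : ∀ j' t → embed (difference (suc (j' + t))) ≋[ C j' ] []
    difference-cyclotomic j' t = subst (λ P → P ≋[ C j' ] []) (sym (trans (embed-sub2 (mul2 (T (suc s)) (frob p (T (j' + t)))) (mul2 (T s) (frob p (T s))))
        (cong₂ (λ x y → x ++ negate y) (embed-mul2 (T (suc s)) (frob p (T (j' + t)))) (embed-mul2 (T s) (frob p (T s))))))
      (trans′ (+-cong (trans′ (signed-product (C j') (suc s) (j' + t) parity) (trans′ (congruence-cyclotomic j' t) (sym′ (signed-product (C j') s s refl)))) (refl′ {negate Y}))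
        (-‿inverseʳ Y))
      where
      open CommutativeRing (quotientRing (C j')) using (+-cong; -‿inverseʳ) renaming (trans to trans′; sym to sym′; refl to refl′)
      s = suc (j' + t)
      T : ℕ → P2
      T s = Tpoly p r m n k N s
      Y = mulP (embed (T s)) (embed (frob p (T s)))
      parity : positive (suc s) ≡ positive (j' + t)
      parity = cong (_≡ᵇ 0) (Exponents.Eω-parity p r m l n k 2r≤m p≡ p-odd (j' + t) ℤ.∣ N ∣)

    lift-admissible : ∀ {j'} ψ → Annihilated p (p ℕ.^ j') ψ → Admissible (C j') (lift ψ)
    lift-admissible ψ an .ext e = cong₂ ψ (z≡ e) (q≡ e)
    lift-admissible {j'} ψ an .kill (a , b , _) = annihilated⇒kills p (p ℕ.^ j') ψ an a b

    -- The congruences modulo the factors at all j' < s say that the difference vanishes on tests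
    -- annihilated by a single factor. `combine` extends this to tests annihilated by [p^s]_q, and
    -- division by this monic polynomial yields the quotient.
    difference-divisible : ∀ s → qint p s ∣₂ difference s
    difference-divisible s = subst (λ M → map (λ i → (ℤ.+ 1 , 0 , i)) (upTo M) ∣₂ difference s) (sym M≡)
      (Division.annihilated⇒divisible (m * L s) (difference s) λ ψ an →
        combine p {{prime⇒nonZero pr}} s (difference s) vanish s ℕ.≤-refl ψ (subst (λ M → Annihilated M 1 ψ) (sym M≡) an))
      where
      open Exponents p r m l n k 2r≤m p≡ p-odd using (L; p^s≡)
      M≡ : p ℕ.^ s ≡ suc (m * L s)
      M≡ = p^s≡ s
      vanish : ∀ j' → j' < s → ∀ ψ → Annihilated p (p ℕ.^ j') ψ → ⟦ difference s ⟧₂ ψ ≡ ℤ.0ℤ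
      -- The cyclotomic congruence is stated for s of the form j' + 1 + t, so t is taken as s - (j'
      -- + 1).
      vanish j' j'<s ψ an = subst (λ s → ⟦ difference s ⟧₂ ψ ≡ ℤ.0ℤ) (ℕ.m+[n∸m]≡n j'<s)
        (at (difference-cyclotomic j' (s ∸ suc j')) (lift-admissible {j'} ψ an))

open import Defs
open import Data.Nat using (ℕ; suc; _+_; _*_; _≤_; _<_; _∸_; NonZero)
open import Data.Nat.Divisibility using (_∣_)
open import Data.Nat.Primality using (Prime)
open import Data.Integer using (ℤ)
open import Relation.Nullary using (¬_)
open import Relation.Binary.PropositionalEquality using (_≡_)

theorem1p1 : (r m l p k n : ℕ) .{{_ : NonZero m}} (N : ℤ) →
    0 < r → 2 * r ≤ m → 0 < l → Prime p → ¬ (2 ∣ p) → p ≡ l * m + 1 →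
    0 < k → 2 * k ≤ n →
    (s : ℕ) → 1 ≤ s →
    let T = Tpoly p r m n k N in
    qint p s ∣₂ sub2 (mul2 (T (suc s)) (frob p (T (s ∸ 1))))
    (mul2 (T s) (frob p (T s)))
theorem1p1 r m l p k n N _ 2r≤m _ pr 2∤p p≡ _ 2k≤n s _ =
  Congruences.Congruence.difference-divisible pr (Arithmetic.¬2∣⇒odd p 2∤p) r m l n k N 2r≤m p≡ 2k≤n s
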